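{- For integers $n,b\geq 1$, $k\geq 0$ and $m_1,\ldots,m_n \geq b$, the number of $(k+1)$-tuples of tight $b$-decorated trees (each coding for a $0$-slice) having in total $n$ blossoming vertices, numbered from $1$ to $n$, of respective degrees $2m_1,\ldots,2m_n$, where the first tree contains the blossoming vertex numbered $1$ (of degree $2m_1$), is equal to $$F^{(b)}_k(m_1,\ldots,m_n) := (n-1)! \sum_{k_1,\ldots,k_n \geq 0} q^{(b)}_{k_1}(m_1) \cdots q^{(b)}_{k_n}(m_n)\, \alpha^{(b)}_{k+k_1+\cdots+k_n,n-1}$$ with $$\alpha_{k,n}^{(b)} = [u^{n-k}] \frac{1}{\left( 1 - u \sum_{j=2}^b \frac1 b \binom{b}{j} \binom{b}{j-1} (-u)^{j-2} \right)^{n+1}}$$ and $$q^{(b)}_{k}(m) := \binom{m+b}{k} \binom{m-b-1+k}{k} = \frac1{(k!)^2} \prod_{i=0}^{k-1} \left( m^2 - (b-i)^2 \right).$$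
   Context: Let $b\ge1$. A $b$-decorated tree is a finite plane tree such that: - It has three types of vertices: primal, dual and edge-vertices, connected by primal half-edges (joining a primal vertex to an edge-vertex) or dual half-edges (joining a dual vertex to an edge-vertex). - It carries arrows, in number between $1$ and $b$, on all primal half-edges incident to a primal vertex of degree at least two, pointing away from that vertex (other half-edges carry no arrow); and leaflets (dangling half-edges), incident to dual vertices and contributing to their degrees. - Around each primal vertex of degree at least two, the total number of arrows is $b+1$. - It is planted on an edge-vertex of degree one, the root; all other edge-vertices have degree two. - An edge-vertex incident to two primal half-edges has both half-edges carrying arrows, with $b$ arrows in total. - An edge-vertex incident to two dual half-edges may exist only when $b=1$, and exactly one of its adjacent dual vertices has degree $2b=2$. - An edge-vertex incident to one primal and one dual half-edge (bent edge-vertex) is of one of the following types: a twig-vertex: the primal half-edge carries no arrow, hence leads to a primal vertex of degree one (the twig-vertex, its incident half-edges and the adjacent primal vertex form a twig); a special bent edge-vertex: the primal half-edge carries $b-1$ arrows and the adjacent dual vertex has degree $2b$; a regular bent edge-vertex: the primal half-edge carries $b$ arrows and the adjacent dual vertex has degree at least $2b+2$. - Each dual vertex of degree $2b$ (special) is incident to exactly one dual half-edge and $2b-1$ leaflets. - Every other dual vertex (labeled) has even degree $2m$ with $m\ge b+1$, and is adjacent to exactly $m-b-1$ twig-vertices. The trees coding for $0$-slices are those whose root edge-vertex is incident to a primal half-edge carrying $b$ arrows, together with, when $b=1$, the tree consisting of the root edge-vertex joined by a dual half-edge to a special dual vertex of degree $2$ carrying one leaflet (it codes for the $2$-angle slice).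 The blossoming vertices are the dual vertices. The root of a blossoming vertex is its dual half-edge leading towards the root of the tree; its decorations are its other incident half-edges: leaflets, twigs, or attaching points (the dual half-edges leading to its other children). A $b$-decorated tree is tight if, at each blossoming vertex, the sequence of decorations read in clockwise order from its root does not contain a twig followed immediately by a leaflet. $[u^j]$ denotes coefficient extraction (zero for $j<0$); hence $\alpha^{(b)}_{k,n}=0$ for $k>n$ and the sum is finite. The binomials in $q_k^{(b)}$ are $\binom{a}{k}=a(a-1)\cdots(a-k+1)/k!$. -}

module Defs where

open import Data.Bool.Base using (Bool; true; false; T)
open import Data.Fin.Base using (Fin; zero; suc)
open import Data.Integer.Base as ℤ using (ℤ; +_; -[1+_]; -1ℤ; _⊖_)
open import Data.List.Base
  using (List; []; _∷_; _++_; map; foldr; length; applyUpTo; zipWith; replicate; tabulate; sum; filterᵇ; concatMap)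
open import Data.List.Membership.Propositional using (_∈_)
open import Data.List.Relation.Binary.Permutation.Propositional using (_↭_)
open import Data.List.Relation.Unary.All using (All)
open import Data.List.Relation.Unary.Linked using (Linked)
open import Data.List.Relation.Unary.Unique.Propositional using (Unique)
open import Data.Nat.Base as ℕ using (ℕ; zero; suc; _∸_; _≤_; NonZero; _!)
open import Data.Nat.Combinatorics using (_C_)
open import Data.Nat.Properties using (_!≢0; _!*_!≢0)
open import Data.Product.Base using (_×_; _,_; proj₁; proj₂; ∃-syntax)
open import Data.Rational.Base as ℚ using (ℚ; 0ℚ; 1ℚ; _/_)
import Data.Rational.Properties as ℚₚ
open import Data.Sum.Base using (_⊎_)
open import Data.Vec.Base as Vec using (Vec; lookup)
open import Function.Base using (_∘_)
open import Function.Bundles using (_⇔_)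
open import Relation.Binary.PropositionalEquality
  using (_≡_; _≢_; refl; sym; cong; cong₂; module ≡-Reasoning)

-- A `Tree X` is what is seen from an edge-vertex through one of its
-- half-edges.  The whole planted tree is the value seen from its root, an
-- edge-vertex of degree one.  Every other edge-vertex has degree two and sits
-- between a vertex and one of its children, so it gets no node of its own.
-- Dual vertices carry a number in X.  Lists give the half-edges at a vertex
-- in clockwise order, starting just after the half-edge leading to the root.

data Tree (X : Set) : Set
data Decoration (X : Set) : Set

data Tree X where
  -- `primal a cs`: the half-edge to the root carries a arrows; for (c , t) in
  -- cs, a half-edge with c arrows leads to an edge-vertex whose other side is t.
  -- Having 0 arrows means carrying no arrow.
  primal : ℕ → List (ℕ × Tree X) → Tree X
  dual   : X → List (Decoration X) → Tree X

data Decoration X where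
  leaflet : Decoration X
  edge    : Tree X → Decoration X

private
  variable
    X : Set

-- The half-edge towards the root counts in the degree.
dualDegree : List (Decoration X) → ℕ
dualDegree ds = suc (length ds)

-- A half-edge with the data needed for the rules at edge-vertices: the number
-- of arrows, or the degree of the incident dual vertex.
data HalfEdge : Set where
  primal : (arrows : ℕ) → HalfEdge
  dual   : (degree : ℕ) → HalfEdge

top : Tree X → HalfEdge
top (primal a _) = primal a
top (dual _ ds)  = dual (dualDegree ds)

isTwig : Decoration X → Bool
isTwig (edge (primal zero _)) = true
isTwig _                      = false

twigs : List (Decoration X) → ℕ
twigs ds = length (filterᵇ isTwig ds)

blossoming    : Tree X → List (X × List (Decoration X))
blossomingAtP : List (ℕ × Tree X) → List (X × List (Decoration X))
blossomingAtD : List (Decoration X) → List (X × List (Decoration X))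

blossoming (primal _ cs) = blossomingAtP cs
blossoming (dual x ds)   = (x , ds) ∷ blossomingAtD ds

blossomingAtP []             = []
blossomingAtP ((_ , t) ∷ cs) = blossoming t ++ blossomingAtP cs

blossomingAtD []             = []
blossomingAtD (leaflet ∷ ds) = blossomingAtD ds
blossomingAtD (edge t ∷ ds)  = blossoming t ++ blossomingAtD ds

-- The argument lists the numbers of arrows on all half-edges at the vertex.
PrimalRule : ℕ → List ℕ → Set
PrimalRule b as =
    (as ≡ 0 ∷ [])
  ⊎ (2 ≤ length as × All (λ a → 1 ≤ a × a ≤ b) as × sum as ≡ b ℕ.+ 1)

-- The half-edge towards the root never belongs to a twig (the primal vertex
-- of a twig has degree one), so twigs are counted among the decorations; it
-- is also the only dual half-edge at a special vertex.
DualRule : ℕ → List (Decoration X) → Set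
DualRule b ds =
    (dualDegree ds ≡ 2 ℕ.* b × ds ≡ replicate (2 ℕ.* b ∸ 1) leaflet)
  ⊎ (∃[ m ] b ℕ.+ 1 ≤ m × dualDegree ds ≡ 2 ℕ.* m × twigs ds ≡ m ∸ (b ℕ.+ 1))

-- Bent b a d: a arrows on the primal half-edge, dual vertex of degree d.
data Bent (b : ℕ) : ℕ → ℕ → Set where
  twig-vertex : ∀ {d} → Bent b 0 d
  special     : ∀ {a d} → suc a ≡ b → d ≡ 2 ℕ.* b → Bent b a d
  regular     : ∀ {a d} → a ≡ b → 2 ℕ.* b ℕ.+ 2 ≤ d → Bent b a d

EdgeRule : ℕ → HalfEdge → HalfEdge → Set
EdgeRule b (primal a) (primal a′) = 1 ≤ a × 1 ≤ a′ × a ℕ.+ a′ ≡ b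
EdgeRule b (primal a) (dual d)    = Bent b a d
EdgeRule b (dual d)   (primal a)  = Bent b a d
EdgeRule b (dual d)   (dual d′)   =
  b ≡ 1 × ((d ≡ 2 ℕ.* b × d′ ≢ 2 ℕ.* b) ⊎ (d ≢ 2 ℕ.* b × d′ ≡ 2 ℕ.* b))

data Decorated (b : ℕ) {X : Set} : Tree X → Set
data Attached (b : ℕ) (h : HalfEdge) {X : Set} : Decoration X → Set

data Decorated b where
  primal : ∀ {a cs} →
           PrimalRule b (a ∷ map proj₁ cs) →
           All (λ (c , t) → EdgeRule b (primal c) (top t) × Decorated b t) cs →
           Decorated b (primal a cs)
  dual   : ∀ {x ds} →
           DualRule b ds →
           All (Attached b (dual (dualDegree ds))) ds →
           Decorated b (dual x ds)

data Attached b h where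
  leaflet : Attached b h leaflet
  edge    : ∀ {t} → EdgeRule b h (top t) → Decorated b t → Attached b h (edge t)

data SliceRoot (b : ℕ) {X : Set} : Tree X → Set where
  primal  : ∀ {cs} → SliceRoot b (primal b cs)
  2-angle : ∀ {x} → b ≡ 1 → SliceRoot b (dual x (leaflet ∷ []))

Tight : Tree X → Set
Tight t = All (Linked (λ d e → T (isTwig d) → e ≢ leaflet) ∘ proj₂) (blossoming t)

-- Terms of type `Vec (Tree (Fin n)) (suc k)` are equal exactly when they are
-- the same tuple of numbered planted plane trees.  The permutation says that
-- every number is used exactly once, and by a vertex of the prescribed degree.
record Admissible (b k : ℕ) {n : ℕ} (m : Vec ℕ (suc n))
                  (ts : Vec (Tree (Fin (suc n))) (suc k)) : Set where
  field
    slices   : All (λ t → Decorated b t × SliceRoot b t × Tight t) (Vec.toList ts)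
    numbered : map (λ (i , ds) → i , dualDegree ds) (concatMap blossoming (Vec.toList ts))
               ↭ tabulate (λ i → i , 2 ℕ.* lookup m i)
    first    : zero ∈ map proj₁ (blossoming (Vec.head ts))

-- Exactly N elements of A satisfy P.
HasCardinality : {A : Set} → (A → Set) → ℕ → Set
HasCardinality P N = ∃[ xs ] Unique xs × (∀ x → x ∈ xs ⇔ P x) × length xs ≡ N

Σ< : ℕ → (ℕ → ℚ) → ℚ
Σ< n f = foldr ℚ._+_ 0ℚ (applyUpTo f n)

-- Power series in u, given by their coefficients.
Series : Set
Series = ℕ → ℚ

-- [u^ j ] f vanishes for j < 0.
[u^_]_ : ℤ → Series → ℚ
[u^ + d ] f      = f d
[u^ -[1+ _ ] ] f = 0ℚ

1ₛ : Series
1ₛ zero    = 1ℚ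
1ₛ (suc _) = 0ℚ

infixl 7 _·_
infixr 8 _^ₛ_

_·_ : Series → Series → Series
(f · g) d = Σ< (suc d) λ i → f i ℚ.* g (d ∸ i)

_^ₛ_ : Series → ℕ → Series
f ^ₛ zero  = 1ₛ
f ^ₛ suc n = f · (f ^ₛ n)

-- 1/f for f with constant coefficient 1 (see ·-recip), by the recurrence
-- r_0 = 1 and r_{d+1} = - Σ_{i ≤ d} f_{i+1} r_{d-i}; `recips f d` is the list
-- r_{d-1}, …, r_0.
recips : Series → ℕ → List ℚ
next   : Series → ℕ → ℚ

recips f zero    = []
recips f (suc d) = next f d ∷ recips f d

next f zero    = 1ℚ
next f (suc d) =
  ℚ.- foldr ℚ._+_ 0ℚ (zipWith ℚ._*_ (applyUpTo (f ∘ suc) (suc d)) (recips f (suc d)))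

recip : Series → Series
recip = next

private
  zipWith-recips : ∀ f (g : Series) d →
    zipWith ℚ._*_ (applyUpTo g (suc d)) (recips f (suc d))
    ≡ applyUpTo (λ i → g i ℚ.* recip f (d ∸ i)) (suc d)
  zipWith-recips f g zero    = refl
  zipWith-recips f g (suc d) = cong (g 0 ℚ.* next f (suc d) ∷_) (zipWith-recips f (g ∘ suc) d)

·-recip : ∀ f → f 0 ≡ 1ℚ → ∀ d → (f · recip f) d ≡ 1ₛ d
·-recip f f₀ zero rewrite f₀ = refl
·-recip f f₀ (suc d) = begin
  f 0 ℚ.* (ℚ.- S) ℚ.+ S′   ≡⟨ cong₂ (λ x y → x ℚ.* (ℚ.- S) ℚ.+ y) f₀ (sym S≡S′) ⟩
  1ℚ ℚ.* (ℚ.- S) ℚ.+ S     ≡⟨ cong (ℚ._+ S) (ℚₚ.*-identityˡ (ℚ.- S)) ⟩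
  ℚ.- S ℚ.+ S              ≡⟨ ℚₚ.+-inverseˡ S ⟩
  0ℚ                       ∎
  where
  open ≡-Reasoning
  S S′ : ℚ
  S  = foldr ℚ._+_ 0ℚ (zipWith ℚ._*_ (applyUpTo (f ∘ suc) (suc d)) (recips f (suc d)))
  S′ = Σ< (suc d) λ i → f (suc i) ℚ.* recip f (d ∸ i)
  S≡S′ : S ≡ S′
  S≡S′ = cong (foldr ℚ._+_ 0ℚ) (zipWith-recips f (f ∘ suc) d)

^ₛ-const : ∀ f → f 0 ≡ 1ℚ → ∀ n → (f ^ₛ n) 0 ≡ 1ℚ
^ₛ-const f f₀ zero    = refl
^ₛ-const f f₀ (suc n) = cong₂ (λ x y → x ℚ.* y ℚ.+ 0ℚ) f₀ (^ₛ-const f f₀ n)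

Πℤ< : ℕ → (ℕ → ℤ) → ℤ
Πℤ< n f = foldr ℤ._*_ (+ 1) (applyUpTo f n)

-- Binomial coefficient with integer upper argument; stdlib's _C_ does not
-- cover a = -1, which occurs in q for m = b and k = 0.
binom : ℤ → ℕ → ℚ
binom a k = (Πℤ< k λ i → a ℤ.- + i) / k !
  where instance _ = k !≢0

q : ℕ → ℕ → ℤ → ℚ
q b k m = binom (m ℤ.+ + b) k ℚ.* binom (m ℤ.- + b ℤ.- + 1 ℤ.+ + k) k

qProduct : ℕ → ℕ → ℤ → ℚ
qProduct b k m =
  (Πℤ< k λ i → m ℤ.* m ℤ.- (+ b ℤ.- + i) ℤ.* (+ b ℤ.- + i)) / (k ! ℕ.* k !)
  where instance _ = k !* k !≢0

sign : ℕ → ℤ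
sign d = -1ℤ ℤ.^ d

module _ (b : ℕ) .{{_ : NonZero b}} where

  -- Σ_{j=2}^b (1/b) C(b,j) C(b,j-1) (-u)^{j-2}: the coefficient of u^d comes
  -- from j = d + 2, and C(b,j) = 0 for j > b.
  innerSum : Series
  innerSum d = (sign d ℤ.* + ((b C (d ℕ.+ 2)) ℕ.* (b C (d ℕ.+ 1)))) / b

  1-u·innerSum : Series
  1-u·innerSum zero    = 1ℚ
  1-u·innerSum (suc d) = ℚ.- innerSum d

  α : ℕ → ℕ → ℚ
  α k n = [u^ n ⊖ k ] recip (1-u·innerSum ^ₛ suc n)

-- Sum over all vectors with entries in {0, …, B - 1}.
ΣVec< : (n B : ℕ) → (Vec ℕ n → ℚ) → ℚ
ΣVec< zero    B f = f Vec.[]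
ΣVec< (suc n) B f = Σ< B λ k → ΣVec< n B λ ks → f (k Vec.∷ ks)

-- For n + 1 blossoming vertices.  Terms with some k_i > n vanish, because
-- then k + k_1 + ⋯ > n in α; so each k_i is summed over {0, …, n}.
F : (b : ℕ) .{{_ : NonZero b}} (k : ℕ) {n : ℕ} → Vec ℕ (suc n) → ℚ
F b k {n} m =
  (+ (n !) / 1) ℚ.*
  ΣVec< (suc n) (suc n) λ ks →
    Vec.foldr′ ℚ._*_ 1ℚ (Vec.zipWith (λ kᵢ mᵢ → q b kᵢ (+ mᵢ)) ks m)
    ℚ.* α b (k ℕ.+ Vec.sum ks) n

-- Give the i-th blossoming vertex a variable tᵢ with tᵢ² = 0, so that numbers of trees become
-- coefficients of series in ℚ[t₁, …, tₙ] / (tᵢ²), and let R be the series of 0-slices.  Between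
-- consecutive attaching points, tightness forces the leaflets before the twigs, so the decorations
-- of vertex i contribute Qᵢ(R) = Σ_k q_k(mᵢ) R^k.  Cutting a tree at its primal vertices shows that
-- A = Σ_c A_c z^c, with A_c the series of what lies below a half-edge carrying c arrows (and
-- Σᵢ tᵢ Qᵢ(R) for c = b), satisfies A = z (R + A) (1 - A) up to z^b.  By Lagrange inversion in z,
-- A_b is a polynomial in R with Narayana coefficients: Σᵢ tᵢ Qᵢ(R) = R g(R), where 1/g is the series
-- in α.  A labelled Lagrange inversion then gives the coefficient of t₁ ⋯ tₙ in R^(k+1), and this
-- is k + 1 times the coefficient in (part of R containing t₁) · R^k because t₁ ∂/∂t₁ is a derivation.

module Submission where

open import Defs
open import Algebra.Bundles using (CommutativeRing)
import Algebra.Properties.AbelianGroup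
import Algebra.Properties.CommutativeSemiring.Exp
import Algebra.Properties.Ring
import Algebra.Properties.Semiring.Exp
import Algebra.Properties.Semiring.Mult
import Algebra.Properties.Semiring.Mult.TCOptimised
import Algebra.Solver.Ring
open import Algebra.Consequences.Setoid using (comm∧idˡ⇒id; comm∧invˡ⇒inv; comm∧distrʳ⇒distr)
open import Algebra.Solver.Ring.AlmostCommutativeRing using (fromCommutativeRing; _-Raw-AlmostCommutative⟶_)
open import Data.Bool.Base using (Bool; true; false; if_then_else_; T)
open import Data.Empty using (⊥; ⊥-elim; ⊥-elim-irr)
open import Data.Fin.Base using (Fin; zero; suc)
import Data.Fin.Properties as Finₚ
open import Data.Integer.Base as ℤ using (ℤ; +_; -[1+_]; -1ℤ; _⊖_)
import Data.Integer.Properties as ℤₚ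
import Data.Integer.Tactic.RingSolver as ℤ-Solver
open import Data.List.Base
  using (List; []; _∷_; _++_; map; length; replicate; tabulate; allFin; concatMap; cartesianProduct)
import Data.List.Properties as Listₚ
open import Data.List.Membership.Propositional using (_∈_)
open import Data.List.Membership.Propositional.Properties
  using (∈-map⁺; ∈-map⁻; ∈-++⁺ˡ; ∈-++⁺ʳ; ∈-++⁻; ∈-∃++; ∈-cartesianProduct⁺; ∈-cartesianProduct⁻)
open import Data.List.Membership.Propositional.Properties.WithK using (unique∧set⇒bag)
open import Data.List.Relation.Binary.BagAndSetEquality using (∼bag⇒↭)
open import Data.List.Relation.Binary.Disjoint.Propositional using (Disjoint)
open import Data.List.Relation.Binary.Permutation.Propositional as Perm
  using (_↭_; ↭-refl; ↭-sym; ↭-trans; ↭-reflexive)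
import Data.List.Relation.Binary.Permutation.Propositional.Properties as Permₚ
open import Data.List.Relation.Unary.All as All using (All; []; _∷_)
import Data.List.Relation.Unary.All.Properties as Allₚ
open import Data.List.Relation.Unary.AllPairs using ([]; _∷_)
open import Data.List.Relation.Unary.Any using (here; there)
open import Data.List.Relation.Unary.Linked as Linked using (Linked; []; [-]; _∷_)
open import Data.List.Relation.Unary.Unique.Propositional using (Unique)
import Data.List.Relation.Unary.Unique.Propositional.Properties as Uniqueₚ
open import Data.Maybe.Base using (just; nothing)
open import Data.Nat.Base as ℕ using (ℕ; zero; suc; _∸_; _!; NonZero)
open import Data.Nat.Combinatorics using (_C_; nCk≡nC[n∸k]; nCk+nC[k+1]≡[n+1]C[k+1]; nCn≡1; nC1≡n; k>n⇒nCk≡0)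
open import Data.Nat.ListAction using (sum)
import Data.Nat.Properties as ℕₚ
open import Data.Nat.Solver using (module +-*-Solver)
import Data.Nat.Tactic.RingSolver as ℕ-Solver
open import Data.Product.Base as Product using (_×_; _,_; proj₁; proj₂; ∃; ∃₂; ∃-syntax)
open import Data.Rational.Base as ℚ using (ℚ; 0ℚ; 1ℚ; _/_; toℚᵘ)
import Data.Rational.Properties as ℚₚ
open import Data.Rational.Unnormalised.Base as ℚᵘ using (mkℚᵘ; *≡*)
import Data.Rational.Unnormalised.Properties as ℚᵘₚ
open import Data.Sum.Base as Sum using (_⊎_; inj₁; inj₂)
open import Data.Unit.Base using (⊤; tt)
open import Data.Vec.Base as Vec using (Vec; []; _∷_; zipWith; lookup)
import Data.Vec.Properties as Vecₚ
open import Function.Base using (_∘_; id)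
open import Function.Bundles using (_⇔_; mk⇔; Equivalence)
open import Level using (0ℓ)
open import Relation.Binary.Bundles using (Setoid)
open import Relation.Binary.Definitions using (WeaklyDecidable)
open import Relation.Binary.PropositionalEquality as ≡ using (_≡_; _≢_)
import Relation.Binary.Reasoning.Setoid
open import Relation.Nullary.Decidable using (Dec; yes; no; does; dec-true; dec-false)
open import Relation.Nullary.Negation using (¬_; contradiction)

-- Two obstacles shape the proof. The equations for the series of subtrees are implicit, so trees
-- are counted by height: a tree whose label monomial is squarefree has at most n blossoming
-- vertices, which bounds its height, and beyond that bound one more unfolding of the grammar
-- changes no coefficient. This gives a fixed point without limits of series. Moreover, nothing is
-- substituted into a power series: R is nilpotent, and the equation between R g(R) and Σᵢ tᵢ Qᵢ(R),
-- multiplied by each R^k, becomes a triangular linear system for the coefficients of the powers of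
-- R, whose solution is verified rather than derived. Division only occurs as cancellation of
-- positive integers, so formulas with a denominator are stated with it cleared. The index c also
-- covers the 0-slices: for c = 0 the rule at an edge-vertex gives b arrows on the half-edge towards
-- the root, and the special vertex below b - 1 arrows becomes the 2-angle slice when b = 1. Special
-- vertices hang below b - 1 arrows and labeled ones below b; moving the former up by one degree is
-- what makes the equation for A a single one.

private
  variable
    n : ℕ
    I I′ Ω Ω′ : Set

-- Commutative rings and a solver for ring identities.

Ring₀ : Set₁
Ring₀ = CommutativeRing 0ℓ 0ℓ

module Naturals (K : Ring₀) where
  open CommutativeRing K
  open Algebra.Properties.Semiring.Mult semiring public using (×-homo-+; ×1-homo-*) renaming (_×_ to _×ℕ_)
  open import Relation.Binary.Reasoning.Setoid setoid

  ν : ℕ → Carrier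
  ν n = n ×ℕ 1#

  ν-+ : ∀ m n → ν (m ℕ.+ n) ≈ ν m + ν n
  ν-+ m n = ×-homo-+ 1# m n

  ν-* : ∀ m n → ν (m ℕ.* n) ≈ ν m * ν n
  ν-* = ×1-homo-*

  ν-1 : ν 1 ≈ 1#
  ν-1 = +-identityʳ 1#

  ν-cong : ∀ {m n} → m ≡ n → ν m ≈ ν n
  ν-cong ≡.refl = refl

module IntegerSolver (K : Ring₀) where
  open CommutativeRing K
  open Algebra.Properties.Ring ring
  open Algebra.Properties.AbelianGroup +-abelianGroup using (⁻¹-∙-comm)
  open Algebra.Properties.Semiring.Mult.TCOptimised semiring
    using (×-homo-+; ×1-homo-*; 1+×) renaming (_×_ to _×′_)
  open import Relation.Binary.Reasoning.Setoid setoid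

  private
    -- In the optimised multiple, 1 times x is x rather than x + 0. The constants 0 and 1 of the
    -- solver thus denote `0#` and `1#` themselves, and `0-homo` and `1-homo` hold by `refl`.
    μ : ℕ → Carrier
    μ n = n ×′ 1#

    ⟦_⟧ᶻ : ℤ → Carrier
    ⟦ + n ⟧ᶻ      = μ n
    ⟦ -[1+ n ] ⟧ᶻ = - μ (suc n)

    cancel : ∀ x a b → (x + a) - (x + b) ≈ a - b
    cancel x a b = begin
      (x + a) - (x + b)      ≈⟨ +-cong (+-comm a x) (⁻¹-∙-comm x b) ⟨
      (a + x) + (- x - b)    ≈⟨ +-assoc a x _ ⟩
      a + (x + (- x - b))    ≈⟨ +-congˡ (+-assoc x (- x) (- b)) ⟨
      a + ((x - x) - b)      ≈⟨ +-congˡ (+-congʳ (-‿inverseʳ x)) ⟩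
      a + (0# - b)           ≈⟨ +-congˡ (+-identityˡ (- b)) ⟩
      a - b                  ∎

    ⊖-homo : ∀ m n → ⟦ m ⊖ n ⟧ᶻ ≈ μ m - μ n
    ⊖-homo m zero = begin
      μ m          ≈⟨ +-identityʳ (μ m) ⟨
      μ m + 0#     ≈⟨ +-congˡ -0#≈0# ⟨
      μ m - 0#     ∎
    ⊖-homo zero (suc n) = sym (+-identityˡ _)
    ⊖-homo (suc m) (suc n) = begin
      ⟦ suc m ⊖ suc n ⟧ᶻ         ≡⟨ ≡.cong ⟦_⟧ᶻ (ℤₚ.[1+m]⊖[1+n]≡m⊖n m n) ⟩
      ⟦ m ⊖ n ⟧ᶻ                 ≈⟨ ⊖-homo m n ⟩
      μ m - μ n                  ≈⟨ cancel 1# (μ m) (μ n) ⟨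
      (1# + μ m) - (1# + μ n)    ≈⟨ +-cong (1+× m 1#) (-‿cong (1+× n 1#)) ⟨
      μ (suc m) - μ (suc n)      ∎

    -‿homoᶻ : ∀ i → ⟦ ℤ.- i ⟧ᶻ ≈ - ⟦ i ⟧ᶻ
    -‿homoᶻ (+ zero)   = sym -0#≈0#
    -‿homoᶻ (+ suc n)  = refl
    -‿homoᶻ -[1+ n ]   = sym (-‿involutive _)

    +-homoᶻ : ∀ i j → ⟦ i ℤ.+ j ⟧ᶻ ≈ ⟦ i ⟧ᶻ + ⟦ j ⟧ᶻ
    +-homoᶻ (+ m)    (+ n)    = ×-homo-+ 1# m n
    +-homoᶻ (+ m)    -[1+ n ] = ⊖-homo m (suc n)
    +-homoᶻ -[1+ m ] (+ n)    = trans (⊖-homo n (suc m)) (+-comm _ _)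
    +-homoᶻ -[1+ m ] -[1+ n ] = begin
      - μ (suc (suc (m ℕ.+ n)))      ≡⟨ ≡.cong (λ k → - μ (suc k)) (ℕₚ.+-suc m n) ⟨
      - μ (suc m ℕ.+ suc n)          ≈⟨ -‿cong (×-homo-+ 1# (suc m) (suc n)) ⟩
      - (μ (suc m) + μ (suc n))      ≈⟨ ⁻¹-∙-comm _ _ ⟨
      - μ (suc m) - μ (suc n)        ∎

    *-homo⁺ : ∀ m j → ⟦ + m ℤ.* j ⟧ᶻ ≈ μ m * ⟦ j ⟧ᶻ
    *-homo⁺ m (+ n) = trans (reflexive (≡.cong ⟦_⟧ᶻ (≡.sym (ℤₚ.pos-* m n)))) (×1-homo-* m n)
    *-homo⁺ m -[1+ n ] = begin
      ⟦ + m ℤ.* (ℤ.- + suc n) ⟧ᶻ    ≡⟨ ≡.cong ⟦_⟧ᶻ (ℤₚ.neg-distribʳ-* (+ m) (+ suc n)) ⟨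
      ⟦ ℤ.- (+ m ℤ.* + suc n) ⟧ᶻ    ≈⟨ -‿homoᶻ (+ m ℤ.* + suc n) ⟩
      - ⟦ + m ℤ.* + suc n ⟧ᶻ        ≈⟨ -‿cong (*-homo⁺ m (+ suc n)) ⟩
      - (μ m * μ (suc n))           ≈⟨ -‿distribʳ-* _ _ ⟩
      μ m * - μ (suc n)             ∎

    *-homoᶻ : ∀ i j → ⟦ i ℤ.* j ⟧ᶻ ≈ ⟦ i ⟧ᶻ * ⟦ j ⟧ᶻ
    *-homoᶻ (+ m)    j = *-homo⁺ m j
    *-homoᶻ -[1+ m ] j = begin
      ⟦ (ℤ.- + suc m) ℤ.* j ⟧ᶻ      ≡⟨ ≡.cong ⟦_⟧ᶻ (ℤₚ.neg-distribˡ-* (+ suc m) j) ⟨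
      ⟦ ℤ.- (+ suc m ℤ.* j) ⟧ᶻ      ≈⟨ -‿homoᶻ (+ suc m ℤ.* j) ⟩
      - ⟦ + suc m ℤ.* j ⟧ᶻ          ≈⟨ -‿cong (*-homo⁺ (suc m) j) ⟩
      - (μ (suc m) * ⟦ j ⟧ᶻ)        ≈⟨ -‿distribˡ-* _ _ ⟩
      - μ (suc m) * ⟦ j ⟧ᶻ          ∎

    morphism : ℤ.+-*-rawRing -Raw-AlmostCommutative⟶ fromCommutativeRing K
    morphism = record
      { ⟦_⟧    = ⟦_⟧ᶻ
      ; +-homo = +-homoᶻ
      ; *-homo = *-homoᶻ
      ; -‿homo = -‿homoᶻ
      ; 0-homo = refl
      ; 1-homo = refl
      }

    _coeff≟_ : WeaklyDecidable (λ i j → ⟦ i ⟧ᶻ ≈ ⟦ j ⟧ᶻ)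
    i coeff≟ j with i ℤₚ.≟ j
    ... | yes ≡.refl = just refl
    ... | no _       = nothing

  open Algebra.Solver.Ring ℤ.+-*-rawRing (fromCommutativeRing K) morphism _coeff≟_ public
    using (solve; _:=_; _:+_; _:*_; _:-_; :-_; con; Polynomial)

  :0 :1 :2 : ∀ {n} → Polynomial n
  :0 = con (+ 0)
  :1 = con (+ 1)
  :2 = con (+ 2)

module MakeRing (S : Setoid 0ℓ 0ℓ) where
  open Setoid S renaming (isEquivalence to ≈-equiv)
  open import Algebra.Definitions _≈_

  commutativeRing : (_+_ _*_ : Carrier → Carrier → Carrier) (-_ : Carrier → Carrier) (0# 1# : Carrier) →
    Congruent₂ _+_ → Associative _+_ → Commutative _+_ → LeftIdentity 0# _+_ →
    Congruent₁ -_ → LeftInverse 0# -_ _+_ →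
    Congruent₂ _*_ → Associative _*_ → Commutative _*_ → LeftIdentity 1# _*_ →
    _*_ DistributesOverʳ _+_ → Ring₀
  commutativeRing _+_ _*_ -_ 0# 1# +-cong +-assoc +-comm +-id -‿cong -‿inv *-cong *-assoc *-comm *-id distribʳ =
    record
    { isCommutativeRing = record
      { isRing = record
        { +-isAbelianGroup = record
          { isGroup = record
            { isMonoid = record
              { isSemigroup = record
                { isMagma = record { isEquivalence = ≈-equiv ; ∙-cong = +-cong }
                ; assoc = +-assoc }
              ; identity = comm∧idˡ⇒id S +-comm +-id }
            ; inverse = comm∧invˡ⇒inv S +-comm -‿inv
            ; ⁻¹-cong = -‿cong }
          ; comm = +-comm }
        ; *-cong = *-cong
        ; *-assoc = *-assoc
        ; *-identity = comm∧idˡ⇒id S *-comm *-id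
        ; distrib = comm∧distrʳ⇒distr S +-cong *-comm distribʳ }
      ; *-comm = *-comm } }

-- The ring of formal power series.

module PowerSeries (K : Ring₀) where
  open CommutativeRing K
  open IntegerSolver K
  open import Relation.Binary.Reasoning.Setoid setoid

  Seq : Set
  Seq = ℕ → Carrier

  tail : Seq → Seq
  tail f n = f (suc n)

  infixl 7 _⋆_
  -- The Cauchy product, by recursion on the degree: peeling off the constant term of the left
  -- factor lets the ring laws follow by induction on the degree. `⋆-sum` gives the usual
  -- convolution sum.
  _⋆_ : Seq → Seq → Seq
  (f ⋆ g) zero    = f 0 * g 0
  (f ⋆ g) (suc d) = f 0 * g (suc d) + (tail f ⋆ g) d

  -- A coefficient of degree d sees only degrees up to d. This matters because the equations for
  -- trees hold only below degree b.
  ⋆-cong≤ : ∀ {f f′ g g′} d → (∀ i → i ℕ.≤ d → f i ≈ f′ i) → (∀ i → i ℕ.≤ d → g i ≈ g′ i) →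
            (f ⋆ g) d ≈ (f′ ⋆ g′) d
  ⋆-cong≤ zero    p q = *-cong (p 0 ℕ.z≤n) (q 0 ℕ.z≤n)
  ⋆-cong≤ (suc d) p q = +-cong (*-cong (p 0 ℕ.z≤n) (q (suc d) ℕₚ.≤-refl))
    (⋆-cong≤ d (λ i i≤d → p (suc i) (ℕ.s≤s i≤d)) (λ i i≤d → q i (ℕₚ.m≤n⇒m≤1+n i≤d)))

  ⋆-cong : ∀ {f f′ g g′} → (∀ i → f i ≈ f′ i) → (∀ i → g i ≈ g′ i) → ∀ d → (f ⋆ g) d ≈ (f′ ⋆ g′) d
  ⋆-cong p q d = ⋆-cong≤ d (λ i _ → p i) (λ i _ → q i)

  ⋆-sucʳ : ∀ f g d → (f ⋆ g) (suc d) ≈ f (suc d) * g 0 + (f ⋆ tail g) d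
  ⋆-sucʳ f g zero    = +-comm _ _
  ⋆-sucʳ f g (suc d) = begin
    f 0 * g (suc (suc d)) + (tail f ⋆ g) (suc d)                            ≈⟨ +-congˡ (⋆-sucʳ (tail f) g d) ⟩
    f 0 * g (suc (suc d)) + (f (suc (suc d)) * g 0 + (tail f ⋆ tail g) d)   ≈⟨ solve 3 (λ x y z → x :+ (y :+ z) := y :+ (x :+ z)) refl _ _ _ ⟩
    f (suc (suc d)) * g 0 + (f 0 * g (suc (suc d)) + (tail f ⋆ tail g) d)   ∎

  ⋆-comm : ∀ f g d → (f ⋆ g) d ≈ (g ⋆ f) d
  ⋆-comm f g zero    = *-comm _ _
  ⋆-comm f g (suc d) = trans (+-cong (*-comm _ _) (⋆-comm (tail f) g d)) (sym (⋆-sucʳ g f d))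

  ⋆-distribʳ : ∀ h f g d → ((λ i → f i + g i) ⋆ h) d ≈ (f ⋆ h) d + (g ⋆ h) d
  ⋆-distribʳ h f g zero    = distribʳ _ _ _
  ⋆-distribʳ h f g (suc d) = begin
    (f 0 + g 0) * h (suc d) + ((λ i → f (suc i) + g (suc i)) ⋆ h) d            ≈⟨ +-congˡ (⋆-distribʳ h (tail f) (tail g) d) ⟩
    (f 0 + g 0) * h (suc d) + ((tail f ⋆ h) d + (tail g ⋆ h) d)                ≈⟨ solve 5 (λ x y z u v → (x :+ y) :* z :+ (u :+ v) := (x :* z :+ u) :+ (y :* z :+ v)) refl _ _ _ _ _ ⟩
    (f 0 * h (suc d) + (tail f ⋆ h) d) + (g 0 * h (suc d) + (tail g ⋆ h) d)    ∎

  ⋆-scaleˡ : ∀ c f g d → ((λ i → c * f i) ⋆ g) d ≈ c * (f ⋆ g) d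
  ⋆-scaleˡ c f g zero    = *-assoc _ _ _
  ⋆-scaleˡ c f g (suc d) = trans (+-cong (*-assoc _ _ _) (⋆-scaleˡ c (tail f) g d)) (sym (distribˡ _ _ _))

  ⋆-assoc : ∀ f g h d → ((f ⋆ g) ⋆ h) d ≈ (f ⋆ (g ⋆ h)) d
  ⋆-assoc f g h zero    = *-assoc _ _ _
  ⋆-assoc f g h (suc d) = begin
    f 0 * g 0 * h (suc d) + (tail (f ⋆ g) ⋆ h) d
      ≈⟨ +-congˡ (⋆-distribʳ h (λ i → f 0 * g (suc i)) (tail f ⋆ g) d) ⟩
    f 0 * g 0 * h (suc d) + (((λ i → f 0 * g (suc i)) ⋆ h) d + ((tail f ⋆ g) ⋆ h) d)
      ≈⟨ +-congˡ (+-cong (⋆-scaleˡ (f 0) (tail g) h d) (⋆-assoc (tail f) g h d)) ⟩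
    f 0 * g 0 * h (suc d) + (f 0 * (tail g ⋆ h) d + (tail f ⋆ (g ⋆ h)) d)
      ≈⟨ solve 5 (λ x y z u v → x :* y :* z :+ (x :* u :+ v) := x :* (y :* z :+ u) :+ v) refl _ _ _ _ _ ⟩
    f 0 * (g 0 * h (suc d) + (tail g ⋆ h) d) + (tail f ⋆ (g ⋆ h)) d ∎

  const : Carrier → Seq
  const c zero    = c
  const c (suc _) = 0#

  ⋆-zeroˡ : ∀ g d → ((λ _ → 0#) ⋆ g) d ≈ 0#
  ⋆-zeroˡ g zero    = zeroˡ _
  ⋆-zeroˡ g (suc d) = trans (+-cong (zeroˡ _) (⋆-zeroˡ g d)) (+-identityˡ _)

  ⋆-constˡ : ∀ c g d → (const c ⋆ g) d ≈ c * g d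
  ⋆-constˡ c g zero    = refl
  ⋆-constˡ c g (suc d) = trans (+-congˡ (⋆-zeroˡ g d)) (+-identityʳ _)

  seqSetoid : Setoid 0ℓ 0ℓ
  seqSetoid = record
    { Carrier = Seq
    ; _≈_ = λ f g → ∀ n → f n ≈ g n
    ; isEquivalence = record
      { refl = λ _ → refl ; sym = λ p n → sym (p n) ; trans = λ p q n → trans (p n) (q n) }
    }

  -- Being a ring in the same sense as K, it can be fed back to the solver and to `ListSum`, which
  -- then handle identities between whole series.
  K[[u]] : Ring₀
  K[[u]] = MakeRing.commutativeRing seqSetoid
    (λ f g n → f n + g n) _⋆_ (λ f n → - f n) (λ _ → 0#) (const 1#)
    (λ p q n → +-cong (p n) (q n)) (λ f g h n → +-assoc _ _ _) (λ f g n → +-comm _ _) (λ f n → +-identityˡ _)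
    (λ p n → -‿cong (p n)) (λ f n → -‿inverseˡ _)
    ⋆-cong ⋆-assoc ⋆-comm (λ g d → trans (⋆-constˡ 1# g d) (*-identityˡ _)) ⋆-distribʳ

-- Calculus of formal power series

module RangeSum (K : Ring₀) where
  open CommutativeRing K
  open IntegerSolver K

  sumTo : ℕ → (ℕ → Carrier) → Carrier
  sumTo zero    f = 0#
  sumTo (suc n) f = f 0 + sumTo n (λ i → f (suc i))

  sumTo-cong : ∀ n {f g : ℕ → Carrier} → (∀ i → i ℕ.< n → f i ≈ g i) → sumTo n f ≈ sumTo n g
  sumTo-cong zero    p = refl
  sumTo-cong (suc n) p = +-cong (p 0 (ℕ.s≤s ℕ.z≤n)) (sumTo-cong n (λ i i<n → p (suc i) (ℕ.s≤s i<n)))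

  sumTo-zero : ∀ n {f : ℕ → Carrier} → (∀ i → i ℕ.< n → f i ≈ 0#) → sumTo n f ≈ 0#
  sumTo-zero zero    p = refl
  sumTo-zero (suc n) p = trans (+-cong (p 0 (ℕ.s≤s ℕ.z≤n)) (sumTo-zero n (λ i i<n → p (suc i) (ℕ.s≤s i<n)))) (+-identityˡ 0#)

  sumTo-+ : ∀ n f g → sumTo n (λ i → f i + g i) ≈ sumTo n f + sumTo n g
  sumTo-+ zero    f g = sym (+-identityˡ 0#)
  sumTo-+ (suc n) f g = trans (+-congˡ (sumTo-+ n _ _))
    (solve 4 (λ x y z u → (x :+ y) :+ (z :+ u) := (x :+ z) :+ (y :+ u)) refl _ _ _ _)

  sumTo-*ˡ : ∀ c n f → c * sumTo n f ≈ sumTo n (λ i → c * f i)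
  sumTo-*ˡ c zero    f = zeroʳ c
  sumTo-*ˡ c (suc n) f = trans (distribˡ _ _ _) (+-congˡ (sumTo-*ˡ c n _))

  sumTo-*ʳ : ∀ c n f → sumTo n f * c ≈ sumTo n (λ i → f i * c)
  sumTo-*ʳ c n f = trans (*-comm _ _) (trans (sumTo-*ˡ c n f) (sumTo-cong n (λ _ _ → *-comm _ _)))

  sumTo-extend : ∀ m n {f : ℕ → Carrier} → (∀ i → m ℕ.≤ i → f i ≈ 0#) → m ℕ.≤ n → sumTo n f ≈ sumTo m f
  sumTo-extend zero    n       p _            = sumTo-zero n (λ i _ → p i ℕ.z≤n)
  sumTo-extend (suc m) (suc n) p (ℕ.s≤s m≤n) = +-congˡ (sumTo-extend m n (λ i m≤i → p (suc i) (ℕ.s≤s m≤i)) m≤n)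

module SeriesCalculus (K : Ring₀) where
  open CommutativeRing K
  open PowerSeries K public
  open Naturals K public
  open RangeSum K public
  module S = CommutativeRing K[[u]]
  open Algebra.Properties.Semiring.Exp S.semiring public using () renaming (_^_ to _^ˢ_)
  private
    module I = IntegerSolver K
    module J = IntegerSolver K[[u]]
  open import Relation.Binary.Reasoning.Setoid setoid

  ⋆-sum : ∀ f g d → (f ⋆ g) d ≈ sumTo (suc d) (λ i → f i * g (d ∸ i))
  ⋆-sum f g zero    = sym (+-identityʳ _)
  ⋆-sum f g (suc d) = +-congˡ (⋆-sum (tail f) g d)

  Y : Seq
  Y zero    = 0#
  Y (suc n) = const 1# n

  Y⋆-zero : ∀ f → (Y ⋆ f) 0 ≈ 0#
  Y⋆-zero f = zeroˡ _

  Y⋆-suc : ∀ f d → (Y ⋆ f) (suc d) ≈ f d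
  Y⋆-suc f d = trans (+-cong (zeroˡ _) (⋆-constˡ 1# f d)) (trans (+-identityˡ _) (*-identityˡ _))

  -- `Y ^ˢ j` starts in degree j, so the terms with j > s vanish. This trades a finite sum over
  -- powers of the variable for one coefficient of a product.
  ⋆-expand : ∀ J f B s → s ℕ.< J → sumTo J (λ j → f j * (Y ^ˢ j ⋆ B) s) ≈ (f ⋆ B) s
  ⋆-expand (suc J) f B zero    _ = trans (+-cong (*-congˡ (*-identityˡ _)) (sumTo-zero J λ i _ →
    trans (*-congˡ (trans (*-congʳ (zeroˡ _)) (zeroˡ _))) (zeroʳ _))) (+-identityʳ _)
  ⋆-expand (suc J) f B (suc s) (ℕ.s≤s s<J) = +-cong
    (*-congˡ (trans (⋆-constˡ 1# B (suc s)) (*-identityˡ _)))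
    (trans (sumTo-cong J λ i _ → *-congˡ (trans (⋆-assoc Y (Y ^ˢ i) B (suc s)) (Y⋆-suc _ s)))
           (⋆-expand J (tail f) B s s<J))

  -- The Euler operator u d/du: a derivation that preserves degrees, so that differentiating shifts
  -- no index.
  θ : Seq → Seq
  θ f n = ν n * f n

  θ-cong : ∀ {f g} → f S.≈ g → θ f S.≈ θ g
  θ-cong p n = *-congˡ (p n)

  θ-+ : ∀ f g → θ (f S.+ g) S.≈ θ f S.+ θ g
  θ-+ f g n = distribˡ _ _ _

  θ-neg : ∀ f → θ (S.- f) S.≈ S.- θ f
  θ-neg f n = I.solve 2 (λ x y → x I.:* (I.:- y) I.:= I.:- (x I.:* y)) refl _ _

  θ-⋆ : ∀ f g → θ (f ⋆ g) S.≈ θ f ⋆ g S.+ f ⋆ θ g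
  θ-⋆ f g zero    = I.solve 2 (λ x y → I.:0 I.:* (x I.:* y) I.:= I.:0 I.:* x I.:* y I.:+ x I.:* (I.:0 I.:* y)) refl _ _
  θ-⋆ f g (suc d) = begin
    (1# + ν d) * (f 0 * g (suc d) + t)
      ≈⟨ I.solve 4 (λ n x y z → (I.:1 I.:+ n) I.:* (x I.:* y I.:+ z) I.:= (I.:1 I.:+ n) I.:* (x I.:* y) I.:+ (z I.:+ n I.:* z)) refl _ _ _ _ ⟩
    (1# + ν d) * (f 0 * g (suc d)) + (t + ν d * t)
      ≈⟨ +-congˡ (+-congˡ (θ-⋆ (tail f) g d)) ⟩
    (1# + ν d) * (f 0 * g (suc d)) + (t + (u + v))
      ≈⟨ I.solve 6 (λ n x y t u v → (I.:1 I.:+ n) I.:* (x I.:* y) I.:+ (t I.:+ (u I.:+ v)) I.:=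
                      (I.:0 I.:* x I.:* y I.:+ (t I.:+ u)) I.:+ (x I.:* ((I.:1 I.:+ n) I.:* y) I.:+ v)) refl _ _ _ _ _ _ ⟩
    (0# * f 0 * g (suc d) + (t + u)) + (f 0 * ((1# + ν d) * g (suc d)) + v)
      ≈⟨ +-congʳ (+-congˡ (⋆-distribʳ g (tail f) (θ (tail f)) d)) ⟨
    (0# * f 0 * g (suc d) + ((tail f S.+ θ (tail f)) ⋆ g) d) + (f 0 * ((1# + ν d) * g (suc d)) + v)
      ≈⟨ +-congʳ (+-congˡ (⋆-cong {g = g} (λ i → I.solve 2 (λ n x → x I.:+ n I.:* x I.:= (I.:1 I.:+ n) I.:* x) refl _ _) (λ _ → refl) d)) ⟩
    (0# * f 0 * g (suc d) + (tail (θ f) ⋆ g) d) + (f 0 * ((1# + ν d) * g (suc d)) + v) ∎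
    where
    t = (tail f ⋆ g) d
    u = (θ (tail f) ⋆ g) d
    v = (tail f ⋆ θ g) d

  const-ν-suc : ∀ n → const (ν (suc n)) S.≈ S.1# S.+ const (ν n)
  const-ν-suc n zero    = refl
  const-ν-suc n (suc i) = sym (+-identityˡ 0#)

  const-cong : ∀ {x y} → x ≈ y → const x S.≈ const y
  const-cong p zero    = p
  const-cong p (suc i) = refl

  const-0 : const 0# S.≈ S.0#
  const-0 zero    = refl
  const-0 (suc i) = refl

  θ-const : ∀ c → θ (const c) S.≈ S.0#
  θ-const c zero    = zeroˡ _
  θ-const c (suc i) = zeroʳ _

  θ-Y : θ Y S.≈ Y
  θ-Y zero          = zeroˡ _
  θ-Y (suc zero)    = trans (*-identityʳ _) ν-1
  θ-Y (suc (suc i)) = zeroʳ _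

  θ-^ : ∀ f n → θ (f ^ˢ suc n) S.≈ const (ν (suc n)) ⋆ (f ^ˢ n ⋆ θ f)
  θ-^ f zero = S.trans (θ-cong (S.*-identityʳ f)) (S.sym (S.trans (S.*-cong (const-cong ν-1) (S.*-identityˡ (θ f))) (S.*-identityˡ (θ f))))
  θ-^ f (suc n) = S.trans (θ-⋆ f (f ^ˢ suc n)) (S.trans (S.+-congˡ {θ f ⋆ f ^ˢ suc n} (S.*-congˡ {f} (θ-^ f n)))
    (S.trans (J.solve 4 (λ x p t c → t J.:* (x J.:* p) J.:+ x J.:* (c J.:* (p J.:* t)) J.:= (J.:1 J.:+ c) J.:* ((x J.:* p) J.:* t)) S.refl f (f ^ˢ n) (θ f) (const (ν (suc n))))
      (S.*-congʳ (S.sym (const-ν-suc (suc n))))))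

  θ-Y^ : ∀ k → θ (Y ^ˢ k) S.≈ const (ν k) ⋆ Y ^ˢ k
  θ-Y^ zero    = S.trans (θ-const 1#) (S.sym (S.trans (S.*-congʳ const-0) (S.zeroˡ (const 1#))))
  θ-Y^ (suc k) = S.trans (θ-^ Y k) (S.*-congˡ {const (ν (suc k))} (S.trans (S.*-congˡ {Y ^ˢ k} θ-Y) (S.*-comm (Y ^ˢ k) Y)))

-- All divisions amount to cancelling a positive integer, and this property passes from K to the
-- ring of squarefree monomials, where the Narayana formula is needed.
TorsionFree : Ring₀ → Set
TorsionFree K = ∀ n x → ν (suc n) * x ≈ 0# → x ≈ 0#
  where
  open CommutativeRing K
  open Naturals K

module Cancellation (K : Ring₀) (torsionFree : TorsionFree K) where
  open CommutativeRing K
  open Naturals K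
  open IntegerSolver K
  open Algebra.Properties.Ring ring

  ν-cancelˡ : ∀ n x y → ν (suc n) * x ≈ ν (suc n) * y → x ≈ y
  ν-cancelˡ n x y p = x-y≈0⇒x≈y (torsionFree n (x - y)
      (trans (solve 3 (λ n x y → n :* (x :- y) := n :* x :- n :* y) refl _ _ _)
             (trans (+-congʳ p) (-‿inverseʳ _))))
    where
    open import Relation.Binary.Reasoning.Setoid setoid
    x-y≈0⇒x≈y : x - y ≈ 0# → x ≈ y
    x-y≈0⇒x≈y q = begin
      x            ≈⟨ solve 2 (λ x y → x := (x :- y) :+ y) refl x y ⟩
      (x - y) + y  ≈⟨ +-congʳ q ⟩
      0# + y       ≈⟨ +-identityˡ y ⟩
      y            ∎

-- Lagrange inversion for A = z φ(A), an equation satisfied up to z^b only, with φ = (R + y) (1 - y):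
-- n [z^n] A^k = k [y^n] y^k φ^n, because both sides obey the recurrence given by A^(k+1) = z A^k φ(A).
module Narayana (K : Ring₀) (torsionFree : TorsionFree K) (R : CommutativeRing.Carrier K) where

  open CommutativeRing K
  open SeriesCalculus K
  open Cancellation K torsionFree
  open Algebra.Properties.Semiring.Exp semiring using (_^_)
  open Algebra.Properties.CommutativeSemiring.Exp S.commutativeSemiring using (^-distrib-*)
  private
    module I = IntegerSolver K
    module J = IntegerSolver K[[u]]
  open import Relation.Binary.Reasoning.Setoid setoid

  kernel : Seq → Seq
  kernel f = (const R S.+ f) ⋆ (S.1# S.+ (S.- f))

  φ : Seq
  φ = kernel Y

  -- The coefficients of φ(y) = R + (1 - R) y - y², applied to three consecutive powers: multiplying
  -- by `kernel f` has this effect on coefficients.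
  combine : Carrier → Carrier → Carrier → Carrier
  combine x₀ x₁ x₂ = R * x₀ + x₁ + (- (R * x₁)) + (- x₂)

  combine-cong : ∀ {x₀ x₁ x₂ y₀ y₁ y₂} → x₀ ≈ y₀ → x₁ ≈ y₁ → x₂ ≈ y₂ → combine x₀ x₁ x₂ ≈ combine y₀ y₁ y₂
  combine-cong p q r = +-cong (+-cong (+-cong (*-congˡ p) q) (-‿cong (*-congˡ q))) (-‿cong r)

  kernel-⋆ : ∀ f g n → (kernel f ⋆ g) n ≈ combine (g n) ((f ⋆ g) n) ((f ⋆ (f ⋆ g)) n)
  kernel-⋆ f g n = trans
    (J.solve 3 (λ r f g → ((r J.:+ f) J.:* (J.:1 J.:+ (J.:- f))) J.:* g J.:=
        r J.:* g J.:+ f J.:* g J.:+ (J.:- (r J.:* (f J.:* g))) J.:+ (J.:- (f J.:* (f J.:* g)))) S.refl (const R) f g n)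
    (+-congʳ (+-cong (+-congʳ (⋆-constˡ R g n)) (-‿cong (⋆-constˡ R (f ⋆ g) n))))

  θφ : θ φ S.≈ Y S.+ (S.- (const R ⋆ Y)) S.+ (S.- (Y ⋆ Y)) S.+ (S.- (Y ⋆ Y))
  θφ = S.trans (θ-⋆ (const R S.+ Y) (S.1# S.+ (S.- Y)))
    (S.trans (S.+-cong
      (S.*-congʳ {S.1# S.+ (S.- Y)} (S.trans (θ-+ (const R) Y) (S.+-cong (θ-const R) θ-Y)))
      (S.*-congˡ {const R S.+ Y} (S.trans (θ-+ S.1# (S.- Y)) (S.+-cong (θ-const 1#) (S.trans (θ-neg Y) (S.-‿cong θ-Y))))))
      (J.solve 2 (λ r y → (J.:0 J.:+ y) J.:* (J.:1 J.:+ (J.:- y)) J.:+ (r J.:+ y) J.:* (J.:0 J.:+ (J.:- y)) J.:=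
         y J.:+ (J.:- (r J.:* y)) J.:+ (J.:- (y J.:* y)) J.:+ (J.:- (y J.:* y))) S.refl (const R) Y))

  module _ (k n : ℕ) where
    g₀ g₁ g₂ : Carrier
    g₀ = (Y ^ˢ k ⋆ φ ^ˢ n) n
    g₁ = (Y ^ˢ suc k ⋆ φ ^ˢ n) n
    g₂ = (Y ^ˢ suc (suc k) ⋆ φ ^ˢ n) n

    G-unfold : (Y ^ˢ suc k ⋆ φ ^ˢ suc n) (suc n) ≈ combine g₀ g₁ g₂
    G-unfold = begin
      (Y ^ˢ suc k ⋆ φ ^ˢ suc n) (suc n)   ≈⟨ ⋆-assoc Y (Y ^ˢ k) (φ ^ˢ suc n) (suc n) ⟩
      (Y ⋆ (Y ^ˢ k ⋆ φ ^ˢ suc n)) (suc n) ≈⟨ Y⋆-suc _ n ⟩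
      (Y ^ˢ k ⋆ (φ ⋆ φ ^ˢ n)) n           ≈⟨ J.solve 3 (λ x y z → x J.:* (y J.:* z) J.:= y J.:* (x J.:* z)) S.refl (Y ^ˢ k) φ (φ ^ˢ n) n ⟩
      (φ ⋆ (Y ^ˢ k ⋆ φ ^ˢ n)) n           ≈⟨ kernel-⋆ Y (Y ^ˢ k ⋆ φ ^ˢ n) n ⟩
      combine g₀ ((Y ⋆ (Y ^ˢ k ⋆ φ ^ˢ n)) n) ((Y ⋆ (Y ⋆ (Y ^ˢ k ⋆ φ ^ˢ n))) n)
        ≈⟨ combine-cong refl (sym (⋆-assoc Y (Y ^ˢ k) (φ ^ˢ n) n))
             (sym (J.solve 3 (λ x y z → x J.:* (x J.:* y) J.:* z J.:= x J.:* (x J.:* (y J.:* z))) S.refl Y (Y ^ˢ k) (φ ^ˢ n) n)) ⟩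
      combine g₀ g₁ g₂ ∎

    -- `combine g₀ g₁ g₂` is the coefficient of degree n in y^k φ^(n+1), where θ multiplies by n;
    -- Leibniz's rule computes the same. The last factor comes from y φ′(y) = (1 - R) y - 2 y².
    G-θ : ν n * combine g₀ g₁ g₂ ≈ ν k * combine g₀ g₁ g₂ + ν (suc n) * (g₁ + (- (R * g₁)) + (- g₂) + (- g₂))
    G-θ = begin
      ν n * combine g₀ g₁ g₂                    ≈⟨ *-congˡ eq ⟩
      θ (Y ^ˢ k ⋆ φ ^ˢ suc n) n                 ≈⟨ θ-⋆ (Y ^ˢ k) (φ ^ˢ suc n) n ⟩
      (θ (Y ^ˢ k) ⋆ φ ^ˢ suc n) n + (Y ^ˢ k ⋆ θ (φ ^ˢ suc n)) n
        ≈⟨ +-cong (trans (S.*-congʳ {φ ^ˢ suc n} (θ-Y^ k) n) (⋆-assoc (const (ν k)) (Y ^ˢ k) (φ ^ˢ suc n) n))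
                  (S.*-congˡ {Y ^ˢ k} (θ-^ φ n) n) ⟩
      (const (ν k) ⋆ (Y ^ˢ k ⋆ φ ^ˢ suc n)) n + (Y ^ˢ k ⋆ (const (ν (suc n)) ⋆ (φ ^ˢ n ⋆ θ φ))) n
        ≈⟨ +-cong (trans (⋆-constˡ (ν k) _ n) (*-congˡ (sym eq)))
             (S.trans (S.*-congˡ {Y ^ˢ k} (S.*-congˡ {const (ν (suc n))} (S.*-congˡ {φ ^ˢ n} θφ)))
               (J.solve 5 (λ y′ c p r y → y′ J.:* (c J.:* (p J.:* (y J.:+ (J.:- (r J.:* y)) J.:+ (J.:- (y J.:* y)) J.:+ (J.:- (y J.:* y))))) J.:=
                  c J.:* ((y J.:* y′) J.:* p J.:+ (J.:- (r J.:* ((y J.:* y′) J.:* p))) J.:+ (J.:- ((y J.:* (y J.:* y′)) J.:* p)) J.:+ (J.:- ((y J.:* (y J.:* y′)) J.:* p))))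
                  S.refl (Y ^ˢ k) (const (ν (suc n))) (φ ^ˢ n) (const R) Y) n) ⟩
      ν k * combine g₀ g₁ g₂ + (const (ν (suc n)) ⋆ D) n
        ≈⟨ +-congˡ (trans (⋆-constˡ (ν (suc n)) D n) (*-congˡ (+-congʳ (+-congʳ (+-congˡ (-‿cong (⋆-constˡ R (Y ^ˢ suc k ⋆ φ ^ˢ n) n))))))) ⟩
      ν k * combine g₀ g₁ g₂ + ν (suc n) * (g₁ + (- (R * g₁)) + (- g₂) + (- g₂)) ∎
      where
      eq : combine g₀ g₁ g₂ ≈ (Y ^ˢ k ⋆ φ ^ˢ suc n) n
      eq = trans (sym G-unfold) (trans (⋆-assoc Y (Y ^ˢ k) (φ ^ˢ suc n) (suc n)) (Y⋆-suc _ n))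
      D₁ D₂ D : Seq
      D₁ = Y ^ˢ suc k ⋆ φ ^ˢ n
      D₂ = Y ^ˢ suc (suc k) ⋆ φ ^ˢ n
      D = D₁ S.+ (S.- (const R ⋆ D₁)) S.+ (S.- D₂) S.+ (S.- D₂)

  Y^-⋆-zero : ∀ k f → (Y ^ˢ suc k ⋆ f) 0 ≈ 0#
  Y^-⋆-zero k f = trans (*-congʳ (zeroˡ _)) (zeroˡ _)

  combine-0 : combine 0# 0# 0# ≈ 0#
  combine-0 = I.solve 1 (λ r → r I.:* I.:0 I.:+ I.:0 I.:+ (I.:- (r I.:* I.:0)) I.:+ (I.:- I.:0) I.:= I.:0) refl R

  module _ (A : Seq) (b : ℕ) (A₀ : A 0 ≈ 0#) (A₊ : ∀ n → n ℕ.< b → A (suc n) ≈ kernel A n) where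

    A^-zero : ∀ k → (A ^ˢ k) 0 ≈ (Y ^ˢ k ⋆ S.1#) 0
    A^-zero zero    = sym (*-identityˡ _)
    A^-zero (suc k) = trans (trans (*-congʳ A₀) (zeroˡ _)) (sym (Y^-⋆-zero k S.1#))

    A^-unfold : ∀ k n → n ℕ.< b →
      (A ^ˢ suc k) (suc n) ≈ combine ((A ^ˢ k) n) ((A ^ˢ suc k) n) ((A ^ˢ suc (suc k)) n)
    A^-unfold k n n<b = begin
      A 0 * (A ^ˢ k) (suc n) + (tail A ⋆ A ^ˢ k) n   ≈⟨ +-cong (trans (*-congʳ A₀) (zeroˡ _)) (⋆-cong≤ {g = A ^ˢ k} n (λ i i≤n → A₊ i (ℕₚ.≤-<-trans i≤n n<b)) (λ _ _ → refl)) ⟩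
      0# + (kernel A ⋆ A ^ˢ k) n                     ≈⟨ +-identityˡ _ ⟩
      (kernel A ⋆ A ^ˢ k) n                          ≈⟨ kernel-⋆ A (A ^ˢ k) n ⟩
      combine ((A ^ˢ k) n) ((A ^ˢ suc k) n) ((A ^ˢ suc (suc k)) n) ∎

    lagrange : ∀ n → n ℕ.≤ b → ∀ k → ν n * (A ^ˢ k) n ≈ ν k * (Y ^ˢ k ⋆ φ ^ˢ n) n
    lagrange zero n≤b zero = trans (zeroˡ _) (sym (zeroˡ _))
    lagrange zero n≤b (suc k) = trans (zeroˡ _) (sym (trans (*-congˡ (Y^-⋆-zero k S.1#)) (zeroʳ _)))
    lagrange (suc n) n<b zero = trans (zeroʳ _) (sym (zeroˡ _))
    -- The factor n on the left makes the formula empty in degree 0, so degree 1 cannot be drawn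
    -- from it and is computed from the constant terms of the powers.
    lagrange (suc zero) 0<b (suc zero) = *-congˡ (trans (trans (A^-unfold 0 0 0<b)
      (combine-cong (A^-zero 0) (A^-zero 1) (A^-zero 2))) (sym (G-unfold 0 0)))
    lagrange (suc zero) 0<b (suc (suc k)) = trans (trans (*-congˡ vanishes) (zeroʳ _)) (sym (trans (*-congˡ vanishes′) (zeroʳ _)))
      where
      vanishes′ : (Y ^ˢ suc (suc k) ⋆ φ ^ˢ 1) 1 ≈ 0#
      vanishes′ = trans (G-unfold (suc k) 0) (trans (combine-cong (Y^-⋆-zero k S.1#) (Y^-⋆-zero (suc k) S.1#) (Y^-⋆-zero (suc (suc k)) S.1#)) combine-0)
      vanishes : (A ^ˢ suc (suc k)) 1 ≈ 0#
      vanishes = trans (A^-unfold (suc k) 0 0<b) (trans (combine-cong (A^-zero (suc k)) (A^-zero (suc (suc k))) (A^-zero (suc (suc (suc k)))))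
        (sym (trans (sym vanishes′) (G-unfold (suc k) 0))))
    -- The factor N = n + 1 turns the three coefficients of degree n + 1 into left sides of
    -- induction hypotheses, which bring in the factors κ, κ + 1 and κ + 2.
    lagrange (suc (suc n)) n<b (suc k) = ν-cancelˡ n _ _ (begin
      N * (ν (suc (suc n)) * (A ^ˢ suc k) (suc (suc n)))
        ≈⟨ *-congˡ (*-congˡ (A^-unfold k (suc n) n<b)) ⟩
      N * ((1# + N) * combine p₀ p₁ p₂)
        ≈⟨ I.solve 5 (λ N r x y z → N I.:* ((I.:1 I.:+ N) I.:* (r I.:* x I.:+ y I.:+ (I.:- (r I.:* y)) I.:+ (I.:- z))) I.:=
             (I.:1 I.:+ N) I.:* (r I.:* (N I.:* x) I.:+ (N I.:* y) I.:+ (I.:- (r I.:* (N I.:* y))) I.:+ (I.:- (N I.:* z)))) refl N R p₀ p₁ p₂ ⟩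
      (1# + N) * combine (N * p₀) (N * p₁) (N * p₂)
        ≈⟨ *-congˡ (combine-cong (lagrange (suc n) n≤b k) (lagrange (suc n) n≤b (suc k)) (lagrange (suc n) n≤b (suc (suc k)))) ⟩
      (1# + N) * combine (κ * x₀) ((1# + κ) * x₁) ((1# + (1# + κ)) * x₂)
        -- Each factor κ + i is split. The parts with i add up to the coefficient of y φ′(y) in
        -- `G-θ`, which merges with one copy of the κ part into a factor N.
        ≈⟨ I.solve 6 (λ N r κ x y z → (I.:1 I.:+ N) I.:* (r I.:* (κ I.:* x) I.:+ (I.:1 I.:+ κ) I.:* y I.:+ (I.:- (r I.:* ((I.:1 I.:+ κ) I.:* y))) I.:+ (I.:- ((I.:1 I.:+ (I.:1 I.:+ κ)) I.:* z))) I.:=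
             N I.:* κ I.:* (r I.:* x I.:+ y I.:+ (I.:- (r I.:* y)) I.:+ (I.:- z)) I.:+
               (κ I.:* (r I.:* x I.:+ y I.:+ (I.:- (r I.:* y)) I.:+ (I.:- z)) I.:+ (I.:1 I.:+ N) I.:* (y I.:+ (I.:- (r I.:* y)) I.:+ (I.:- z) I.:+ (I.:- z)))) refl N R κ x₀ x₁ x₂ ⟩
      N * κ * combine x₀ x₁ x₂ + (κ * combine x₀ x₁ x₂ + (1# + N) * (x₁ + (- (R * x₁)) + (- x₂) + (- x₂)))
        ≈⟨ +-congˡ (G-θ k (suc n)) ⟨
      N * κ * combine x₀ x₁ x₂ + N * combine x₀ x₁ x₂
        ≈⟨ I.solve 3 (λ N κ x → N I.:* κ I.:* x I.:+ N I.:* x I.:= N I.:* ((I.:1 I.:+ κ) I.:* x)) refl N κ _ ⟩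
      N * ((1# + κ) * combine x₀ x₁ x₂)
        ≈⟨ *-congˡ (*-congˡ (G-unfold k (suc n))) ⟨
      N * (ν (suc k) * (Y ^ˢ suc k ⋆ φ ^ˢ suc (suc n)) (suc (suc n))) ∎)
      where
      N = ν (suc n)
      κ = ν k
      n≤b = ℕₚ.<⇒≤ n<b
      p₀ = (A ^ˢ k) (suc n)
      p₁ = (A ^ˢ suc k) (suc n)
      p₂ = (A ^ˢ suc (suc k)) (suc n)
      x₀ = g₀ k (suc n)
      x₁ = g₁ k (suc n)
      x₂ = g₂ k (suc n)

  pascal : ∀ n i → ν (n C i) + ν (n C suc i) ≈ ν (suc n C suc i)
  pascal n i = trans (sym (ν-+ (n C i) (n C suc i))) (ν-cong (nCk+nC[k+1]≡[n+1]C[k+1] n i))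

  [1-Y]^ : ∀ n i → ((S.1# S.+ (S.- Y)) ^ˢ n) i ≈ (- 1#) ^ i * ν (n C i)
  [1-Y]^ zero zero = sym (trans (*-identityˡ _) ν-1)
  [1-Y]^ zero (suc i) = sym (zeroʳ _)
  [1-Y]^ (suc n) zero = begin
    (1# + (- 0#)) * ((S.1# S.+ (S.- Y)) ^ˢ n) 0     ≈⟨ *-congˡ ([1-Y]^ n 0) ⟩
    (1# + (- 0#)) * (1# * (1# + 0#))                ≈⟨ I.solve 0 ((I.:1 I.:+ (I.:- I.:0)) I.:* (I.:1 I.:* (I.:1 I.:+ I.:0)) I.:= I.:1 I.:* (I.:1 I.:+ I.:0)) refl ⟩
    1# * (1# + 0#)                                  ∎
  [1-Y]^ (suc n) (suc i) = begin
    ((S.1# S.+ (S.- Y)) ⋆ P) (suc i)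
      ≈⟨ J.solve 2 (λ y p → (J.:1 J.:+ (J.:- y)) J.:* p J.:= p J.:+ (J.:- (y J.:* p))) S.refl Y P (suc i) ⟩
    P (suc i) + (- (Y ⋆ P) (suc i))
      ≈⟨ +-cong ([1-Y]^ n (suc i)) (-‿cong (trans (Y⋆-suc P i) ([1-Y]^ n i))) ⟩
    (- 1#) * σ * ν (n C suc i) + (- (σ * ν (n C i)))
      ≈⟨ I.solve 3 (λ σ x y → (I.:- I.:1) I.:* σ I.:* x I.:+ (I.:- (σ I.:* y)) I.:= (I.:- I.:1) I.:* σ I.:* (y I.:+ x)) refl σ _ _ ⟩
    (- 1#) * σ * (ν (n C i) + ν (n C suc i))
      ≈⟨ *-congˡ (pascal n i) ⟩
    (- 1#) * σ * ν (suc n C suc i) ∎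
    where
    P = (S.1# S.+ (S.- Y)) ^ˢ n
    σ = (- 1#) ^ i

  [R+Y]^ : ∀ n i → i ℕ.≤ n → ((const R S.+ Y) ^ˢ n) i ≈ ν (n C i) * R ^ (n ∸ i)
  [R+Y]^≥ : ∀ n i → n ℕ.< i → ((const R S.+ Y) ^ˢ n) i ≈ 0#
  [R+Y]-suc : ∀ n i → ((const R S.+ Y) ^ˢ suc n) (suc i) ≈ R * ((const R S.+ Y) ^ˢ n) (suc i) + ((const R S.+ Y) ^ˢ n) i
  [R+Y]-suc n i = trans (S.distribʳ P (const R) Y (suc i)) (+-cong (⋆-constˡ R P (suc i)) (Y⋆-suc P i))
    where P = (const R S.+ Y) ^ˢ n
  [R+Y]^≥ zero (suc i) _ = refl
  [R+Y]^≥ (suc n) (suc i) (ℕ.s≤s n<i) = trans ([R+Y]-suc n i)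
    (trans (+-cong (trans (*-congˡ ([R+Y]^≥ n (suc i) (ℕₚ.m≤n⇒m≤1+n n<i))) (zeroʳ _)) ([R+Y]^≥ n i n<i)) (+-identityˡ _))
  [R+Y]^ zero zero _ = sym (trans (*-identityʳ _) ν-1)
  [R+Y]^ (suc n) zero _ = begin
    (R + 0#) * ((const R S.+ Y) ^ˢ n) 0   ≈⟨ *-congˡ ([R+Y]^ n 0 ℕ.z≤n) ⟩
    (R + 0#) * ((1# + 0#) * R ^ n)        ≈⟨ I.solve 2 (λ r p → (r I.:+ I.:0) I.:* ((I.:1 I.:+ I.:0) I.:* p) I.:= (I.:1 I.:+ I.:0) I.:* (r I.:* p)) refl R _ ⟩
    (1# + 0#) * (R * R ^ n)               ∎
  [R+Y]^ (suc n) (suc i) (ℕ.s≤s i≤n) with ℕₚ.m≤n⇒m<n∨m≡n i≤n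
  ... | inj₁ i<n = begin
    ((const R S.+ Y) ^ˢ suc n) (suc i)      ≈⟨ [R+Y]-suc n i ⟩
    R * P (suc i) + P i                     ≈⟨ +-cong (*-congˡ ([R+Y]^ n (suc i) i<n)) ([R+Y]^ n i i≤n) ⟩
    R * (ν (n C suc i) * R ^ (n ∸ suc i)) + ν (n C i) * R ^ (n ∸ i)
      ≈⟨ +-congʳ (I.solve 3 (λ r x y → r I.:* (x I.:* y) I.:= x I.:* (r I.:* y)) refl R _ _) ⟩
    ν (n C suc i) * R ^ suc (n ∸ suc i) + ν (n C i) * R ^ (n ∸ i)
      ≡⟨ ≡.cong (λ j → ν (n C suc i) * R ^ j + ν (n C i) * R ^ (n ∸ i)) (≡.sym (ℕₚ.+-∸-assoc 1 i<n)) ⟩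
    ν (n C suc i) * R ^ (n ∸ i) + ν (n C i) * R ^ (n ∸ i)
      ≈⟨ trans (sym (distribʳ _ _ _)) (*-congʳ (trans (+-comm _ _) (pascal n i))) ⟩
    ν (suc n C suc i) * R ^ (n ∸ i) ∎
    where P = (const R S.+ Y) ^ˢ n
  ... | inj₂ ≡.refl = begin
    ((const R S.+ Y) ^ˢ suc n) (suc n)      ≈⟨ [R+Y]-suc n n ⟩
    R * P (suc n) + P n                     ≈⟨ +-cong (trans (*-congˡ ([R+Y]^≥ n (suc n) ℕₚ.≤-refl)) (zeroʳ _)) ([R+Y]^ n n i≤n) ⟩
    0# + ν (n C n) * R ^ (n ∸ n)            ≈⟨ +-identityˡ _ ⟩
    ν (n C n) * R ^ (n ∸ n)                 ≈⟨ *-congʳ (ν-cong (≡.trans (nCn≡1 n) (≡.sym (nCn≡1 (suc n))))) ⟩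
    ν (suc n C suc n) * R ^ (n ∸ n) ∎
    where P = (const R S.+ Y) ^ˢ n

  module _ (A : Seq) (b : ℕ) (A₀ : A 0 ≈ 0#) (A₊ : ∀ n → n ℕ.< suc b → A (suc n) ≈ kernel A n) where

    -- For k = 1 only [y^b] φ^(b+1) is left. It is expanded with the binomial theorems for both
    -- factors of φ = (R + y) (1 - y); i is the exponent of -y, and symmetry turns the binomial of b
    -- + 1 over b - i into the one over i + 1.
    narayana : ν (suc b) * A (suc b) ≈
      sumTo (suc b) (λ i → (- 1#) ^ i * ν ((suc b C suc i) ℕ.* (suc b C i)) * R ^ suc i)
    narayana = begin
      ν (suc b) * A (suc b)                           ≈⟨ *-congˡ (S.*-identityʳ A (suc b)) ⟨
      ν (suc b) * (A ^ˢ 1) (suc b)                    ≈⟨ lagrange A (suc b) A₀ A₊ (suc b) ℕₚ.≤-refl 1 ⟩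
      ν 1 * (Y ^ˢ 1 ⋆ φ ^ˢ suc b) (suc b)             ≈⟨ trans (*-congʳ ν-1) (*-identityˡ _) ⟩
      (Y ^ˢ 1 ⋆ φ ^ˢ suc b) (suc b)                   ≈⟨ S.*-congʳ {φ ^ˢ suc b} (S.*-identityʳ Y) (suc b) ⟩
      (Y ⋆ φ ^ˢ suc b) (suc b)                        ≈⟨ Y⋆-suc (φ ^ˢ suc b) b ⟩
      (φ ^ˢ suc b) b                                  ≈⟨ ^-distrib-* (const R S.+ Y) (S.1# S.+ (S.- Y)) (suc b) b ⟩
      ((const R S.+ Y) ^ˢ suc b ⋆ (S.1# S.+ (S.- Y)) ^ˢ suc b) b
        ≈⟨ ⋆-comm ((const R S.+ Y) ^ˢ suc b) ((S.1# S.+ (S.- Y)) ^ˢ suc b) b ⟩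
      ((S.1# S.+ (S.- Y)) ^ˢ suc b ⋆ (const R S.+ Y) ^ˢ suc b) b
        ≈⟨ ⋆-sum ((S.1# S.+ (S.- Y)) ^ˢ suc b) ((const R S.+ Y) ^ˢ suc b) b ⟩
      sumTo (suc b) (λ i → ((S.1# S.+ (S.- Y)) ^ˢ suc b) i * ((const R S.+ Y) ^ˢ suc b) (b ∸ i))
        ≈⟨ sumTo-cong (suc b) term ⟩
      sumTo (suc b) (λ i → (- 1#) ^ i * ν ((suc b C suc i) ℕ.* (suc b C i)) * R ^ suc i) ∎
      where
      term : ∀ i → i ℕ.< suc b → ((S.1# S.+ (S.- Y)) ^ˢ suc b) i * ((const R S.+ Y) ^ˢ suc b) (b ∸ i)
             ≈ (- 1#) ^ i * ν ((suc b C suc i) ℕ.* (suc b C i)) * R ^ suc i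
      term i (ℕ.s≤s i≤b) = begin
        ((S.1# S.+ (S.- Y)) ^ˢ suc b) i * ((const R S.+ Y) ^ˢ suc b) (b ∸ i)
          ≈⟨ *-cong ([1-Y]^ (suc b) i) ([R+Y]^ (suc b) (b ∸ i) (ℕₚ.m≤n⇒m≤1+n (ℕₚ.m∸n≤m b i))) ⟩
        (- 1#) ^ i * ν (suc b C i) * (ν (suc b C (b ∸ i)) * R ^ (suc b ∸ (b ∸ i)))
          ≈⟨ I.solve 4 (λ s x y r → s I.:* x I.:* (y I.:* r) I.:= s I.:* (y I.:* x) I.:* r) refl _ _ _ _ ⟩
        (- 1#) ^ i * (ν (suc b C (b ∸ i)) * ν (suc b C i)) * R ^ (suc b ∸ (b ∸ i))
          ≡⟨ ≡.cong₂ (λ x y → (- 1#) ^ i * (ν x * ν (suc b C i)) * R ^ y)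
               (≡.sym (nCk≡nC[n∸k] {suc i} {suc b} (ℕ.s≤s i≤b))) (≡.trans (ℕₚ.+-∸-assoc 1 (ℕₚ.m∸n≤m b i)) (≡.cong suc (ℕₚ.m∸[m∸n]≡n i≤b))) ⟩
        (- 1#) ^ i * (ν (suc b C suc i) * ν (suc b C i)) * R ^ suc i
          ≈⟨ *-congʳ (*-congˡ (ν-* (suc b C suc i) (suc b C i))) ⟨
        (- 1#) ^ i * ν ((suc b C suc i) ℕ.* (suc b C i)) * R ^ suc i ∎

-- Squarefree monomials

size : Vec Bool n → ℕ
size []          = 0
size (true ∷ S)  = suc (size S)
size (false ∷ S) = size S

size≤ : (S : Vec Bool n) → size S ℕ.≤ n
size≤ []          = ℕ.z≤n
size≤ (true ∷ S)  = ℕ.s≤s (size≤ S)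
size≤ (false ∷ S) = ℕₚ.m≤n⇒m≤1+n (size≤ S)

splits : Vec Bool n → List (Vec Bool n × Vec Bool n)
splits []          = ([] , []) ∷ []
splits (false ∷ S) = map (λ (T , U) → false ∷ T , false ∷ U) (splits S)
splits (true ∷ S)  = map (λ (T , U) → false ∷ T , true ∷ U) (splits S)
                  ++ map (λ (T , U) → true ∷ T , false ∷ U) (splits S)

elements : Vec Bool n → List (Fin n × Vec Bool n)
elements []          = []
elements (false ∷ S) = map (λ (i , S′) → suc i , false ∷ S′) (elements S)
elements (true ∷ S)  = (zero , false ∷ S) ∷ map (λ (i , S′) → suc i , true ∷ S′) (elements S)

splits-size : (S : Vec Bool n) → All (λ (T , U) → size T ℕ.+ size U ≡ size S) (splits S)
splits-size []          = ≡.refl ∷ []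
splits-size (false ∷ S) = Allₚ.map⁺ (splits-size S)
splits-size (true ∷ S)  = Allₚ.++⁺
  (Allₚ.map⁺ (All.map (λ {TU} e → ≡.trans (ℕₚ.+-suc (size (proj₁ TU)) _) (≡.cong suc e)) (splits-size S)))
  (Allₚ.map⁺ (All.map (≡.cong suc) (splits-size S)))

elements-size : (S : Vec Bool n) → All (λ (_ , S′) → size S ≡ suc (size S′)) (elements S)
elements-size []          = []
elements-size (false ∷ S) = Allₚ.map⁺ (elements-size S)
elements-size (true ∷ S)  = ≡.refl ∷ Allₚ.map⁺ (All.map (≡.cong suc) (elements-size S))

module ListSum (K : Ring₀) where
  open CommutativeRing K
  open IntegerSolver K
  open Naturals K
  ΣL : List I → (I → Carrier) → Carrier
  ΣL []       F = 0#
  ΣL (x ∷ xs) F = F x + ΣL xs F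

  ΣL-cong : ∀ {xs : List I} {F G} → All (λ x → F x ≈ G x) xs → ΣL xs F ≈ ΣL xs G
  ΣL-cong []       = refl
  ΣL-cong (p ∷ ps) = +-cong p (ΣL-cong ps)

  ΣL-cong′ : ∀ (xs : List I) {F G} → (∀ x → F x ≈ G x) → ΣL xs F ≈ ΣL xs G
  ΣL-cong′ xs p = ΣL-cong (All.universal p xs)

  ΣL-++ : ∀ (xs ys : List I) F → ΣL (xs ++ ys) F ≈ ΣL xs F + ΣL ys F
  ΣL-++ []       ys F = sym (+-identityˡ _)
  ΣL-++ (x ∷ xs) ys F = trans (+-congˡ (ΣL-++ xs ys F)) (sym (+-assoc _ _ _))

  ΣL-map : ∀ (f : I → I′) xs F → ΣL (map f xs) F ≈ ΣL xs (F ∘ f)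
  ΣL-map f []       F = refl
  ΣL-map f (x ∷ xs) F = +-congˡ (ΣL-map f xs F)

  ΣL-+ : ∀ (xs : List I) F G → ΣL xs (λ x → F x + G x) ≈ ΣL xs F + ΣL xs G
  ΣL-+ []       F G = sym (+-identityˡ 0#)
  ΣL-+ (x ∷ xs) F G = trans (+-congˡ (ΣL-+ xs F G))
    (solve 4 (λ x y z u → (x :+ y) :+ (z :+ u) := (x :+ z) :+ (y :+ u)) refl _ _ _ _)

  ΣL-*ˡ : ∀ c (xs : List I) F → c * ΣL xs F ≈ ΣL xs (λ x → c * F x)
  ΣL-*ˡ c []       F = zeroʳ c
  ΣL-*ˡ c (x ∷ xs) F = trans (distribˡ _ _ _) (+-congˡ (ΣL-*ˡ c xs F))

  ΣL-*ʳ : ∀ c (xs : List I) F → ΣL xs F * c ≈ ΣL xs (λ x → F x * c)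
  ΣL-*ʳ c xs F = trans (*-comm _ _) (trans (ΣL-*ˡ c xs F) (ΣL-cong′ xs (λ _ → *-comm _ _)))

  ΣL-zero : ∀ {xs : List I} {F} → All (λ x → F x ≈ 0#) xs → ΣL xs F ≈ 0#
  ΣL-zero []       = refl
  ΣL-zero (p ∷ ps) = trans (+-cong p (ΣL-zero ps)) (+-identityˡ 0#)

  ΣL-elements-const : ∀ (S : Vec Bool n) c → ΣL (elements S) (λ _ → c) ≈ ν (size S) * c
  ΣL-elements-const []          c = sym (zeroˡ c)
  ΣL-elements-const (false ∷ S) c = trans (ΣL-map _ (elements S) _) (ΣL-elements-const S c)
  ΣL-elements-const (true ∷ S)  c = trans (+-congˡ (trans (ΣL-map _ (elements S) _) (ΣL-elements-const S c)))
    (solve 2 (λ x c → c :+ x :* c := (:1 :+ x) :* c) refl _ c)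

-- K[t] / (t²)
module Dual (K : Ring₀) where
  open CommutativeRing K
  open IntegerSolver K

  setoidᴰ : Setoid 0ℓ 0ℓ
  setoidᴰ = record
    { Carrier = Carrier × Carrier
    ; _≈_ = λ (x , y) (x′ , y′) → x ≈ x′ × y ≈ y′
    ; isEquivalence = record
      { refl = refl , refl
      ; sym = λ (p , q) → sym p , sym q
      ; trans = λ (p , q) (p′ , q′) → trans p p′ , trans q q′ } }

  dualRing : Ring₀
  dualRing = MakeRing.commutativeRing setoidᴰ
    (λ (x , y) (x′ , y′) → x + x′ , y + y′)
    (λ (x , y) (x′ , y′) → x * x′ , x * y′ + y * x′)
    (λ (x , y) → - x , - y) (0# , 0#) (1# , 0#)
    (λ (p , q) (p′ , q′) → +-cong p p′ , +-cong q q′)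
    (λ _ _ _ → +-assoc _ _ _ , +-assoc _ _ _)
    (λ _ _ → +-comm _ _ , +-comm _ _)
    (λ _ → +-identityˡ _ , +-identityˡ _)
    (λ (p , q) → -‿cong p , -‿cong q)
    (λ _ → -‿inverseˡ _ , -‿inverseˡ _)
    (λ (p , q) (p′ , q′) → *-cong p p′ , +-cong (*-cong p q′) (*-cong q p′))
    (λ _ _ _ → *-assoc _ _ _ ,
      solve 6 (λ x y x′ y′ x″ y″ → x :* x′ :* y″ :+ (x :* y′ :+ y :* x′) :* x″ := x :* (x′ :* y″ :+ y′ :* x″) :+ y :* (x′ :* x″)) refl _ _ _ _ _ _)
    (λ _ _ → *-comm _ _ , solve 4 (λ x y x′ y′ → x :* y′ :+ y :* x′ := x′ :* y :+ y′ :* x) refl _ _ _ _)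
    (λ _ → *-identityˡ _ , solve 2 (λ x y → :1 :* y :+ :0 :* x := y) refl _ _)
    (λ _ _ _ → distribʳ _ _ _ ,
      solve 6 (λ x y x′ y′ x″ y″ → (x′ :+ x″) :* y :+ (y′ :+ y″) :* x := (x′ :* y :+ y′ :* x) :+ (x″ :* y :+ y″ :* x)) refl _ _ _ _ _ _)

  open Naturals K
  open Naturals dualRing using () renaming (ν to νᴰ)
  private module D = CommutativeRing dualRing
  open Algebra.Properties.Semiring.Exp semiring using (_^_)
  open Algebra.Properties.Semiring.Exp D.semiring using () renaming (_^_ to _^ᴰ_)

  νᴰ≈ : ∀ n → νᴰ n D.≈ (ν n , 0#)
  νᴰ≈ zero    = refl , refl
  νᴰ≈ (suc n) = let p , q = νᴰ≈ n in +-congˡ p , trans (+-congˡ q) (+-identityˡ 0#)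

  dual-torsionFree : TorsionFree K → TorsionFree dualRing
  dual-torsionFree tf n (x , y) (p , q) =
    tf n x (trans (*-congʳ (sym (proj₁ (νᴰ≈ (suc n))))) p) ,
    tf n y (trans (trans (solve 3 (λ a x y → a :* y := a :* y :+ :0 :* x) refl (ν (suc n)) x y)
      (sym (+-cong (*-congʳ (proj₁ (νᴰ≈ (suc n)))) (*-congʳ (proj₂ (νᴰ≈ (suc n))))))) q)

  -- The second component is the derivative in t, so this is the power rule. It is the source of the
  -- factor k + 1 that is cancelled in `first-sliceGF`.
  ^-dual : ∀ x y k → (x , y) ^ᴰ suc k D.≈ (x ^ suc k , ν (suc k) * (y * x ^ k))
  ^-dual x y zero = refl , solve 2 (λ x y → x :* :0 :+ y :* :1 := (:1 :+ :0) :* (y :* :1)) refl x y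
  ^-dual x y (suc k) = let p , q = ^-dual x y k in *-congˡ p ,
    trans (+-cong (*-congˡ q) (*-congˡ p))
      (solve 4 (λ x y z n → x :* (n :* (y :* z)) :+ y :* (x :* z) := (:1 :+ n) :* (y :* (x :* z))) refl x y (x ^ k) _)

  proj₁-^ : ∀ x y k → proj₁ ((x , y) ^ᴰ k) ≈ x ^ k
  proj₁-^ x y zero    = refl
  proj₁-^ x y (suc k) = *-congˡ (proj₁-^ x y k)

-- K[t₁, …, tₙ] / (t₁², …, tₙ²); its monomials are the subsets of {1, …, n}.
subsetRing : Ring₀ → ℕ → Ring₀
subsetRing K zero    = K
subsetRing K (suc n) = Dual.dualRing (subsetRing K n)

subsetRing-torsionFree : ∀ {K} → TorsionFree K → ∀ n → TorsionFree (subsetRing K n)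
subsetRing-torsionFree tf zero    = tf
subsetRing-torsionFree tf (suc n) = Dual.dual-torsionFree (subsetRing _ n) (subsetRing-torsionFree tf n)

module SubsetRing (K : Ring₀) where
  open CommutativeRing K hiding (zero)
  open ListSum K
  open Naturals K
  module E (n : ℕ) where
    open CommutativeRing (subsetRing K n) public
    open Algebra.Properties.Semiring.Exp (CommutativeRing.semiring (subsetRing K n)) public using (_^_)

  Elt : ℕ → Set
  Elt n = E.Carrier n

  coef : Vec Bool n → Elt n → Carrier
  coef []          f = f
  coef (false ∷ S) f = coef S (proj₁ f)
  coef (true ∷ S)  f = coef S (proj₂ f)

  coef-cong : (S : Vec Bool n) {f g : Elt n} → E._≈_ n f g → coef S f ≈ coef S g
  coef-cong []          p = p
  coef-cong (false ∷ S) p = coef-cong S (proj₁ p)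
  coef-cong (true ∷ S)  p = coef-cong S (proj₂ p)

  coef-ext : ∀ n (f g : Elt n) → (∀ (S : Vec Bool n) → coef S f ≈ coef S g) → E._≈_ n f g
  coef-ext zero    f g p = p []
  coef-ext (suc n) f g p = coef-ext n _ _ (λ S → p (false ∷ S)) , coef-ext n _ _ (λ S → p (true ∷ S))

  coef-0 : (S : Vec Bool n) → coef S (E.0# n) ≈ 0#
  coef-0 []          = refl
  coef-0 (false ∷ S) = coef-0 S
  coef-0 (true ∷ S)  = coef-0 S

  coef-+ : (S : Vec Bool n) (f g : Elt n) → coef S (E._+_ n f g) ≈ coef S f + coef S g
  coef-+ []          f g = refl
  coef-+ (false ∷ S) f g = coef-+ S (proj₁ f) (proj₁ g)
  coef-+ (true ∷ S)  f g = coef-+ S (proj₂ f) (proj₂ g)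

  coef-neg : (S : Vec Bool n) (f : Elt n) → coef S (E.-_ n f) ≈ - coef S f
  coef-neg []          f = refl
  coef-neg (false ∷ S) f = coef-neg S (proj₁ f)
  coef-neg (true ∷ S)  f = coef-neg S (proj₂ f)

  coef-ν : (S : Vec Bool n) (k : ℕ) (f : Elt n) → coef S (E._*_ n (Naturals.ν (subsetRing K n) k) f) ≈ ν k * coef S f
  coef-ν {n} S zero    f = trans (coef-cong S (E.zeroˡ n f)) (trans (coef-0 S) (sym (zeroˡ _)))
  coef-ν {n} S (suc k) f = trans
    (coef-cong S (J.solve 2 (λ k f → (J.:1 J.:+ k) J.:* f J.:= f J.:+ k J.:* f) (E.refl n) (Naturals.ν (subsetRing K n) k) f))
    (trans (coef-+ S f _) (trans (+-congˡ (coef-ν S k f))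
      (I.solve 2 (λ k f → f I.:+ k I.:* f I.:= (I.:1 I.:+ k) I.:* f) refl _ _)))
    where
    module I = IntegerSolver K
    module J = IntegerSolver (subsetRing K n)

  coef-1 : (S : Vec Bool n) → 0 ℕ.< size S → coef S (E.1# n) ≈ 0#
  coef-1 (false ∷ S) p = coef-1 S p
  coef-1 (true ∷ S)  p = coef-0 S

  coef-1∅ : (S : Vec Bool n) → size S ≡ 0 → coef S (E.1# n) ≈ 1#
  coef-1∅ []          p = refl
  coef-1∅ (false ∷ S) p = coef-1∅ S p

  coef-* : (S : Vec Bool n) (f g : Elt n) →
    coef S (E._*_ n f g) ≈ ΣL (splits S) (λ (T , U) → coef T f * coef U g)
  coef-* []          f g = sym (+-identityʳ _)
  coef-* (false ∷ S) f g = trans (coef-* S _ _) (sym (ΣL-map _ (splits S) _))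
  coef-* (true ∷ S)  f g = trans (coef-+ S _ _) (trans (+-cong (coef-* S _ _) (coef-* S _ _))
    (sym (trans (ΣL-++ (map _ (splits S)) _ _) (+-cong (ΣL-map _ (splits S) _) (ΣL-map _ (splits S) _)))))

  -- t₁ f₁ + ⋯ + tₙ fₙ
  tsum : (Fin n → Elt n) → Elt n
  tsum {zero}  f = E.0# 0
  tsum {suc n} f = tsum (λ i → proj₁ (f (suc i))) , E._+_ n (proj₁ (f zero)) (tsum (λ i → proj₂ (f (suc i))))

  coef-tsum : (S : Vec Bool n) (f : Fin n → Elt n) → coef S (tsum f) ≈ ΣL (elements S) (λ (i , S′) → coef S′ (f i))
  coef-tsum []          f = refl
  coef-tsum (false ∷ S) f = trans (coef-tsum S _) (sym (ΣL-map _ (elements S) _))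
  coef-tsum (true ∷ S)  f = trans (coef-+ S _ _) (+-congˡ (trans (coef-tsum S _) (sym (ΣL-map _ (elements S) _))))

  tsum-+ : ∀ n (f g : Fin n → Elt n) → E._≈_ n (tsum (λ i → E._+_ n (f i) (g i))) (E._+_ n (tsum f) (tsum g))
  tsum-+ zero    f g = sym (+-identityˡ 0#)
  tsum-+ (suc n) f g = tsum-+ n _ _ , E.trans n (E.+-congˡ n (tsum-+ n _ _))
    (solve 4 (λ x y z u → (x :+ y) :+ (z :+ u) := (x :+ z) :+ (y :+ u)) (E.refl n) _ _ _ _)
    where open IntegerSolver (subsetRing K n)

  tsum-* : ∀ n (f : Fin n → Elt n) (h : Elt n) → E._≈_ n (E._*_ n (tsum f) h) (tsum (λ i → E._*_ n (f i) h))
  tsum-* zero    f h = zeroˡ h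
  tsum-* (suc n) f (h₀ , h₁) = tsum-* n _ h₀ ,
    E.trans n (solve 5 (λ a x b h₀ h₁ → a :* h₁ :+ (x :+ b) :* h₀ := x :* h₀ :+ (a :* h₁ :+ b :* h₀)) (E.refl n) _ _ _ h₀ h₁)
      (E.+-congˡ n (E.trans n (E.+-cong n (tsum-* n _ h₁) (tsum-* n _ h₀)) (E.sym n (tsum-+ n _ _))))
    where open IntegerSolver (subsetRing K n)

  -- Each of the k factors has no constant term and so uses up at least one variable. This keeps all
  -- sums over powers of R finite.
  nilpotent : (R : Elt n) → (∀ (S : Vec Bool n) → size S ≡ 0 → coef S R ≈ 0#) →
              ∀ k (S : Vec Bool n) → size S ℕ.< k → coef S (E._^_ n R k) ≈ 0#
  nilpotent {n} R R∅ (suc k) S (ℕ.s≤s s≤k) = trans (coef-* S R _) (ΣL-zero (All.map (λ {TU} → term {TU}) (splits-size S)))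
    where
    term : ∀ {TU : Vec Bool n × Vec Bool n} → size (proj₁ TU) ℕ.+ size (proj₂ TU) ≡ size S →
           coef (proj₁ TU) R * coef (proj₂ TU) (E._^_ n R k) ≈ 0#
    term {T , U} e with size T in eq
    ... | zero  = trans (*-congʳ (R∅ T eq)) (zeroˡ _)
    ... | suc t = trans (*-congˡ (nilpotent R R∅ k U
      (ℕₚ.<-≤-trans (ℕ.s≤s (ℕₚ.m≤n+m (size U) t)) (ℕₚ.≤-trans (ℕₚ.≤-reflexive e) s≤k)))) (zeroʳ _)

-- Labelled Lagrange inversion

module ProductSeries (K : Ring₀) where
  open CommutativeRing K hiding (zero)
  open SeriesCalculus K
  open ListSum K
  private
    module SL = ListSum K[[u]]
    module SN = Naturals K[[u]]
    module J = IntegerSolver K[[u]]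

  ∏ : (Fin n → Seq) → Vec Bool n → Seq
  ∏ Q []          = S.1#
  ∏ Q (true ∷ T)  = Q zero ⋆ ∏ (Q ∘ suc) T
  ∏ Q (false ∷ T) = ∏ (Q ∘ suc) T

  ∏-∅ : (Q : Fin n → Seq) (T : Vec Bool n) → size T ≡ 0 → ∏ Q T S.≈ S.1#
  ∏-∅ Q []          p = S.refl
  ∏-∅ Q (false ∷ T) p = ∏-∅ (Q ∘ suc) T p

  ∏-elements : (Q : Fin n → Seq) (T : Vec Bool n) →
    All (λ (i , T′) → Q i ⋆ ∏ Q T′ S.≈ ∏ Q T) (elements T)
  ∏-elements Q []          = []
  ∏-elements Q (false ∷ T) = Allₚ.map⁺ (∏-elements (Q ∘ suc) T)
  ∏-elements Q (true ∷ T)  = S.refl ∷ Allₚ.map⁺ (All.map (λ {iT} p →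
    S.trans (J.solve 3 (λ x y z → x J.:* (y J.:* z) J.:= y J.:* (x J.:* z)) S.refl (Q (suc (proj₁ iT))) (Q zero) (∏ (Q ∘ suc) (proj₂ iT)))
            (S.*-congˡ {Q zero} p)) (∏-elements (Q ∘ suc) T))

  -- Leibniz's rule: for i in T, removing i leaves the product of the other factors.
  ∏-θ : (Q : Fin n → Seq) (T : Vec Bool n) →
    SL.ΣL (elements T) (λ (i , T′) → θ (Q i) ⋆ ∏ Q T′) S.≈ θ (∏ Q T)
  ∏-θ Q []          = S.sym (θ-const 1#)
  ∏-θ Q (false ∷ T) = S.trans (SL.ΣL-map _ (elements T) _) (∏-θ (Q ∘ suc) T)
  ∏-θ Q (true ∷ T)  = S.trans (S.+-congˡ {θ (Q zero) ⋆ ∏ (Q ∘ suc) T} (S.trans (SL.ΣL-map _ (elements T) _)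
    (S.trans (SL.ΣL-cong′ (elements T) (λ (i , T′) → J.solve 3 (λ x y z → x J.:* (y J.:* z) J.:= y J.:* (x J.:* z)) S.refl (θ (Q (suc i))) (Q zero) (∏ (Q ∘ suc) T′)))
      (S.trans (S.sym (SL.ΣL-*ˡ (Q zero) (elements T) _)) (S.*-congˡ {Q zero} (∏-θ (Q ∘ suc) T))))))
    (S.sym (θ-⋆ (Q zero) (∏ (Q ∘ suc) T)))

  ΣL-coefficient : ∀ {I : Set} (xs : List I) (F : I → Seq) d → SL.ΣL xs F d ≈ ΣL xs (λ x → F x d)
  ΣL-coefficient []       F d = refl
  ΣL-coefficient (x ∷ xs) F d = +-congˡ (ΣL-coefficient xs F d)

  const-ν : ∀ m f → const (ν m) ⋆ f S.≈ SN.ν m ⋆ f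
  const-ν m f = S.*-congʳ {f} (go m)
    where
    go : ∀ m → const (ν m) S.≈ SN.ν m
    go zero    = const-0
    go (suc m) = S.trans (const-ν-suc m) (S.+-congˡ {S.1#} (go m))

-- Lagrange inversion in K[t₁, …, tₙ] / (t₁², …, tₙ²): eqn states that R^(k+1) g(R) = R^k Σᵢ tᵢ Qᵢ(R).
module Lagrange (K : Ring₀) {n : ℕ} (R : CommutativeRing.Carrier (subsetRing K n))
  (g w : ℕ → CommutativeRing.Carrier K) (Q : Fin n → ℕ → CommutativeRing.Carrier K) where

  open CommutativeRing K hiding (zero)
  open SubsetRing K
  open SeriesCalculus K
  open ListSum K
  open ProductSeries K
  open E n using () renaming (_^_ to _^ᴱ_)
  private
    module SL = ListSum K[[u]]
    module I = IntegerSolver K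
    module J = IntegerSolver K[[u]]
  open import Relation.Binary.Reasoning.Setoid setoid

  -- Since `g 0` is 1, the equation expresses δ (k + 1) by values of δ at larger arguments. Descent
  -- therefore starts above s, where δ vanishes.
  downward : ∀ (δ : ℕ → Carrier) J s → 0 ℕ.< J → g 0 ≈ 1# →
    (∀ k → sumTo J (λ j → g j * δ (suc k ℕ.+ j)) ≈ 0#) → (∀ k → s ℕ.< k → δ k ≈ 0#) → ∀ k → δ (suc k) ≈ 0#
  downward δ (suc J) s _ g₀ eqn big k = go (suc s) k (ℕ.s≤s (ℕₚ.m≤n⇒m≤o+n k (ℕₚ.n≤1+n s)))
    where
    go : ∀ d k → s ℕ.< suc k ℕ.+ d → δ (suc k) ≈ 0#
    go zero    k p = big (suc k) (≡.subst (s ℕ.<_) (ℕₚ.+-identityʳ (suc k)) p)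
    go (suc d) k p = begin
      δ (suc k)                                      ≈⟨ *-identityˡ _ ⟨
      1# * δ (suc k)                                 ≈⟨ *-cong g₀ (reflexive (≡.cong δ (ℕₚ.+-identityʳ (suc k)))) ⟨
      g 0 * δ (suc k ℕ.+ 0)                          ≈⟨ +-identityʳ _ ⟨
      g 0 * δ (suc k ℕ.+ 0) + 0#                     ≈⟨ +-congˡ (sumTo-zero J (λ j _ → trans (*-congˡ (later j)) (zeroʳ _))) ⟨
      sumTo (suc J) (λ j → g j * δ (suc k ℕ.+ j))    ≈⟨ eqn k ⟩
      0#                                             ∎
      where
      later : ∀ j → δ (suc k ℕ.+ suc j) ≈ 0#
      later j = go d (k ℕ.+ suc j) (ℕₚ.≤-trans p (ℕ.s≤s (ℕₚ.≤-trans (ℕₚ.≤-reflexive (ℕₚ.+-suc k d))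
        (ℕₚ.≤-trans (ℕₚ.+-monoˡ-≤ d (ℕₚ.m≤m+n (suc k) j)) (ℕₚ.≤-reflexive (≡.cong (ℕ._+ d) (≡.sym (ℕₚ.+-suc k j))))))))

  -- The sum of (k + j) fⱼ y^(k+j) over j is the Euler derivative of y^k f, that is y^k (k f + θ f).
  weightedSum : ∀ J k c (f B : Seq) s → s ℕ.< J →
    sumTo J (λ j → f j * (ν (k ℕ.+ j) * (c * (Y ^ˢ (k ℕ.+ j) ⋆ B) s))) ≈
    c * ((const (ν k) ⋆ f S.+ θ f) ⋆ (Y ^ˢ k ⋆ B)) s
  weightedSum J k c f B s s<J = begin
    sumTo J (λ j → f j * (ν (k ℕ.+ j) * (c * (Y ^ˢ (k ℕ.+ j) ⋆ B) s)))
      ≈⟨ sumTo-cong J (λ j _ → term j) ⟩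
    sumTo J (λ j → c * ((const (ν k) ⋆ f S.+ θ f) j * (Y ^ˢ j ⋆ (Y ^ˢ k ⋆ B)) s))
      ≈⟨ sumTo-*ˡ c J _ ⟨
    c * sumTo J (λ j → (const (ν k) ⋆ f S.+ θ f) j * (Y ^ˢ j ⋆ (Y ^ˢ k ⋆ B)) s)
      ≈⟨ *-congˡ (⋆-expand J (const (ν k) ⋆ f S.+ θ f) (Y ^ˢ k ⋆ B) s s<J) ⟩
    c * ((const (ν k) ⋆ f S.+ θ f) ⋆ (Y ^ˢ k ⋆ B)) s ∎
    where
    open Algebra.Properties.Semiring.Exp S.semiring using (^-homo-*)
    term : ∀ j → f j * (ν (k ℕ.+ j) * (c * (Y ^ˢ (k ℕ.+ j) ⋆ B) s)) ≈
                 c * ((const (ν k) ⋆ f S.+ θ f) j * (Y ^ˢ j ⋆ (Y ^ˢ k ⋆ B)) s)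
    term j = begin
      f j * (ν (k ℕ.+ j) * (c * (Y ^ˢ (k ℕ.+ j) ⋆ B) s))
        ≈⟨ *-congˡ (*-cong (ν-+ k j) (*-congˡ (S.trans (S.*-congʳ {B} (^-homo-* Y k j))
             (J.solve 3 (λ x y z → (x J.:* y) J.:* z J.:= y J.:* (x J.:* z)) S.refl (Y ^ˢ k) (Y ^ˢ j) B) s))) ⟩
      f j * ((ν k + ν j) * (c * (Y ^ˢ j ⋆ (Y ^ˢ k ⋆ B)) s))
        ≈⟨ I.solve 5 (λ f k j c z → f I.:* ((k I.:+ j) I.:* (c I.:* z)) I.:= c I.:* ((k I.:* f I.:+ j I.:* f) I.:* z)) refl _ _ _ _ _ ⟩
      c * ((ν k * f j + ν j * f j) * (Y ^ˢ j ⋆ (Y ^ˢ k ⋆ B)) s)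
        ≈⟨ *-congˡ (*-congʳ (+-congʳ (⋆-constˡ (ν k) f j))) ⟨
      c * ((const (ν k) ⋆ f S.+ θ f) j * (Y ^ˢ j ⋆ (Y ^ˢ k ⋆ B)) s) ∎

  module _ (g₀ : g 0 ≈ 1#) (w⋆g : (w ⋆ g) S.≈ S.1#) where

    -- Differentiate w g = 1 and multiply by w.
    θw : θ w S.≈ S.- ((w ⋆ w) ⋆ θ g)
    θw = S.trans (S.trans (S.trans (S.sym (S.*-identityʳ (θ w))) (S.*-congˡ {θ w} (S.sym w⋆g)))
         (J.solve 4 (λ t w g h → t J.:* (w J.:* g) J.:= w J.:* (t J.:* g J.:+ w J.:* h) J.:+ (J.:- ((w J.:* w) J.:* h))) S.refl (θ w) w g (θ g)))
         (S.trans (S.+-congʳ {S.- ((w ⋆ w) ⋆ θ g)} (S.trans (S.*-congˡ {w} (S.trans (S.sym (θ-⋆ w g)) (S.trans (θ-cong w⋆g) (θ-const 1#)))) (S.zeroʳ w)))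
           (S.+-identityˡ (S.- ((w ⋆ w) ⋆ θ g))))

    -- The identity behind the induction step, read off from the coefficient of u^s in θ (P Y^k w^s).
    stepIdentity : ∀ P k s′ → let s = suc s′ in
      ((const (ν k) ⋆ (const (ν (suc s)) ⋆ P) S.+ θ P) ⋆ (Y ^ˢ k ⋆ w ^ˢ s)) s
      ≈ ν s * (Y ^ˢ k ⋆ ((const (ν (suc k)) ⋆ g S.+ θ g) ⋆ (P ⋆ w ^ˢ suc s))) s
    stepIdentity P k s′ = begin
      ((const (ν k) ⋆ (const (ν (suc s)) ⋆ P) S.+ θ P) ⋆ (Y ^ˢ k ⋆ w ^ˢ s)) s
        ≈⟨ J.solve 5 (λ a c p t v → (a J.:* (c J.:* p) J.:+ t) J.:* v J.:= a J.:* (c J.:* (p J.:* v)) J.:+ t J.:* v) S.refl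
             (const (ν k)) (const (ν (suc s))) P (θ P) (Y ^ˢ k ⋆ w ^ˢ s) s ⟩
      (const (ν k) ⋆ (const (ν (suc s)) ⋆ V)) s + (θ P ⋆ (Y ^ˢ k ⋆ w ^ˢ s)) s
        ≈⟨ +-cong (trans (⋆-constˡ (ν k) _ s) (*-congˡ (⋆-constˡ (ν (suc s)) V s))) θP ⟩
      ν k * ((1# + ν s) * V s) + (ν s * V s + (- (ν k * V s)) + ν s * U s)
        ≈⟨ I.solve 4 (λ k n v u → k I.:* ((I.:1 I.:+ n) I.:* v) I.:+ (n I.:* v I.:+ (I.:- (k I.:* v)) I.:+ n I.:* u) I.:=
             n I.:* ((I.:1 I.:+ k) I.:* v I.:+ u)) refl (ν k) (ν s) (V s) (U s) ⟩
      ν s * ((1# + ν k) * V s + U s)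
        ≈⟨ *-congˡ (+-congʳ (⋆-constˡ (ν (suc k)) V s)) ⟨
      ν s * ((const (ν (suc k)) ⋆ V) s + U s)
        ≈⟨ *-congˡ (+-congʳ (S.*-congˡ {const (ν (suc k))} V≈ s)) ⟩
      ν s * ((const (ν (suc k)) ⋆ (P ⋆ (Y ^ˢ k ⋆ (w ^ˢ suc s ⋆ g)))) s + U s)
        ≈⟨ *-congˡ (J.solve 6 (λ c p y w g h → c J.:* (p J.:* (y J.:* (w J.:* g))) J.:+ (p J.:* (y J.:* (w J.:* h))) J.:= y J.:* ((c J.:* g J.:+ h) J.:* (p J.:* w)))
             S.refl (const (ν (suc k))) P (Y ^ˢ k) (w ^ˢ suc s) g (θ g) s) ⟩
      ν s * (Y ^ˢ k ⋆ ((const (ν (suc k)) ⋆ g S.+ θ g) ⋆ (P ⋆ w ^ˢ suc s))) s ∎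
      where
      s = suc s′
      V U : Seq
      V = P ⋆ (Y ^ˢ k ⋆ w ^ˢ s)
      U = P ⋆ (Y ^ˢ k ⋆ (w ^ˢ suc s ⋆ θ g))
      V≈ : V S.≈ P ⋆ (Y ^ˢ k ⋆ (w ^ˢ suc s ⋆ g))
      V≈ = S.*-congˡ {P} (S.*-congˡ {Y ^ˢ k} (S.trans (S.sym (S.*-identityʳ (w ^ˢ s))) (S.trans (S.*-congˡ {w ^ˢ s} (S.sym w⋆g))
        (J.solve 3 (λ x w g → x J.:* (w J.:* g) J.:= (w J.:* x) J.:* g) S.refl (w ^ˢ s) w g))))
      θw^ : θ (w ^ˢ s) S.≈ const (ν s) ⋆ (S.- (w ^ˢ suc s ⋆ θ g))
      θw^ = S.trans (θ-^ w s′) (S.*-congˡ {const (ν s)} (S.trans (S.*-congˡ {w ^ˢ s′} θw)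
        (J.solve 3 (λ x w h → x J.:* (J.:- ((w J.:* w) J.:* h)) J.:= J.:- ((w J.:* (w J.:* x)) J.:* h)) S.refl (w ^ˢ s′) w (θ g))))
      θV : θ V S.≈ θ P ⋆ (Y ^ˢ k ⋆ w ^ˢ s) S.+ P ⋆ ((const (ν k) ⋆ Y ^ˢ k) ⋆ w ^ˢ s S.+ Y ^ˢ k ⋆ (const (ν s) ⋆ (S.- (w ^ˢ suc s ⋆ θ g))))
      θV = S.trans (θ-⋆ P (Y ^ˢ k ⋆ w ^ˢ s)) (S.+-congˡ {θ P ⋆ (Y ^ˢ k ⋆ w ^ˢ s)} (S.*-congˡ {P} (S.trans (θ-⋆ (Y ^ˢ k) (w ^ˢ s))
        (S.+-cong (S.*-congʳ {w ^ˢ s} (θ-Y^ k)) (S.*-congˡ {Y ^ˢ k} θw^)))))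
      θP : (θ P ⋆ (Y ^ˢ k ⋆ w ^ˢ s)) s ≈ ν s * V s + (- (ν k * V s)) + ν s * U s
      θP = begin
        (θ P ⋆ (Y ^ˢ k ⋆ w ^ˢ s)) s
          ≈⟨ J.solve 7 (λ t y w p a c h → t J.:* (y J.:* w) J.:=
               (t J.:* (y J.:* w) J.:+ p J.:* ((a J.:* y) J.:* w J.:+ y J.:* (c J.:* (J.:- h)))) J.:+ (J.:- (a J.:* (p J.:* (y J.:* w)))) J.:+ c J.:* (p J.:* (y J.:* h)))
               S.refl (θ P) (Y ^ˢ k) (w ^ˢ s) P (const (ν k)) (const (ν s)) (w ^ˢ suc s ⋆ θ g) s ⟩
        (θ P ⋆ (Y ^ˢ k ⋆ w ^ˢ s) S.+ P ⋆ ((const (ν k) ⋆ Y ^ˢ k) ⋆ w ^ˢ s S.+ Y ^ˢ k ⋆ (const (ν s) ⋆ (S.- (w ^ˢ suc s ⋆ θ g))))) s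
          + (- (const (ν k) ⋆ V) s) + (const (ν s) ⋆ U) s
          ≈⟨ +-cong (+-cong (sym (θV s)) (-‿cong (⋆-constˡ (ν k) V s))) (⋆-constˡ (ν s) U s) ⟩
        ν s * V s + (- (ν k * V s)) + ν s * U s ∎

    module _ (R∅ : ∀ (T : Vec Bool n) → size T ≡ 0 → coef T R ≈ 0#) (J : ℕ) (n<J : n ℕ.< J)
      (eqn : ∀ k (T : Vec Bool n) → sumTo J (λ j → g j * coef T (R ^ᴱ (suc k ℕ.+ j))) ≈
             ΣL (elements T) (λ (i , T′) → sumTo J (λ j → Q i j * coef T′ (R ^ᴱ (k ℕ.+ j))))) where

      -- The classical (k/s) [u^(s-k)] of an s-th power, with s = s′ + 1 the size of T: extracting a
      -- squarefree monomial contributes s!, which leaves (s - 1)!. The factor `Y ^ˢ k` shifts the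
      -- degree, so that k > s needs no case of its own.
      formula : ℕ → ℕ → Vec Bool n → Carrier
      formula s′ k T = ν k * (ν (s′ !) * (Y ^ˢ k ⋆ (∏ Q T ⋆ w ^ˢ suc s′)) (suc s′))

      Y^-⋆-< : ∀ k f d → d ℕ.< k → (Y ^ˢ k ⋆ f) d ≈ 0#
      Y^-⋆-< (suc k) f zero    _ = trans (*-congʳ (zeroˡ _)) (zeroˡ _)
      Y^-⋆-< (suc k) f (suc d) (ℕ.s≤s d<k) = trans (⋆-assoc Y (Y ^ˢ k) f (suc d)) (trans (Y⋆-suc _ d) (Y^-⋆-< k f d d<k))

      -- This sum and the one in `Q-side` are brought to one common expression. The spare factor Y
      -- lowers the degree from s′ + 1 to s′.
      g-side : ∀ s′ k (T : Vec Bool n) → size T ≡ suc s′ →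
        sumTo J (λ j → g j * formula s′ (suc k ℕ.+ j) T) ≈
        ν (s′ !) * (Y ^ˢ k ⋆ ((const (ν (suc k)) ⋆ g S.+ θ g) ⋆ (∏ Q T ⋆ w ^ˢ suc s′))) s′
      g-side s′ k T e = begin
        sumTo J (λ j → g j * formula s′ (suc k ℕ.+ j) T)
          ≈⟨ weightedSum J (suc k) (ν (s′ !)) g B (suc s′) (ℕₚ.≤-<-trans (≡.subst (ℕ._≤ n) e (size≤ T)) n<J) ⟩
        ν (s′ !) * (f ⋆ (Y ^ˢ suc k ⋆ B)) (suc s′)
          ≈⟨ *-congˡ (J.solve 4 (λ f y x b → f J.:* ((y J.:* x) J.:* b) J.:= y J.:* (x J.:* (f J.:* b))) S.refl f Y (Y ^ˢ k) B (suc s′)) ⟩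
        ν (s′ !) * (Y ⋆ (Y ^ˢ k ⋆ (f ⋆ B))) (suc s′)
          ≈⟨ *-congˡ (Y⋆-suc _ s′) ⟩
        ν (s′ !) * (Y ^ˢ k ⋆ (f ⋆ B)) s′ ∎
        where
        B f : Seq
        B = ∏ Q T ⋆ w ^ˢ suc s′
        f = const (ν (suc k)) ⋆ g S.+ θ g

      coef-^∅ : ∀ k (T : Vec Bool n) → size T ≡ 0 → coef T (R ^ᴱ k) ≈ (Y ^ˢ k) 0
      coef-^∅ zero    T e = coef-1∅ T e
      coef-^∅ (suc k) T e = trans (nilpotent R R∅ (suc k) T (≡.subst (ℕ._< suc k) (≡.sym e) (ℕ.s≤s ℕ.z≤n))) (sym (zeroˡ _))

      mutual
        -- Induction on the size of T, for all powers at once. For fixed T, `eqn` is a triangular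
        -- system in the powers of R with leading coefficient 1, and its right side involves smaller
        -- sets only. As `formula` solves the same system, `downward` makes the difference vanish.
        lagrange : ∀ s′ (T : Vec Bool n) → size T ≡ suc s′ → ∀ k → coef T (R ^ᴱ k) ≈ formula s′ k T
        lagrange s′ T e zero = trans (coef-1 T (≡.subst (0 ℕ.<_) (≡.sym e) (ℕ.s≤s ℕ.z≤n))) (sym (zeroˡ _))
        lagrange s′ T e (suc k) = begin
          coef T (R ^ᴱ suc k)               ≈⟨ I.solve 2 (λ x y → x I.:= (x I.:- y) I.:+ y) refl _ (formula s′ (suc k) T) ⟩
          δ (suc k) + formula s′ (suc k) T  ≈⟨ +-congʳ (downward δ J (suc s′) (ℕₚ.≤-<-trans ℕ.z≤n n<J) g₀ vanish large k) ⟩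
          0# + formula s′ (suc k) T         ≈⟨ +-identityˡ _ ⟩
          formula s′ (suc k) T              ∎
          where
          δ : ℕ → Carrier
          δ k = coef T (R ^ᴱ k) - formula s′ k T
          large : ∀ k → suc s′ ℕ.< k → δ k ≈ 0#
          large k s<k = begin
            coef T (R ^ᴱ k) - formula s′ k T
              ≈⟨ +-cong (nilpotent R R∅ k T (≡.subst (ℕ._< k) (≡.sym e) s<k))
                        (-‿cong (trans (*-congˡ (trans (*-congˡ (Y^-⋆-< k _ (suc s′) s<k)) (zeroʳ _))) (zeroʳ _))) ⟩
            0# - 0#  ≈⟨ -‿inverseʳ 0# ⟩
            0#       ∎
          vanish : ∀ k → sumTo J (λ j → g j * δ (suc k ℕ.+ j)) ≈ 0#
          vanish k = begin
            sumTo J (λ j → g j * δ (suc k ℕ.+ j))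
              ≈⟨ sumTo-cong J (λ j _ → I.solve 3 (λ g x y → g I.:* (x I.:- y) I.:= g I.:* x I.:+ (I.:- I.:1) I.:* (g I.:* y)) refl (g j) _ _) ⟩
            sumTo J (λ j → g j * coef T (R ^ᴱ (suc k ℕ.+ j)) + (- 1#) * (g j * formula s′ (suc k ℕ.+ j) T))
              ≈⟨ sumTo-+ J _ _ ⟩
            sumTo J (λ j → g j * coef T (R ^ᴱ (suc k ℕ.+ j))) + sumTo J (λ j → (- 1#) * (g j * formula s′ (suc k ℕ.+ j) T))
              ≈⟨ +-cong (trans (eqn k T) (Q-side s′ k T e)) (sym (sumTo-*ˡ (- 1#) J _)) ⟩
            X + (- 1#) * sumTo J (λ j → g j * formula s′ (suc k ℕ.+ j) T)
              ≈⟨ +-congˡ (*-congˡ (g-side s′ k T e)) ⟩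
            X + (- 1#) * X
              ≈⟨ I.solve 1 (λ x → x I.:+ (I.:- I.:1) I.:* x I.:= I.:0) refl X ⟩
            0# ∎
            where
            X = ν (s′ !) * (Y ^ˢ k ⋆ ((const (ν (suc k)) ⋆ g S.+ θ g) ⋆ (∏ Q T ⋆ w ^ˢ suc s′))) s′

        Q-side : ∀ s′ k (T : Vec Bool n) → size T ≡ suc s′ →
          ΣL (elements T) (λ (i , T′) → sumTo J (λ j → Q i j * coef T′ (R ^ᴱ (k ℕ.+ j)))) ≈
          ν (s′ !) * (Y ^ˢ k ⋆ ((const (ν (suc k)) ⋆ g S.+ θ g) ⋆ (∏ Q T ⋆ w ^ˢ suc s′))) s′
        -- T has a single element, so each T′ is empty and outside the scope of `formula`. There R^k
        -- has coefficient 1 for k = 0 and 0 otherwise, which is `(Y ^ˢ k) 0`.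
        Q-side zero k T e = begin
          ΣL (elements T) (λ (i , T′) → sumTo J (λ j → Q i j * coef T′ (R ^ᴱ (k ℕ.+ j))))
            ≈⟨ ΣL-cong (All.zipWith (λ {iT} → term {iT}) (elements-size T , ∏-elements Q T)) ⟩
          ΣL (elements T) (λ _ → (∏ Q T ⋆ Y ^ˢ k) 0)
            ≈⟨ ΣL-elements-const T _ ⟩
          ν (size T) * (∏ Q T ⋆ Y ^ˢ k) 0
            ≈⟨ *-congʳ (trans (ν-cong e) ν-1) ⟩
          1# * (P₀ * (Y ^ˢ k) 0)
            ≈⟨ *-congˡ (*-congˡ (Yν k)) ⟩
          1# * (P₀ * ((Y ^ˢ k) 0 * ν (suc k)))
            ≈⟨ *-cong (sym ν-1) (I.solve 3 (λ p y n → p I.:* (y I.:* n) I.:= y I.:* ((n I.:* I.:1 I.:+ I.:0) I.:* (p I.:* (I.:1 I.:* I.:1)))) refl P₀ _ _) ⟩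
          ν 1 * ((Y ^ˢ k) 0 * ((ν (suc k) * 1# + 0#) * (P₀ * (1# * 1#))))
            ≈⟨ *-congˡ (*-congˡ (*-cong (+-cong (*-congˡ (sym g₀)) (sym (zeroˡ _))) (*-congˡ (*-congʳ (sym w₀))))) ⟩
          ν 1 * ((Y ^ˢ k) 0 * ((ν (suc k) * g 0 + 0# * g 0) * (P₀ * (w 0 * 1#)))) ∎
          where
          P₀ = ∏ Q T 0
          w₀ : w 0 ≈ 1#
          w₀ = trans (sym (*-identityʳ _)) (trans (*-congˡ (sym g₀)) (w⋆g 0))
          -- Only k = 0 contributes, where the factor k + 1 is 1. It is inserted to match the
          -- constant term of the common expression.
          Yν : ∀ k → (Y ^ˢ k) 0 ≈ (Y ^ˢ k) 0 * ν (suc k)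
          Yν zero    = sym (trans (*-identityˡ _) ν-1)
          Yν (suc k) = trans (zeroˡ _) (sym (trans (*-congʳ (zeroˡ _)) (zeroˡ _)))
          term : ∀ {iT : Fin n × Vec Bool n} → size T ≡ suc (size (proj₂ iT)) × (Q (proj₁ iT) ⋆ ∏ Q (proj₂ iT) S.≈ ∏ Q T) →
            sumTo J (λ j → Q (proj₁ iT) j * coef (proj₂ iT) (R ^ᴱ (k ℕ.+ j))) ≈ (∏ Q T ⋆ Y ^ˢ k) 0
          term {i , T′} (e′ , p) = begin
            sumTo J (λ j → Q i j * coef T′ (R ^ᴱ (k ℕ.+ j)))
              ≈⟨ sumTo-cong J (λ j _ → *-congˡ (trans (coef-^∅ (k ℕ.+ j) T′ ∅) (trans (^-homo-* Y k j 0) (*-comm _ _)))) ⟩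
            sumTo J (λ j → Q i j * (Y ^ˢ j ⋆ Y ^ˢ k) 0)
              ≈⟨ ⋆-expand J (Q i) (Y ^ˢ k) 0 (ℕₚ.≤-<-trans ℕ.z≤n n<J) ⟩
            (Q i ⋆ Y ^ˢ k) 0
              ≈⟨ S.*-congʳ {Y ^ˢ k} (S.trans (S.sym (S.*-identityʳ (Q i))) (S.trans (S.*-congˡ {Q i} (S.sym (∏-∅ Q T′ ∅))) p)) 0 ⟩
            (∏ Q T ⋆ Y ^ˢ k) 0 ∎
            where
            open Algebra.Properties.Semiring.Exp S.semiring using (^-homo-*)
            ∅ : size T′ ≡ 0
            ∅ = ℕₚ.suc-injective (≡.trans (≡.sym e′) e)
        Q-side (suc s″) k T e = begin
          ΣL (elements T) (λ (i , T′) → sumTo J (λ j → Q i j * coef T′ (R ^ᴱ (k ℕ.+ j))))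
            ≈⟨ ΣL-cong (All.map (λ {iT} → term {iT}) (elements-size T)) ⟩
          ΣL (elements T) (λ (i , T′) → ν (s″ !) * (D i ⋆ (Y ^ˢ k ⋆ (∏ Q T′ ⋆ w ^ˢ s))) s)
            ≈⟨ ΣL-*ˡ (ν (s″ !)) (elements T) _ ⟨
          ν (s″ !) * ΣL (elements T) (λ (i , T′) → (D i ⋆ (Y ^ˢ k ⋆ (∏ Q T′ ⋆ w ^ˢ s))) s)
            ≈⟨ *-congˡ (ΣL-coefficient (elements T) (λ (i , T′) → D i ⋆ (Y ^ˢ k ⋆ (∏ Q T′ ⋆ w ^ˢ s))) s) ⟨
          ν (s″ !) * SL.ΣL (elements T) (λ (i , T′) → D i ⋆ (Y ^ˢ k ⋆ (∏ Q T′ ⋆ w ^ˢ s))) s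
            ≈⟨ *-congˡ (sumF s) ⟩
          ν (s″ !) * ((const (ν k) ⋆ (const (ν (suc s)) ⋆ ∏ Q T) S.+ θ (∏ Q T)) ⋆ (Y ^ˢ k ⋆ w ^ˢ s)) s
            ≈⟨ *-congˡ (stepIdentity (∏ Q T) k s″) ⟩
          ν (s″ !) * (ν s * Z)
            ≈⟨ I.solve 3 (λ x y z → x I.:* (y I.:* z) I.:= (y I.:* x) I.:* z) refl _ _ _ ⟩
          (ν s * ν (s″ !)) * Z
            ≈⟨ *-congʳ (ν-* s (s″ !)) ⟨
          ν (s !) * Z ∎
          where
          s = suc s″
          Z = (Y ^ˢ k ⋆ ((const (ν (suc k)) ⋆ g S.+ θ g) ⋆ (∏ Q T ⋆ w ^ˢ suc s))) s
          D : Fin n → Seq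
          D i = const (ν k) ⋆ Q i S.+ θ (Q i)
          term : ∀ {iT : Fin n × Vec Bool n} → size T ≡ suc (size (proj₂ iT)) →
            sumTo J (λ j → Q (proj₁ iT) j * coef (proj₂ iT) (R ^ᴱ (k ℕ.+ j))) ≈
            ν (s″ !) * (D (proj₁ iT) ⋆ (Y ^ˢ k ⋆ (∏ Q (proj₂ iT) ⋆ w ^ˢ s))) s
          term {i , T′} e′ = trans
            (sumTo-cong J (λ j _ → *-congˡ (lagrange s″ T′ e″ (k ℕ.+ j))))
            (weightedSum J k (ν (s″ !)) (Q i) (∏ Q T′ ⋆ w ^ˢ s) s (ℕₚ.≤-<-trans (≡.subst (ℕ._≤ n) e″ (size≤ T′)) n<J))
            where
            e″ : size T′ ≡ s
            e″ = ℕₚ.suc-injective (≡.trans (≡.sym e′) e)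
          W : Seq
          W = Y ^ˢ k ⋆ w ^ˢ s
          -- The product of Qᵢ with the factors of T′ is the same for all i in T, whence the factor
          -- |T| = s + 1; the derivatives add up by Leibniz's rule.
          sumF : SL.ΣL (elements T) (λ (i , T′) → D i ⋆ (Y ^ˢ k ⋆ (∏ Q T′ ⋆ w ^ˢ s))) S.≈
                 (const (ν k) ⋆ (const (ν (suc s)) ⋆ ∏ Q T) S.+ θ (∏ Q T)) ⋆ W
          sumF = S.trans (SL.ΣL-cong′ (elements T) (λ (i , T′) →
              J.solve 6 (λ c q t y p w → (c J.:* q J.:+ t) J.:* (y J.:* (p J.:* w)) J.:= (c J.:* (q J.:* p) J.:+ t J.:* p) J.:* (y J.:* w))
                S.refl (const (ν k)) (Q i) (θ (Q i)) (Y ^ˢ k) (∏ Q T′) (w ^ˢ s)))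
            (S.trans (S.sym (SL.ΣL-*ʳ W (elements T) _))
            (S.*-congʳ {W} (S.trans (SL.ΣL-+ (elements T) _ _)
              (S.+-cong
                (S.trans (S.sym (SL.ΣL-*ˡ (const (ν k)) (elements T) _)) (S.*-congˡ {const (ν k)}
                  (S.trans (SL.ΣL-cong (∏-elements Q T)) (S.trans (SL.ΣL-elements-const T (∏ Q T))
                    (S.trans (S.sym (const-ν (size T) (∏ Q T))) (S.*-congʳ {∏ Q T} (const-cong (ν-cong e))))))))
                (∏-θ Q T)))))

open ≡ using (refl)

open Equivalence using (to; from)

⇔-trans : ∀ {P Q R : Set} → P ⇔ Q → Q ⇔ R → P ⇔ R
⇔-trans p q = mk⇔ (to q ∘ to p) (from p ∘ from q)

-- Counting labelled objects

_⊕_ : Vec ℕ n → Vec ℕ n → Vec ℕ n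
_⊕_ = zipWith ℕ._+_

zeros : Vec ℕ n
zeros = Vec.replicate _ 0

unit : Fin n → Vec ℕ n
unit zero    = 1 ∷ zeros
unit (suc i) = 0 ∷ unit i

⊕-identityˡ : (v : Vec ℕ n) → zeros ⊕ v ≡ v
⊕-identityˡ = Vecₚ.zipWith-identityˡ ℕₚ.+-identityˡ

⊕-assoc : (u v w : Vec ℕ n) → (u ⊕ v) ⊕ w ≡ u ⊕ (v ⊕ w)
⊕-assoc = Vecₚ.zipWith-assoc ℕₚ.+-assoc

bit : Bool → ℕ
bit true  = 1
bit false = 0

⟦_⟧ : Vec Bool n → Vec ℕ n
⟦_⟧ = Vec.map bit

⟦⟧-injective : {S T : Vec Bool n} → ⟦ S ⟧ ≡ ⟦ T ⟧ → S ≡ T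
⟦⟧-injective {S = []}        {[]}        _ = refl
⟦⟧-injective {S = true ∷ S}  {true ∷ T}  e = ≡.cong (true ∷_) (⟦⟧-injective (Vecₚ.∷-injectiveʳ e))
⟦⟧-injective {S = false ∷ S} {false ∷ T} e = ≡.cong (false ∷_) (⟦⟧-injective (Vecₚ.∷-injectiveʳ e))
⟦⟧-injective {S = true ∷ S}  {false ∷ T} e with () ← Vecₚ.∷-injectiveˡ e
⟦⟧-injective {S = false ∷ S} {true ∷ T}  e with () ← Vecₚ.∷-injectiveˡ e

splits-sound : (S : Vec Bool n) → All (λ (T , U) → ⟦ T ⟧ ⊕ ⟦ U ⟧ ≡ ⟦ S ⟧) (splits S)
splits-sound []          = refl ∷ []
splits-sound (false ∷ S) = Allₚ.map⁺ (All.map (≡.cong (0 ∷_)) (splits-sound S))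
splits-sound (true ∷ S)  = Allₚ.++⁺ (Allₚ.map⁺ (All.map (≡.cong (1 ∷_)) (splits-sound S)))
                                    (Allₚ.map⁺ (All.map (≡.cong (1 ∷_)) (splits-sound S)))

-- Natural numbers with sum 0 or 1 are themselves 0 or 1. So squarefree monomials of a product only
-- come from squarefree monomials of its factors, and the others can be ignored throughout.
splits-complete : ∀ (u v : Vec ℕ n) (S : Vec Bool n) → u ⊕ v ≡ ⟦ S ⟧ →
  ∃₂ λ T U → (T , U) ∈ splits S × u ≡ ⟦ T ⟧ × v ≡ ⟦ U ⟧
splits-complete [] [] [] e = [] , [] , here refl , refl , refl
splits-complete (x ∷ u) (y ∷ v) (b ∷ S) e
  with T , U , m , p , q ← splits-complete u v S (Vecₚ.∷-injectiveʳ e) with x | y | b | Vecₚ.∷-injectiveˡ e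
... | 0 | 0 | false | refl = false ∷ T , false ∷ U , ∈-map⁺ _ m , ≡.cong (0 ∷_) p , ≡.cong (0 ∷_) q
... | 0 | 1 | true  | refl = false ∷ T , true ∷ U , ∈-++⁺ˡ (∈-map⁺ _ m) , ≡.cong (0 ∷_) p , ≡.cong (1 ∷_) q
... | 1 | 0 | true  | refl = true ∷ T , false ∷ U , ∈-++⁺ʳ _ (∈-map⁺ _ m) , ≡.cong (1 ∷_) p , ≡.cong (0 ∷_) q

splits-unique : (S : Vec Bool n) → Unique (splits S)
splits-unique []          = [] ∷ []
splits-unique (false ∷ S) = Uniqueₚ.map⁺ (λ { refl → refl }) (splits-unique S)
splits-unique (true ∷ S)  = Uniqueₚ.++⁺ (Uniqueₚ.map⁺ (λ { refl → refl }) (splits-unique S))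
  (Uniqueₚ.map⁺ (λ { refl → refl }) (splits-unique S)) disjoint
  where
  disjoint : Disjoint (map (λ (T , U) → false ∷ T , true ∷ U) (splits S)) (map (λ (T , U) → true ∷ T , false ∷ U) (splits S))
  disjoint (p , q) with _ , _ , refl ← ∈-map⁻ _ p with _ , _ , () ← ∈-map⁻ _ q

elements-sound : (S : Vec Bool n) → All (λ (i , S′) → unit i ⊕ ⟦ S′ ⟧ ≡ ⟦ S ⟧) (elements S)
elements-sound []          = []
elements-sound (false ∷ S) = Allₚ.map⁺ (All.map (≡.cong (0 ∷_)) (elements-sound S))
elements-sound (true ∷ S)  = ≡.cong (1 ∷_) (⊕-identityˡ ⟦ S ⟧) ∷ Allₚ.map⁺ (All.map (≡.cong (1 ∷_)) (elements-sound S))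

elements-complete : ∀ i (v : Vec ℕ n) (S : Vec Bool n) → unit i ⊕ v ≡ ⟦ S ⟧ →
  ∃[ S′ ] (i , S′) ∈ elements S × v ≡ ⟦ S′ ⟧
elements-complete zero (x ∷ v) (b ∷ S) e with x | b | Vecₚ.∷-injectiveˡ e
... | 0 | true | refl = false ∷ S , here refl , ≡.cong (0 ∷_) (≡.trans (≡.sym (⊕-identityˡ v)) (Vecₚ.∷-injectiveʳ e))
elements-complete (suc i) (x ∷ v) (b ∷ S) e
  with S′ , m , p ← elements-complete i v S (Vecₚ.∷-injectiveʳ e) with x | b | Vecₚ.∷-injectiveˡ e
... | 0 | false | refl = false ∷ S′ , ∈-map⁺ _ m , ≡.cong (0 ∷_) p
... | 1 | true  | refl = true ∷ S′ , there (∈-map⁺ _ m) , ≡.cong (1 ∷_) p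

elements-unique : (S : Vec Bool n) → Unique (elements S)
elements-unique []          = []
elements-unique (false ∷ S) = Uniqueₚ.map⁺ (λ { refl → refl }) (elements-unique S)
elements-unique (true ∷ S)  = All.tabulate (λ m e → case (∈-map⁻ _ m) e) ∷ Uniqueₚ.map⁺ (λ { refl → refl }) (elements-unique S)
  where
  case : ∀ {x} → ∃ _ → _ ≡ x → ⊥
  case (_ , _ , refl) ()

module Cardinality (K : Ring₀) where
  module K = CommutativeRing K
  open Naturals K
  open ListSum K using (ΣL)

  -- The number N is compared with v through its image in K, where the generating functions have
  -- their coefficients.
  Card : (Ω → Set) → K.Carrier → Set
  Card P v = ∃[ N ] HasCardinality P N × ν N K.≈ v

  card-resp : {P Q : Ω → Set} {u v : K.Carrier} → (∀ x → P x ⇔ Q x) → u K.≈ v → Card P u → Card Q v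
  card-resp e p (N , (xs , u , m , l) , q) = N , (xs , u , (λ x → ⇔-trans (m x) (e x)) , l) , K.trans q p

  card-unique : {P : Ω → Set} {u v : K.Carrier} → Card P u → Card P v → u K.≈ v
  card-unique (M , (xs , u , m , refl) , p) (N , (ys , u′ , m′ , refl) , q) = K.trans (K.sym p) (K.trans (ν-cong
    (Permₚ.↭-length (∼bag⇒↭ (unique∧set⇒bag u u′ (λ {x} → mk⇔ (from (m′ x) ∘ to (m x)) (from (m x) ∘ to (m′ x)))))) ) q)

  card-∅ : {P : Ω → Set} → (∀ x → ¬ P x) → Card P K.0#
  card-∅ e = 0 , ([] , [] , (λ x → mk⇔ (λ ()) (λ p → ⊥-elim (e x p))) , refl) , K.refl

  card-singleton : {P : Ω → Set} (a : Ω) → (∀ x → P x ⇔ x ≡ a) → Card P K.1#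
  card-singleton a e = 1 , (a ∷ [] , [] ∷ [] , (λ x → mk⇔ (λ { (here p) → from (e x) p ; (there ()) }) (λ p → here (to (e x) p))) , refl) , ν-1

  card-map : {P : Ω → Set} {v : K.Carrier} (f : Ω → Ω′) → (∀ {x y} → f x ≡ f y → x ≡ y) →
             Card P v → Card (λ y → ∃[ x ] P x × y ≡ f x) v
  card-map f inj (N , (xs , u , m , refl) , p) = N , (map f xs , Uniqueₚ.map⁺ inj u ,
    (λ y → mk⇔ (λ q → let x , x∈ , e = ∈-map⁻ f q in x , to (m x) x∈ , e) (λ { (x , px , refl) → ∈-map⁺ f (from (m x) px) })) , Listₚ.length-map f xs) , p

  card-⊎ : {P Q : Ω → Set} {u v : K.Carrier} → (∀ x → P x → ¬ Q x) → Card P u → Card Q v → Card (λ x → P x ⊎ Q x) (u K.+ v)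
  card-⊎ d (M , (xs , u , m , refl) , p) (N , (ys , u′ , m′ , refl) , q) = _ , (xs ++ ys ,
    Uniqueₚ.++⁺ u u′ (λ {x} (a , b) → d x (to (m x) a) (to (m′ x) b)) ,
    (λ x → mk⇔ (λ z → Sum.map (to (m x)) (to (m′ x)) (∈-++⁻ xs z)) Sum.[ ∈-++⁺ˡ ∘ from (m x) , ∈-++⁺ʳ xs ∘ from (m′ x) ]) ,
    Listₚ.length-++ xs) , K.trans (ν-+ (length xs) (length ys)) (K.+-cong p q)

  card-× : {P : Ω → Set} {Q : Ω′ → Set} {u v : K.Carrier} → Card P u → Card Q v → Card (λ (x , y) → P x × Q y) (u K.* v)
  card-× (M , (xs , u , m , refl) , p) (N , (ys , u′ , m′ , refl) , q) = _ , (cartesianProduct xs ys ,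
    Uniqueₚ.cartesianProduct⁺ u u′ ,
    (λ (x , y) → mk⇔ (λ z → Product.map (to (m x)) (to (m′ y)) (∈-cartesianProduct⁻ xs ys z)) (λ (a , b) → ∈-cartesianProduct⁺ (from (m x) a) (from (m′ y) b))) ,
    length-cartesianProduct xs ys) , K.trans (ν-* (length xs) (length ys)) (K.*-cong p q)
    where
    length-cartesianProduct : ∀ (xs : List Ω) (ys : List Ω′) → length (cartesianProduct xs ys) ≡ length xs ℕ.* length ys
    length-cartesianProduct []       ys = refl
    length-cartesianProduct (x ∷ xs) ys = ≡.trans (Listₚ.length-++ (map (x ,_) ys))
      (≡.cong₂ ℕ._+_ (Listₚ.length-map _ ys) (length-cartesianProduct xs ys))

  card-Σ : ∀ (is : List I) {P : I → Ω → Set} {F : I → K.Carrier} → Unique is → (∀ {i j x} → P i x → P j x → i ≡ j) →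
           All (λ i → Card (P i) (F i)) is → Card (λ x → ∃[ i ] i ∈ is × P i x) (ΣL is F)
  card-Σ []       u d []       = card-∅ λ { _ (_ , () , _) }
  card-Σ (i ∷ is) (i∉ ∷ u) d (c ∷ cs) = card-resp
    (λ x → mk⇔ Sum.[ (λ p → i , here refl , p) , (λ (j , j∈ , p) → j , there j∈ , p) ]
      (λ { (j , here refl , p) → inj₁ p ; (j , there j∈ , p) → inj₂ (j , j∈ , p) })) K.refl
    (card-⊎ (λ { x p (j , j∈ , q) → All.lookup i∉ j∈ (d p q) }) c (card-Σ is u d cs))

-- Objects weighted by the multiset of their labels: f is their generating function,
-- up to monomials that are not squarefree.
module Counting (K : Ring₀) (n : ℕ) where
  open Cardinality K
  open SubsetRing K
  open ListSum K using (ΣL)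
  open RangeSum (subsetRing K n) using (sumTo)
  private module En = CommutativeRing (subsetRing K n)

  Counts : (Ω → Vec ℕ n) → (Ω → Set) → Elt n → Set
  Counts w P f = ∀ S → Card (λ x → P x × w x ≡ ⟦ S ⟧) (coef S f)

  counts-resp : {w : Ω → Vec ℕ n} {P Q : Ω → Set} {f g : Elt n} →
    (∀ x → P x ⇔ Q x) → f En.≈ g → Counts w P f → Counts w Q g
  counts-resp e p c S = card-resp (λ x → mk⇔ (Product.map₁ (to (e x))) (Product.map₁ (from (e x)))) (coef-cong S p) (c S)

  -- The source of equations between generating functions: two ways of enumerating the same objects.
  counts-unique : {w : Ω → Vec ℕ n} {P : Ω → Set} {f g : Elt n} → Counts w P f → Counts w P g → f En.≈ g
  counts-unique c d = coef-ext n _ _ (λ S → card-unique (c S) (d S))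

  counts-∅ : {w : Ω → Vec ℕ n} {P : Ω → Set} → (∀ x → ¬ P x) → Counts w P En.0#
  counts-∅ e S = card-resp (λ _ → mk⇔ id id) (K.sym (coef-0 S)) (card-∅ (λ x (p , _) → e x p))

  counts-map : {w : Ω → Vec ℕ n} {w′ : Ω′ → Vec ℕ n} {P : Ω → Set} {f : Elt n} (h : Ω → Ω′) →
    (∀ {x y} → h x ≡ h y → x ≡ y) → (∀ x → w′ (h x) ≡ w x) →
    Counts w P f → Counts w′ (λ y → ∃[ x ] P x × y ≡ h x) f
  counts-map h inj wh c S = card-resp
    (λ y → mk⇔ (λ { (x , (p , e) , refl) → (x , p , refl) , ≡.trans (wh x) e }) (λ { ((x , p , refl) , e) → x , (p , ≡.trans (≡.sym (wh x)) e) , refl }))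
    K.refl (card-map h inj (c S))

  counts-⊎ : {w : Ω → Vec ℕ n} {P Q : Ω → Set} {f g : Elt n} → (∀ x → P x → ¬ Q x) →
    Counts w P f → Counts w Q g → Counts w (λ x → P x ⊎ Q x) (f En.+ g)
  counts-⊎ d c c′ S = card-resp
    (λ x → mk⇔ Sum.[ Product.map₁ inj₁ , Product.map₁ inj₂ ] (λ { (inj₁ p , e) → inj₁ (p , e) ; (inj₂ p , e) → inj₂ (p , e) }))
    (K.sym (coef-+ S _ _)) (card-⊎ (λ x (p , _) (q , _) → d x p q) (c S) (c′ S))

  counts-guard : {D : Set} {w : Ω → Vec ℕ n} {P : Ω → Set} {f : Elt n} (d : Dec D) →
    (D → Counts w P f) → Counts w (λ x → D × P x) (if does d then f else En.0#)
  counts-guard (yes p) c = counts-resp (λ x → mk⇔ (p ,_) proj₂) En.refl (c p)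
  counts-guard (no ¬p) c = counts-∅ (λ x (p , _) → ¬p p)

  counts-singleton : {w : Ω → Vec ℕ n} (a : Ω) → w a ≡ zeros → Counts w (_≡ a) En.1#
  counts-singleton {w = w} a wa S with size S in eq
  ... | zero  = card-resp (λ x → mk⇔ (λ { refl → refl , ≡.trans wa (≡.sym (∅ S eq)) }) proj₁)
                  (K.sym (coef-1∅ S eq)) (card-singleton a (λ x → mk⇔ id id))
    where
    ∅ : ∀ {m} (S : Vec Bool m) → size S ≡ 0 → ⟦ S ⟧ ≡ zeros
    ∅ []          e = refl
    ∅ (false ∷ S) e = ≡.cong (0 ∷_) (∅ S e)
  ... | suc s = card-resp (λ x → mk⇔ id id) (K.sym (coef-1 S (≡.subst (0 ℕ.<_) (≡.sym eq) (ℕ.s≤s ℕ.z≤n))))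
                  (card-∅ λ { x (refl , e) → nonzero S eq (≡.trans (≡.sym e) wa) })
    where
    nonzero : ∀ {m} (S : Vec Bool m) {s} → size S ≡ suc s → ¬ ⟦ S ⟧ ≡ zeros
    nonzero (false ∷ S) e z = nonzero S e (Vecₚ.∷-injectiveʳ z)
    nonzero (true ∷ S)  e z with () ← Vecₚ.∷-injectiveˡ z

  counts-× : {w : Ω → Vec ℕ n} {w′ : Ω′ → Vec ℕ n} {P : Ω → Set} {Q : Ω′ → Set} {f g : Elt n} →
    Counts w P f → Counts w′ Q g → Counts (λ (x , y) → w x ⊕ w′ y) (λ (x , y) → P x × Q y) (f En.* g)
  counts-× {w = w} {w′} {P} {Q} {f} {g} c c′ S = card-resp
    (λ (x , y) → mk⇔
      (λ { ((T , U) , m , (p , e) , (q , e′)) → (p , q) , ≡.trans (≡.cong₂ _⊕_ e e′) (All.lookup (splits-sound S) m) })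
      (λ { ((p , q) , e) → let T , U , m , u , v = splits-complete (w x) (w′ y) S e in (T , U) , m , (p , u) , (q , v) }))
    (K.sym (coef-* S f g))
    (card-Σ (splits S) {F = λ (T , U) → coef T f K.* coef U g} (splits-unique S)
      (λ { ((_ , a) , (_ , b)) ((_ , a′) , (_ , b′)) → ≡.cong₂ _,_ (⟦⟧-injective (≡.trans (≡.sym a) a′)) (⟦⟧-injective (≡.trans (≡.sym b) b′)) })
      (All.universal (λ (T , U) → card-× (c T) (c′ U)) (splits S)))

  counts-tsum : {w : Ω → Vec ℕ n} {P : Fin n → Ω → Set} {f : Fin n → Elt n} →
    (∀ i → Counts w (P i) (f i)) → Counts (λ (i , x) → unit i ⊕ w x) (λ (i , x) → P i x) (tsum f)
  counts-tsum {Ω = Ω} {w = w} {P} {f} c S = card-resp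
    (λ (i , x) → mk⇔
      (λ { ((i , S′) , m , (y , (p , e) , refl)) → p , ≡.trans (≡.cong (unit i ⊕_) e) (All.lookup (elements-sound S) m) })
      (λ { (p , e) → let S′ , m , u = elements-complete i (w x) S e in (i , S′) , m , (x , (p , u) , refl) }))
    (K.sym (coef-tsum S f))
    (card-Σ (elements S) {F = λ (i , S′) → coef S′ (f i)} (elements-unique S)
      (λ { (_ , (_ , a) , refl) (_ , (_ , a′) , refl) → ≡.cong (_ ,_) (⟦⟧-injective (≡.trans (≡.sym a) a′)) })
      (All.universal (λ (i , S′) → card-map {Ω′ = Fin n × Ω} (i ,_) (λ { refl → refl }) (c i S′)) (elements S)))

  counts-Σ : ∀ N {w : Ω → Vec ℕ n} {P : ℕ → Ω → Set} {f : ℕ → Elt n} → (∀ {i j x} → P i x → P j x → i ≡ j) →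
    (∀ i → i ℕ.< N → Counts w (P i) (f i)) → Counts w (λ x → ∃[ i ] i ℕ.< N × P i x) (sumTo N f)
  counts-Σ zero    d c = counts-∅ λ { x (_ , () , _) }
  counts-Σ (suc N) {P = P} d c = counts-resp
    (λ x → mk⇔ Sum.[ (λ p → 0 , ℕ.s≤s ℕ.z≤n , p) , (λ (i , i<N , p) → suc i , ℕ.s≤s i<N , p) ]
       λ { (zero , _ , p) → inj₁ p ; (suc i , ℕ.s≤s i<N , p) → inj₂ (i , i<N , p) })
    En.refl
    (counts-⊎ (λ { x p (i , _ , q) → case (d p q) }) (c 0 (ℕ.s≤s ℕ.z≤n))
      (counts-Σ N {P = λ i → P (suc i)} (λ p q → ℕₚ.suc-injective (d p q)) (λ i i<N → c (suc i) (ℕ.s≤s i<N))))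
    where
    case : ∀ {i} → 0 ≡ suc i → ⊥
    case ()

-- The grammar of decorated trees

private
  variable
    X : Set
    c j l t s : ℕ
    e : Bool
    u : Tree X
    cs : List (ℕ × Tree X)
    ds : List (Decoration X)

-- Sequences of children of a primal vertex, with s arrows in total on their half-edges.
data Forest {X : Set} (P : ℕ → Tree X → Set) : ℕ → List (ℕ × Tree X) → Set where
  []  : Forest P 0 []
  _∷_ : P (suc c) u → Forest P s cs → Forest P (suc c ℕ.+ s) ((suc c , u) ∷ cs)

twigDecoration : Decoration X
twigDecoration = edge (primal 0 [])

-- Sequences with j attaching points, l leaflets and t twigs, without a leaflet following
-- a twig; the Boolean tells whether the sequence may start with a leaflet.
data Word {X : Set} (P : Tree X → Set) : Bool → ℕ → ℕ → ℕ → List (Decoration X) → Set where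
  []      : Word P e 0 0 0 []
  leaflet : Word P true j l t ds → Word P true j (suc l) t (leaflet ∷ ds)
  twig    : Word P false j l t ds → Word P e j l (suc t) (twigDecoration ∷ ds)
  attach  : P u → Word P true j l t ds → Word P e (suc j) l t (edge u ∷ ds)

-- The only ambiguity in reading a word is a twig taken for an attached tree, which the hypothesis
-- on P excludes. It makes the classes of words with different j disjoint.
word-unique : ∀ {P : Tree X → Set} {e j j′ l l′ t t′ ds} → ¬ P (primal 0 []) →
              Word P e j l t ds → Word P e j′ l′ t′ ds → j ≡ j′
word-unique ¬tw []           []           = refl
word-unique ¬tw (leaflet w)  (leaflet w′) = word-unique ¬tw w w′
word-unique ¬tw (twig w)     (twig w′)    = word-unique ¬tw w w′
word-unique ¬tw (twig w)     (attach p _) = contradiction p ¬tw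
word-unique ¬tw (attach p _) (twig w′)    = contradiction p ¬tw
word-unique ¬tw (attach _ w) (attach _ w′) = ≡.cong suc (word-unique ¬tw w w′)

-- Distributions of l leaflets among the gaps that follow the j attaching points, plus the initial gap
-- if e holds.
leafletCount : Bool → ℕ → ℕ → ℕ
leafletCount true  j       l       = (l ℕ.+ j) C j
leafletCount false zero    zero    = 1
leafletCount false zero    (suc l) = 0
leafletCount false (suc j) l       = (l ℕ.+ j) C j

-- Inside a gap the order is forced, so only the numbers of leaflets and of twigs in each gap
-- matter, and they are chosen independently. Twigs may go into all j + 1 gaps, the initial one
-- included even if e is false.
wordCount : Bool → ℕ → ℕ → ℕ → ℕ
wordCount e j l t = leafletCount e j l ℕ.* ((t ℕ.+ j) C j)

-- Pascal's rule, matching the case distinction whether the word starts with a leaflet.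
wordCount-leaflet : ∀ j l t → wordCount true j (suc l) t ≡ wordCount true j l t ℕ.+ wordCount false j (suc l) t
wordCount-leaflet j l t = ≡.trans (≡.cong (ℕ._* ((t ℕ.+ j) C j)) (go j)) (ℕₚ.*-distribʳ-+ ((t ℕ.+ j) C j) (leafletCount true j l) (leafletCount false j (suc l)))
  where
  go : ∀ j → leafletCount true j (suc l) ≡ leafletCount true j l ℕ.+ leafletCount false j (suc l)
  go zero    = refl
  go (suc j) = ≡.trans (≡.sym (nCk+nC[k+1]≡[n+1]C[k+1] (l ℕ.+ suc j) j))
    (≡.trans (ℕₚ.+-comm _ (((l ℕ.+ suc j)) C suc j)) (≡.cong (λ k → ((l ℕ.+ suc j) C suc j) ℕ.+ (k C j)) (ℕₚ.+-suc l j)))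

wordCount-start : ∀ j t → wordCount true j 0 t ≡ wordCount false j 0 t
wordCount-start zero    t = refl
wordCount-start (suc j) t = ≡.cong (ℕ._* ((t ℕ.+ suc j) C suc j)) (≡.trans (nCn≡1 (suc j)) (≡.sym (nCn≡1 j)))

wordCount-attach : ∀ j l → wordCount true j l 0 ≡ wordCount false (suc j) l 0
wordCount-attach j l = ≡.cong (leafletCount true j l ℕ.*_) (≡.trans (nCn≡1 j) (≡.sym (nCn≡1 (suc j))))

wordCount-twig : ∀ j l t → wordCount false (suc j) l (suc t) ≡ wordCount false (suc j) l t ℕ.+ wordCount true j l (suc t)
wordCount-twig j l t = ≡.trans (≡.cong (((l ℕ.+ j) C j) ℕ.*_)
  (≡.trans (≡.sym (nCk+nC[k+1]≡[n+1]C[k+1] (t ℕ.+ suc j) j)) (≡.trans (ℕₚ.+-comm _ ((t ℕ.+ suc j) C suc j))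
    (≡.cong (λ k → ((t ℕ.+ suc j) C suc j) ℕ.+ (k C j)) (ℕₚ.+-suc t j)))))
  (ℕₚ.*-distribˡ-+ ((l ℕ.+ j) C j) ((t ℕ.+ suc j) C suc j) ((suc t ℕ.+ j) C j))

labelWeight : List (Fin n × List (Decoration (Fin n))) → Vec ℕ n
labelWeight []            = zeros
labelWeight ((i , _) ∷ l) = unit i ⊕ labelWeight l

labelWeight-++ : (k l : List (Fin n × List (Decoration (Fin n)))) → labelWeight (k ++ l) ≡ labelWeight k ⊕ labelWeight l
labelWeight-++ []            l = ≡.sym (⊕-identityˡ _)
labelWeight-++ ((i , _) ∷ k) l = ≡.trans (≡.cong (unit i ⊕_) (labelWeight-++ k l)) (≡.sym (⊕-assoc (unit i) _ _))

treeWeight : Tree (Fin n) → Vec ℕ n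
treeWeight = labelWeight ∘ blossoming

forestWeight : List (ℕ × Tree (Fin n)) → Vec ℕ n
forestWeight = labelWeight ∘ blossomingAtP

wordWeight : List (Decoration (Fin n)) → Vec ℕ n
wordWeight = labelWeight ∘ blossomingAtD

module Grammar {n : ℕ} (b : ℕ) (m : Fin n → ℕ) where
  -- What lies below a half-edge carrying c > 0 arrows, seen from its edge-vertex, for trees
  -- of height at most h; for c = 0, the trees coding for 0-slices.
  Below : ℕ → ℕ → Tree (Fin n) → Set
  Below zero    c u             = ⊥
  -- The edge rule a + c = b and the total b + 1 around the vertex leave c + 1 arrows for the
  -- children. At c = 0 the edge rule turns into the condition a = b on the root of a slice.
  Below (suc h) c (primal a cs) = c ℕ.< b × a ℕ.+ c ≡ b × Forest (Below h) (suc c) cs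
  -- A special vertex hangs below b - 1 arrows and is the 2-angle slice if b = 1; a labeled one
  -- hangs below b arrows. Of its degree 2 m, the half-edge to the root and m - b - 1 twigs leave m
  -- + b attaching points and leaflets.
  Below (suc h) c (dual i ds)   =
      (suc c ≡ b × m i ≡ b × ds ≡ replicate (2 ℕ.* b ∸ 1) leaflet)
    ⊎ (c ≡ b × b ℕ.< m i × ∃[ j ] j ℕ.< suc (m i ℕ.+ b) × Word (Below h 0) true j (m i ℕ.+ b ∸ j) (m i ∸ suc b) ds)

  ¬below-twig : ∀ h → ¬ Below h 0 (primal 0 [])
  ¬below-twig (suc h) (0<b , 0≡b , _) = ℕₚ.<⇒≢ 0<b 0≡b

-- Generating functions of the grammar.

module TreeCounting (K : Ring₀) (n : ℕ) where
  open Counting K n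
  open SubsetRing K using (Elt; tsum)
  open CommutativeRing (subsetRing K n) renaming (refl to ≈-refl; sym to ≈-sym; trans to ≈-trans) hiding (zero)
  open Naturals (subsetRing K n)
  open RangeSum (subsetRing K n)
  open PowerSeries (subsetRing K n) using (Seq; _⋆_; tail)
  open IntegerSolver (subsetRing K n)
  open Algebra.Properties.Semiring.Exp semiring using (_^_)

  forestGF : Seq → ℕ → Carrier
  -- The first child contributes p + 1 arrows at least, and p is not counted.
  firstGF  : Seq → ℕ → ℕ → Carrier

  forestGF f zero    = 1#
  forestGF f (suc s) = firstGF f 0 s

  firstGF f p zero    = f (suc p) * 1#
  firstGF f p (suc s) = f (suc p) * firstGF f 0 s + firstGF f (suc p) s

  -- At p = 0 this is H = 1 + z (tail f) H for H = `forestGF f`, the equation of sequences of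
  -- children.
  firstGF-⋆ : ∀ f p s → firstGF f p s ≈ ((λ i → f (suc (p ℕ.+ i))) ⋆ forestGF f) s
  firstGF-⋆ f p zero    = *-congʳ (reflexive (≡.cong (f ∘ suc) (≡.sym (ℕₚ.+-identityʳ p))))
  firstGF-⋆ f p (suc s) = +-cong (*-congʳ (reflexive (≡.cong (f ∘ suc) (≡.sym (ℕₚ.+-identityʳ p)))))
    (≈-trans (firstGF-⋆ f (suc p) s) (PowerSeries.⋆-cong (subsetRing K n) {g = forestGF f}
      (λ i → reflexive (≡.cong (f ∘ suc) (≡.sym (ℕₚ.+-suc p i)))) (λ _ → ≈-refl) s))

  module _ {P : ℕ → Tree (Fin n) → Set} {f : Seq} (counts : ∀ c → Counts treeWeight (P c) (f c)) where

    private
      pairWeight : (ℕ × Tree (Fin n)) × List (ℕ × Tree (Fin n)) → Vec ℕ n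
      pairWeight ((c , u) , cs) = treeWeight u ⊕ forestWeight cs

      First : ℕ → ℕ → (ℕ × Tree (Fin n)) × List (ℕ × Tree (Fin n)) → Set
      First p s ((c , u) , cs) = ∃₂ λ i k → i ℕ.+ k ≡ s × c ≡ suc (p ℕ.+ i) × P c u × Forest P k cs

      counts-child : ∀ c → Counts (treeWeight ∘ proj₂) (λ (c′ , u) → c′ ≡ c × P c′ u) (f c)
      counts-child c = counts-resp (λ _ → mk⇔ (λ { (u , p , refl) → refl , p }) (λ { (refl , p) → _ , p , refl })) ≈-refl
        (counts-map (c ,_) (λ { refl → refl }) (λ _ → refl) (counts c))

    counts-forest : ∀ s → Counts forestWeight (Forest P s) (forestGF f s)
    counts-first  : ∀ p s → Counts pairWeight (First p s) (firstGF f p s)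

    counts-forest zero = counts-resp (λ x → mk⇔ (λ { refl → [] }) (λ { [] → refl })) ≈-refl (counts-singleton [] refl)
    counts-forest (suc s) = counts-resp
      (λ x → mk⇔ (λ { (_ , (i , k , refl , refl , p , w) , refl) → p ∷ w }) (λ { (p ∷ w) → _ , (_ , _ , refl , refl , p , w) , refl }))
      ≈-refl (counts-map (λ (x , xs) → x ∷ xs) (λ { refl → refl }) (λ ((c , u) , cs) → labelWeight-++ (blossoming u) (blossomingAtP cs)) (counts-first 0 s))

    counts-first p zero = counts-resp
      (λ _ → mk⇔ (λ { ((e , q) , w) → 0 , 0 , refl , ≡.trans e (≡.cong suc (≡.sym (ℕₚ.+-identityʳ p))) , q , w })
                 (λ { (zero , zero , refl , e , q , w) → (≡.trans e (≡.cong suc (ℕₚ.+-identityʳ p)) , q) , w }))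
      ≈-refl (counts-× (counts-child (suc p)) (counts-forest 0))
    counts-first p (suc s) = counts-resp
      (λ _ → mk⇔
        (λ { (inj₁ ((e , q) , w)) → 0 , suc s , refl , ≡.trans e (≡.cong suc (≡.sym (ℕₚ.+-identityʳ p))) , q , w
           ; (inj₂ (i , k , e′ , e , q , w)) → suc i , k , ≡.cong suc e′ , ≡.trans e (≡.cong suc (≡.sym (ℕₚ.+-suc p i))) , q , w })
        (λ { (zero , k , refl , e , q , w) → inj₁ ((≡.trans e (≡.cong suc (ℕₚ.+-identityʳ p)) , q) , w)
           ; (suc i , k , e′ , e , q , w) → inj₂ (i , k , ℕₚ.suc-injective e′ , ≡.trans e (≡.cong suc (ℕₚ.+-suc p i)) , q , w) }))
      ≈-refl
      (counts-⊎ (λ { ((c , u) , cs) ((e , _) , _) (i , _ , _ , e′ , _) → ℕₚ.m≢1+m+n p (≡.trans (ℕₚ.suc-injective (≡.trans (≡.sym e) e′)) refl) })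
        (counts-× (counts-child (suc p)) (counts-forest (suc s))) (counts-first (suc p) s))

  module _ {P : Tree (Fin n) → Set} (¬twig : ¬ P (primal 0 [])) {R : Carrier} (counts : Counts treeWeight P R) where

    private
      gf-+ : ∀ {k} x y j → k ≡ x ℕ.+ y → ν x * R ^ j + ν y * R ^ j ≈ ν k * R ^ j
      gf-+ x y j refl = ≈-trans (≈-sym (distribʳ _ _ _)) (*-congʳ (≈-sym (ν-+ x y)))

      gf-R : ∀ {x y} j → x ≡ y → R * (ν x * R ^ j) ≈ ν y * R ^ suc j
      gf-R j refl = solve 3 (λ r x y → r :* (x :* y) := x :* (r :* y)) ≈-refl R _ (R ^ j)

      counts-twig : ∀ {e j l t g} → Counts wordWeight (Word P e j l t) g →
        Counts wordWeight (λ ds → ∃[ ds′ ] Word P e j l t ds′ × ds ≡ twigDecoration ∷ ds′) g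
      counts-twig = counts-map (twigDecoration ∷_) (λ { refl → refl }) (λ _ → refl)

      counts-attach : ∀ {e j l t g} → Counts wordWeight (Word P e j l t) g →
        Counts wordWeight (λ ds → ∃[ x ] (P (proj₁ x) × Word P e j l t (proj₂ x)) × ds ≡ edge (proj₁ x) ∷ proj₂ x) (R * g)
      counts-attach c = counts-map (λ (u , ds) → edge u ∷ ds) (λ { refl → refl })
        (λ (u , ds) → labelWeight-++ (blossoming u) (blossomingAtD ds)) (counts-× counts c)

    counts-word₀ : ∀ l t → Counts wordWeight (Word P false 0 l t) (ν (wordCount false 0 l t) * R ^ 0)
    counts-word₀ zero zero = counts-resp (λ _ → mk⇔ (λ { refl → [] }) (λ { [] → refl }))
      (solve 0 (:1 := (:1 :+ :0) :* :1) ≈-refl) (counts-singleton [] refl)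
    counts-word₀ (suc l) zero = counts-resp (λ _ → mk⇔ ⊥-elim (λ ())) (≈-sym (zeroˡ _)) (counts-∅ (λ _ z → z))
    counts-word₀ l (suc t) = counts-resp (λ _ → mk⇔ (λ { (_ , w , refl) → twig w }) (λ { (twig w) → _ , w , refl }))
      ≈-refl (counts-twig (counts-word₀ l t))

    counts-wordᵗ : ∀ j l t → Counts wordWeight (Word P true j l t) (ν (wordCount true j l t) * R ^ j)
    counts-wordᶠ : ∀ j l t → Counts wordWeight (Word P false j l t) (ν (wordCount false j l t) * R ^ j)
    -- With no leaflet left, permission to start with one changes nothing.
    counts-wordᵗ j zero t = counts-resp
      (λ _ → mk⇔ (λ { [] → [] ; (twig w) → twig w ; (attach p w) → attach p w }) (λ { [] → [] ; (twig w) → twig w ; (attach p w) → attach p w }))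
      (*-congʳ (ν-cong (≡.sym (wordCount-start j t)))) (counts-wordᶠ j zero t)
    counts-wordᵗ j (suc l) t = counts-resp
      (λ _ → mk⇔ (λ { (inj₁ (_ , w , refl)) → leaflet w ; (inj₂ (twig w)) → twig w ; (inj₂ (attach p w)) → attach p w })
                 (λ { (leaflet w) → inj₁ (_ , w , refl) ; (twig w) → inj₂ (twig w) ; (attach p w) → inj₂ (attach p w) }))
      (gf-+ (wordCount true j l t) (wordCount false j (suc l) t) j (wordCount-leaflet j l t))
      (counts-⊎ (λ { _ (_ , _ , refl) () })
        (counts-map {w = wordWeight} (leaflet ∷_) (λ { refl → refl }) (λ _ → refl) (counts-wordᵗ j l t)) (counts-wordᶠ j (suc l) t))
    counts-wordᶠ zero l t = counts-word₀ l t
    counts-wordᶠ (suc j) l zero = counts-resp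
      (λ _ → mk⇔ (λ { (_ , (p , w) , refl) → attach p w }) (λ { (attach p w) → _ , (p , w) , refl }))
      (gf-R j (wordCount-attach j l)) (counts-attach (counts-wordᵗ j l zero))
    counts-wordᶠ (suc j) l (suc t) = counts-resp
      (λ _ → mk⇔ (λ { (inj₁ (_ , w , refl)) → twig w ; (inj₂ (_ , (p , w) , refl)) → attach p w })
                 (λ { (twig w) → inj₁ (_ , w , refl) ; (attach p w) → inj₂ (_ , (p , w) , refl) }))
      (≈-trans (+-congˡ (gf-R {wordCount true j l (suc t)} j refl)) (gf-+ (wordCount false (suc j) l t) (wordCount true j l (suc t)) (suc j) (wordCount-twig j l t)))
      (counts-⊎ (λ { _ (_ , _ , refl) ((_ , _) , (p , _) , refl) → ¬twig p }) (counts-twig (counts-wordᶠ (suc j) l t)) (counts-attach (counts-wordᵗ j l (suc t))))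

  module _ (b : ℕ) (m : Fin n → ℕ) where

    open Grammar b m

    specialGF : Fin n → Carrier
    specialGF i = if does (m i ℕₚ.≟ b) then 1# else 0#

    labeledGF : Carrier → Fin n → Carrier
    labeledGF R i = if does (b ℕₚ.<? m i)
      then sumTo (suc (m i ℕ.+ b)) (λ j → ν (wordCount true j (m i ℕ.+ b ∸ j) (m i ∸ suc b)) * R ^ j) else 0#

    step : Seq → Seq
    step f c = (if does (c ℕₚ.<? b) then forestGF f (suc c) else 0#)
             + ((if does (suc c ℕₚ.≟ b) then tsum specialGF else 0#) + (if does (c ℕₚ.≟ b) then tsum (labeledGF (f 0)) else 0#))

    belowGF : ℕ → Seq
    belowGF zero    c = 0#
    belowGF (suc h) c = step (belowGF h) c

    counts-below : ∀ h c → Counts treeWeight (Below h c) (belowGF h c)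
    counts-below zero    c = counts-∅ (λ _ z → z)
    counts-below (suc h) c = counts-resp
      (λ { (primal a cs) → mk⇔
             (λ { (inj₁ (c<b , _ , w , refl)) → c<b , ℕₚ.m∸n+n≡m (ℕₚ.<⇒≤ c<b) , w
                ; (inj₂ (inj₁ (_ , _ , _ , ()))) ; (inj₂ (inj₂ (_ , _ , _ , ()))) })
             (λ { (c<b , e , w) → inj₁ (c<b , cs , w , ≡.cong (λ a → primal a cs) (≡.trans (≡.sym (ℕₚ.m+n∸n≡m a c)) (≡.cong (_∸ c) e))) })
         ; (dual i ds) → mk⇔
             (λ { (inj₁ (_ , _ , _ , ()))
                ; (inj₂ (inj₁ (e , _ , (e′ , e″) , refl))) → inj₁ (e , e′ , e″)
                ; (inj₂ (inj₂ (e , _ , (p , w) , refl))) → inj₂ (e , p , w) })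
             (λ { (inj₁ (e , e′ , e″)) → inj₂ (inj₁ (e , (i , ds) , (e′ , e″) , refl))
                ; (inj₂ (e , p , w)) → inj₂ (inj₂ (e , (i , ds) , (p , w) , refl)) }) })
      ≈-refl
      (counts-⊎ (λ { u (_ , _ , _ , refl) (inj₁ (_ , _ , _ , ())) ; u (_ , _ , _ , refl) (inj₂ (_ , _ , _ , ())) })
        (counts-guard (c ℕₚ.<? b) (λ _ → counts-map {w = forestWeight} (primal (b ∸ c)) (λ { refl → refl }) (λ _ → refl) (counts-forest (counts-below h) (suc c))))
        (counts-⊎ (λ { u (e , _) (e′ , _) → ℕₚ.1+n≢n (≡.trans e (≡.sym e′)) })
          (counts-guard (suc c ℕₚ.≟ b) (λ _ → counts-dual (counts-tsum λ i →
            counts-guard (m i ℕₚ.≟ b) (λ _ → counts-singleton (replicate (2 ℕ.* b ∸ 1) leaflet) (leaflets (2 ℕ.* b ∸ 1))))))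
          (counts-guard (c ℕₚ.≟ b) (λ _ → counts-dual (counts-tsum λ i →
            counts-guard (b ℕₚ.<? m i) (λ _ → counts-Σ (suc (m i ℕ.+ b)) (word-unique (¬below-twig h))
              (λ j _ → counts-wordᵗ (¬below-twig h) (counts-below h 0) j (m i ℕ.+ b ∸ j) (m i ∸ suc b))))))))
      where
      counts-dual : ∀ {P : Fin n × List (Decoration (Fin n)) → Set} {g} → Counts (λ (i , ds) → unit i ⊕ wordWeight ds) P g →
        Counts treeWeight (λ u → ∃[ x ] P x × u ≡ dual (proj₁ x) (proj₂ x)) g
      counts-dual = counts-map (λ (i , ds) → dual i ds) (λ { refl → refl }) (λ _ → refl)
      leaflets : ∀ k → wordWeight {n} (replicate k leaflet) ≡ zeros
      leaflets zero    = refl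
      leaflets (suc k) = leaflets k

-- Agreement of the grammar with the rules of decorated trees.

module _ where
  open import Data.Nat.Base using (_+_; _*_; _≤_; _<_; z≤n; s≤s)

  forest-map : ∀ {P Q : ℕ → Tree X → Set} {s cs} → (∀ {c u} → P c u → Q c u) → Forest P s cs → Forest Q s cs
  forest-map f []      = []
  forest-map f (p ∷ w) = f p ∷ forest-map f w

  word-map : ∀ {P Q : Tree X → Set} → (∀ {u} → P u → Q u) → Word P e j l t ds → Word Q e j l t ds
  word-map f []           = []
  word-map f (leaflet w)  = leaflet (word-map f w)
  word-map f (twig w)     = twig (word-map f w)
  word-map f (attach p w) = attach (f p) (word-map f w)

  TwigLeaflet-free : Decoration X → Decoration X → Set
  TwigLeaflet-free d d′ = T (isTwig d) → d′ ≢ leaflet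

  word-length : ∀ {P : Tree X → Set} → Word P e j l t ds → length ds ≡ j + (l + t)
  word-length []           = refl
  word-length {j = j} {l = suc l} {t} (leaflet w) = ≡.trans (≡.cong suc (word-length w)) (≡.sym (ℕₚ.+-suc j (l + t)))
  word-length {j = j} {l = l} {t = suc t} (twig w) = ≡.trans (≡.cong suc (word-length w))
    (≡.trans (≡.sym (ℕₚ.+-suc j (l + t))) (≡.cong (ℕ._+_ j) (≡.sym (ℕₚ.+-suc l t))))
  word-length (attach p w) = ≡.cong suc (word-length w)

  word-twigs : ∀ {P : Tree X → Set} → (∀ {u} → P u → isTwig (edge u) ≡ false) → Word P e j l t ds → twigs ds ≡ t
  word-twigs f []          = refl
  word-twigs f (leaflet w) = word-twigs f w
  word-twigs f (twig w)    = ≡.cong suc (word-twigs f w)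
  word-twigs f (attach p w) rewrite f p = word-twigs f w

  linked-∷ : ∀ {A : Set} {R : A → A → Set} {x xs} → (∀ {y ys} → xs ≡ y ∷ ys → R x y) → Linked R xs → Linked R (x ∷ xs)
  linked-∷ {xs = []}     f _ = [-]
  linked-∷ {xs = x ∷ xs} f w = f refl ∷ w

  word-tight : ∀ {P : Tree X → Set} → (∀ {u} → P u → isTwig (edge u) ≡ false) → Word P e j l t ds → Linked TwigLeaflet-free ds
  word-tight f []           = []
  word-tight f (leaflet w)  = linked-∷ (λ _ ()) (word-tight f w)
  word-tight f (twig w)     = linked-∷ (λ e _ → start w e) (word-tight f w)
    where
    start : ∀ {P : Tree X → Set} {j l t ds y ys} → Word P false j l t ds → ds ≡ y ∷ ys → y ≢ leaflet
    start (twig w)     refl ()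
    start (attach p w) refl ()
  word-tight f (attach p w) = linked-∷ (λ _ z → ⊥-elim (≡.subst T (f p) z)) (word-tight f w)

  module GoodTrees {n : ℕ} (b′ : ℕ) (m : Fin n → ℕ) where

    b : ℕ
    b = suc b′

    open Grammar b m

    VertexRule : Fin n × List (Decoration (Fin n)) → Set
    VertexRule (i , ds) = Linked TwigLeaflet-free ds × dualDegree ds ≡ 2 * m i

    -- The half-edges from a primal vertex to its children carry at least one arrow, which leaves c
    -- = 0 free to stand for the root of a slice.
    Fits : ℕ → Tree (Fin n) → Set
    Fits zero    u = SliceRoot b u
    Fits (suc c) u = EdgeRule b (primal (suc c)) (top u)

    Good : ℕ → Tree (Fin n) → Set
    Good c u = Fits c u × Decorated b u × All VertexRule (blossoming u)

    below-mono : ∀ {h h′ c} u → h ≤ h′ → Below h c u → Below h′ c u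
    below-mono (primal a cs) (s≤s h≤h′) (c<b , e , w) = c<b , e , forest-map (λ {_} {u} → below-mono u h≤h′) w
    below-mono (dual i ds)   (s≤s h≤h′) (inj₁ p) = inj₁ p
    below-mono (dual i ds)   (s≤s h≤h′) (inj₂ (e , b<m , j , j< , w)) = inj₂ (e , b<m , j , j< , word-map (λ {u} → below-mono u h≤h′) w)

    sliceRoot-notTwig : ∀ {u : Tree (Fin n)} → SliceRoot b u → isTwig (edge u) ≡ false
    sliceRoot-notTwig primal      = refl
    sliceRoot-notTwig (2-angle _) = refl

    double-injective : ∀ {x y} → 2 * x ≡ 2 * y → x ≡ y
    double-injective = ℕₚ.*-cancelˡ-≡ _ _ 2

    sound : ∀ h c u → Below h c u → Good c u

    sound-forest : ∀ h {s cs} → Forest (Below h) s cs →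
      All (λ a → 1 ≤ a × a ≤ s) (map proj₁ cs) × sum (map proj₁ cs) ≡ s
      × All (λ (c , u) → EdgeRule b (primal c) (top u) × Decorated b u) cs × All VertexRule (blossomingAtP cs)
    sound-forest h [] = [] , refl , [] , []
    sound-forest h {suc c+s} (_∷_ {c} {u} {s} p w) with sound h (suc c) u p | sound-forest h w
    ... | f , d , v | as , e , fs , vs =
      (s≤s z≤n , s≤s (ℕₚ.m≤m+n c s)) ∷ All.map (Product.map₂ (λ p → ℕₚ.≤-trans p (ℕₚ.m≤n+m s (suc c)))) as ,
      ≡.cong (ℕ._+_ (suc c)) e , (f , d) ∷ fs , Allₚ.++⁺ v vs

    sound-word : ∀ h {e j l t ds d} → 2 * b + 2 ≤ d → Word (Below h 0) e j l t ds →
      All (Attached b (dual d)) ds × All VertexRule (blossomingAtD ds)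
    sound-word h d> []          = [] , []
    sound-word h d> (leaflet w) = Product.map₁ (leaflet ∷_) (sound-word h d> w)
    sound-word h d> (twig w)    = Product.map₁ (edge twig-vertex (primal (inj₁ refl) []) ∷_) (sound-word h d> w)
    sound-word h {d = d} d> (attach {u} p w) with sound h 0 u p | sound-word h d> w
    ... | f , dec , v | as , vs = edge (rule f) dec ∷ as , Allₚ.++⁺ v vs
      where
      d≢2b : d ≢ 2 * b
      d≢2b e = ℕₚ.<-irrefl (≡.sym e) (ℕₚ.<-≤-trans (ℕₚ.m<m+n (2 * b) (s≤s z≤n)) d>)
      rule : ∀ {u} → SliceRoot b u → EdgeRule b (dual d) (top u)
      rule primal         = regular refl d>
      rule (2-angle refl) = refl , inj₂ (d≢2b , refl)

    sound (suc h) c (primal a cs) (c<b , e , w) with sound-forest h w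
    ... | as , σ , fs , vs = fits c e , primal (inj₂ (two w , (a≥1 , a≤b) ∷ All.map (Product.map₂ (λ p → ℕₚ.≤-trans p c<b)) as ,
        ≡.trans (≡.cong (ℕ._+_ a) σ) (≡.trans (ℕₚ.+-suc a c) (≡.trans (≡.cong suc e) (ℕₚ.+-comm 1 b))))) fs , vs
      where
      a≥1 : 1 ≤ a
      a≥1 = ℕₚ.+-cancelʳ-≤ c 1 a (≡.subst (suc c ≤_) (≡.sym e) c<b)
      a≤b : a ≤ b
      a≤b = ≡.subst (a ≤_) e (ℕₚ.m≤m+n a c)
      two : ∀ {cs} → Forest (Below h) (suc c) cs → 2 ≤ suc (length (map proj₁ cs))
      two (p ∷ w) = s≤s (s≤s z≤n)
      fits : ∀ c → a + c ≡ b → Fits c (primal a cs)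
      fits zero    e rewrite ≡.trans (≡.sym (ℕₚ.+-identityʳ a)) e = primal
      fits (suc c) e = s≤s z≤n , a≥1 , ≡.trans (ℕₚ.+-comm (suc c) a) e
    sound (suc h) c (dual i ds) (inj₁ (e , mᵢ , refl)) =
      fits c e , dual (inj₁ (≡.cong suc (Listₚ.length-replicate (2 * b ∸ 1)) , refl)) (Allₚ.replicate⁺ _ leaflet) ,
      (tight (2 * b ∸ 1) , ≡.trans (≡.cong suc (Listₚ.length-replicate (2 * b ∸ 1))) (≡.cong (2 *_) (≡.sym mᵢ))) ∷ none (2 * b ∸ 1)
      where
      fits : ∀ c → suc c ≡ b → Fits c (dual i (replicate (2 * b ∸ 1) leaflet))
      fits zero    refl = 2-angle refl
      fits (suc c) e = special e (≡.cong suc (Listₚ.length-replicate (2 * b ∸ 1)))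
      tight : ∀ k → Linked (TwigLeaflet-free {Fin n}) (replicate k leaflet)
      tight zero    = []
      tight (suc k) = linked-∷ (λ _ ()) (tight k)
      none : ∀ k → All VertexRule (blossomingAtD (replicate k leaflet))
      none zero    = []
      none (suc k) = none k
    sound (suc h) c (dual i ds) (inj₂ (refl , b<m , j , s≤s j≤ , w)) =
      regular refl d> , dual (inj₂ (m i , ≡.subst (_≤ m i) (ℕₚ.+-comm 1 b) b<m , degree ,
        ≡.trans (word-twigs notTwig w) (≡.cong (m i ∸_) (ℕₚ.+-comm 1 b)))) (proj₁ ws) ,
      (word-tight notTwig w , degree) ∷ proj₂ ws
      where
      notTwig : ∀ {u} → Below h 0 u → isTwig (edge u) ≡ false
      notTwig {u} p = sliceRoot-notTwig (proj₁ (sound h 0 u p))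
      degree : dualDegree ds ≡ 2 * m i
      degree = begin
        suc (length ds)                                     ≡⟨ ≡.cong suc (word-length w) ⟩
        suc (j + ((m i + b ∸ j) + (m i ∸ suc b)))           ≡⟨ ≡.cong suc (≡.sym (ℕₚ.+-assoc j _ _)) ⟩
        suc ((j + (m i + b ∸ j)) + (m i ∸ suc b))           ≡⟨ ≡.cong (λ x → suc (x + (m i ∸ suc b))) (ℕₚ.m+[n∸m]≡n j≤) ⟩
        suc ((m i + b) + (m i ∸ suc b))                     ≡⟨ solve 3 (λ x y z → con 1 :+ ((x :+ y) :+ z) := x :+ ((con 1 :+ y) :+ z)) refl (m i) b (m i ∸ suc b) ⟩
        m i + (suc b + (m i ∸ suc b))                       ≡⟨ ≡.cong (ℕ._+_ (m i)) (ℕₚ.m+[n∸m]≡n b<m) ⟩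
        m i + m i                                           ≡⟨ ≡.cong (ℕ._+_ (m i)) (ℕₚ.+-identityʳ (m i)) ⟨
        2 * m i                                             ∎
        where
        open ≡.≡-Reasoning
        open +-*-Solver
      d> : 2 * b + 2 ≤ dualDegree ds
      d> = ℕₚ.≤-trans (ℕₚ.≤-reflexive (solve 1 (λ x → con 2 :* x :+ con 2 := con 2 :* (con 1 :+ x)) refl b)) (ℕₚ.≤-trans (ℕₚ.*-monoʳ-≤ 2 b<m) (ℕₚ.≤-reflexive (≡.sym degree)))
        where open +-*-Solver
      ws = sound-word h d> w

    count : Tree (Fin n) → ℕ
    count = length ∘ blossoming

    countP : List (ℕ × Tree (Fin n)) → ℕ
    countP = length ∘ blossomingAtP

    -- Bounds the height of a subtree with s blossoming vertices below a half-edge with c arrows: from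
    -- a primal vertex to a child, either s decreases or c increases.
    bound : ℕ → ℕ → ℕ
    bound s c = suc b * s + (b ∸ c)

    -- `b ∸ c` is at most b, less than the weight b + 1 of a vertex, so one vertex fewer outweighs
    -- any change of c.
    bound-< : ∀ s s′ c → s < s′ → bound s c < suc b * s′
    bound-< s s′ c s<s′ = begin-strict
      suc b * s + (b ∸ c)   ≤⟨ ℕₚ.+-monoʳ-≤ (suc b * s) (ℕₚ.m∸n≤m b c) ⟩
      suc b * s + b         <⟨ ℕₚ.n<1+n _ ⟩
      suc (suc b * s + b)   ≡⟨ solve 2 (λ b s → con 1 :+ ((con 1 :+ b) :* s :+ b) := (con 1 :+ b) :* (con 1 :+ s)) refl b s ⟩
      suc b * suc s         ≤⟨ ℕₚ.*-monoʳ-≤ (suc b) s<s′ ⟩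
      suc b * s′            ∎
      where
      open ℕₚ.≤-Reasoning
      open +-*-Solver

    countP-∷ : ∀ c u cs → countP ((c , u) ∷ cs) ≡ count u + countP cs
    countP-∷ c u cs = Listₚ.length-++ (blossoming u)

    NotTwig : Tree (Fin n) → Set
    NotTwig (primal a _) = 1 ≤ a
    NotTwig (dual _ _)   = ⊤

    edge-notTwig : ∀ c u → EdgeRule b (primal c) (top u) → NotTwig u
    edge-notTwig c (primal a cs) (_ , a≥1 , _) = a≥1
    edge-notTwig c (dual i ds)   _             = tt

    -- Descending from a primal vertex outside twigs only crosses primal half-edges that carry
    -- arrows, hence never enters a twig before it meets a dual vertex.
    positive : ∀ u → NotTwig u → Decorated b u → 1 ≤ count u
    positive (dual i ds) _ _ = s≤s z≤n
    positive (primal a cs) a≥1 (primal (inj₁ e) _) with refl ← Listₚ.∷-injectiveˡ e with () ← a≥1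
    positive (primal a []) _ (primal (inj₂ (s≤s () , _)) _)
    positive (primal a ((c , u) ∷ cs)) _ (primal (inj₂ _) ((f , d) ∷ _)) =
      ≡.subst (1 ≤_) (≡.sym (countP-∷ c u cs)) (ℕₚ.≤-trans (positive u (edge-notTwig c u f) d) (ℕₚ.m≤m+n _ _))

    good-positive : ∀ u → Good 0 u → 1 ≤ count u
    good-positive (primal a cs) (primal , d , _) = positive (primal b cs) (s≤s z≤n) d
    good-positive (dual i ds)   _                = s≤s z≤n

    count≤ : (cs : List (ℕ × Tree (Fin n))) → All (λ (c , u) → count u ≤ countP cs) cs
    count≤ []             = []
    count≤ ((c , u) ∷ cs) = ≡.subst (count u ≤_) (≡.sym (countP-∷ c u cs)) (ℕₚ.m≤m+n _ _) ∷
      All.map (λ p → ℕₚ.≤-trans p (≡.subst (countP cs ≤_) (≡.sym (countP-∷ c u cs)) (ℕₚ.m≤n+m _ _))) (count≤ cs)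

    count< : (x y : ℕ × Tree (Fin n)) (cs : List (ℕ × Tree (Fin n))) → All (λ (_ , u) → 1 ≤ count u) (x ∷ y ∷ cs) →
             All (λ (_ , u) → count u < countP (x ∷ y ∷ cs)) (x ∷ y ∷ cs)
    count< (c , u) y cs (p ∷ q ∷ ps) =
      ≡.subst (count u <_) (≡.sym (countP-∷ c u (y ∷ cs))) (ℕₚ.m<m+n (count u) (ℕₚ.≤-trans q (All.head (count≤ (y ∷ cs))))) ∷
      All.map (λ r → ≡.subst (_ <_) (≡.sym (countP-∷ c u (y ∷ cs))) (ℕₚ.≤-<-trans r (ℕₚ.m<n+m (countP (y ∷ cs)) p))) (count≤ (y ∷ cs))

    -- An only child receives all c + 1 arrows and keeps the vertices; with several children, each
    -- one leaves at least one vertex to a sibling.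
    children-bound : ∀ c cs → sum (map proj₁ cs) ≡ suc c → All (λ (_ , u) → 1 ≤ count u) cs →
      All (λ (c′ , u) → bound (count u) c′ ≤ bound (countP cs) (suc c)) cs
    children-bound c ((c′ , u) ∷ []) e _ = ℕₚ.≤-reflexive (≡.cong₂ bound
      (≡.trans (≡.sym (ℕₚ.+-identityʳ _)) (≡.sym (countP-∷ c′ u []))) (≡.trans (≡.sym (ℕₚ.+-identityʳ c′)) e)) ∷ []
    children-bound c (x ∷ y ∷ cs) e ps =
      All.map (λ {z} p → ℕₚ.≤-trans (ℕₚ.<⇒≤ (bound-< (count (proj₂ z)) (countP (x ∷ y ∷ cs)) (proj₁ z) p)) (ℕₚ.m≤m+n _ _)) (count< x y cs ps)

    -- The Boolean of `Word` read as a condition on a list; it records whether a twig has just been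
    -- passed.
    Startable : Bool → List (Decoration (Fin n)) → Set
    Startable e ds = ∀ {ds′} → ds ≡ leaflet ∷ ds′ → e ≡ true

    complete : ∀ c u → Good c u → Below (bound (count u) c) c u

    complete-primal : ∀ c a cs → 1 ≤ a → a + c ≡ b → Decorated b (primal a cs) → All VertexRule (blossomingAtP cs) →
      Below (bound (countP cs) c) c (primal a cs)

    complete-forest : ∀ h cs → All (λ (c , u) → EdgeRule b (primal c) (top u) × Decorated b u) cs →
      All (1 ≤_) (map proj₁ cs) → All VertexRule (blossomingAtP cs) →
      All (λ (c , u) → bound (count u) c ≤ h) cs → Forest (Below h) (sum (map proj₁ cs)) cs
    complete-forest h [] _ _ _ _ = []
    complete-forest h ((suc c , u) ∷ cs) ((f , d) ∷ fs) (_ ∷ ps) vs (q ∷ qs) =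
      below-mono u q (complete (suc c) u (f , d , Allₚ.++⁻ˡ (blossoming u) vs)) ∷
      complete-forest h cs fs ps (Allₚ.++⁻ʳ (blossoming u) vs) qs

    -- A degree d of at least 2 b + 2 rules out special bent edge-vertices, and for a dual child it
    -- forces b = 1 and a special child. What remains is a twig, or a tree that codes for a 0-slice.
    complete-child : ∀ {d h} u → 2 * b + 2 ≤ d → EdgeRule b (dual d) (top u) → Decorated b u → All VertexRule (blossoming u) →
      bound (count u) 0 ≤ h → u ≡ primal 0 [] ⊎ isTwig (edge u) ≡ false × Below h 0 u

    -- The numbers j and l are merely read off here; the prescribed degree fixes j + l afterwards,
    -- in `complete`.
    complete-word : ∀ {d} e h ds → 2 * b + 2 ≤ d → All (Attached b (dual d)) ds → Linked TwigLeaflet-free ds →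
      All VertexRule (blossomingAtD ds) → bound (length (blossomingAtD ds)) 0 ≤ h → Startable e ds →
      ∃₂ λ j l → Word (Below h 0) e j l (twigs ds) ds
    complete-word e h [] _ _ _ _ _ _ = 0 , 0 , []
    complete-word false h (leaflet ∷ ds) d> _ _ _ _ st with () ← st refl
    complete-word true h (leaflet ∷ ds) d> (_ ∷ as) lk vs q st with complete-word true h ds d> as (Linked.tail lk) vs q (λ _ → refl)
    ... | j , l , w = j , suc l , leaflet w
    complete-word e h (edge u ∷ ds) d> (edge f d ∷ as) lk vs q st
      with complete-child {h = h} u d> f d (Allₚ.++⁻ˡ (blossoming u) vs) (ℕₚ.≤-trans (ℕₚ.+-monoˡ-≤ b (ℕₚ.*-monoʳ-≤ (suc b) (≡.subst (count u ≤_) (≡.sym len) (ℕₚ.m≤m+n _ _)))) q)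
         | Allₚ.++⁻ʳ (blossoming u) vs
         | ℕₚ.≤-trans (ℕₚ.+-monoˡ-≤ b (ℕₚ.*-monoʳ-≤ (suc b) (≡.subst (length (blossomingAtD ds) ≤_) (≡.sym len) (ℕₚ.m≤n+m _ _)))) q
      where
      len : length (blossomingAtD (edge u ∷ ds)) ≡ count u + length (blossomingAtD ds)
      len = Listₚ.length-++ (blossoming u)
    ... | inj₁ refl | vs′ | q′ with complete-word false h ds d> as (Linked.tail lk) vs′ q′ (λ { refl → ⊥-elim (Linked.head lk tt refl) })
    ...   | j , l , w = j , l , twig w
    complete-word e h (edge u ∷ ds) d> (edge f d ∷ as) lk vs q st
        | inj₂ (notTwig , p) | vs′ | q′ rewrite notTwig with complete-word true h ds d> as (Linked.tail lk) vs′ q′ (λ _ → refl)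
    ...   | j , l , w = suc j , l , attach p w

    2b<⇒≢ : ∀ {d} → 2 * b + 2 ≤ d → d ≢ 2 * b
    2b<⇒≢ d> e = ℕₚ.<-irrefl (≡.sym e) (ℕₚ.<-≤-trans (ℕₚ.m<m+n (2 * b) (s≤s z≤n)) d>)

    ¬labeled : ∀ {x d} → b + 1 ≤ x → d ≡ 2 * x → d ≢ 2 * b
    ¬labeled {x} b<x refl = λ e → ℕₚ.<-irrefl (≡.sym (double-injective e)) (≡.subst (_≤ x) (ℕₚ.+-comm b 1) b<x)

    complete-child (primal zero [])      _ _ _ _ _ = inj₁ refl
    complete-child (primal zero (_ ∷ _)) _ _ (primal (inj₁ ()) _) _ _
    complete-child (primal zero (_ ∷ _)) _ _ (primal (inj₂ (_ , ((() , _) ∷ _) , _)) _) _ _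
    complete-child (primal (suc a) cs) d> (special _ e) dec vs q = contradiction e (2b<⇒≢ d>)
    complete-child (primal (suc a) cs) d> (regular refl _) dec vs q =
      inj₂ (refl , below-mono (primal b cs) q (complete-primal 0 b cs (s≤s z≤n) (ℕₚ.+-identityʳ b) dec vs))
    complete-child (dual i ds) d> (b≡1 , inj₁ (e , _)) dec vs q = contradiction e (2b<⇒≢ d>)
    complete-child (dual i ds) d> (b≡1 , inj₂ (_ , e)) (dual (inj₂ (x , b<x , e′ , _)) _) vs q = contradiction e (¬labeled b<x e′)
    complete-child (dual i ds) d> (refl , inj₂ (_ , e)) (dual (inj₁ (_ , refl)) _) ((_ , e′) ∷ _) q =
      inj₂ (refl , below-mono (dual i ds) q (inj₁ (refl , double-injective (≡.sym e′) , refl)))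

    complete-primal c a cs a≥1 e (primal (inj₁ e′) _) vs with refl ← Listₚ.∷-injectiveˡ e′ with () ← a≥1
    complete-primal c a cs a≥1 e (primal (inj₂ (_ , (_ ∷ as) , σ)) fs) vs =
      -- `Below` needs a visible successor: since c < b, passing to c + 1 lowers `b ∸ c` by one, so
      -- the bound at c is the successor of the bound used for the children.
      ≡.subst (λ h → Below h c (primal a cs)) (≡.trans (≡.sym (ℕₚ.+-suc (suc b * countP cs) (b ∸ suc c))) (≡.cong (ℕ._+_ (suc b * countP cs)) (≡.sym (ℕₚ.+-∸-assoc 1 c<b))))
        (c<b , e , ≡.subst (λ s → Forest (Below (bound (countP cs) (suc c))) s cs) total
          (complete-forest _ cs fs (All.map proj₁ as) vs (children-bound c cs total (All.map (λ { {c , u} (f , d) → positive u (edge-notTwig c u f) d }) fs))))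
      where
      c<b : c < b
      c<b = ≡.subst (c <_) e (ℕₚ.m<n+m c a≥1)
      total : sum (map proj₁ cs) ≡ suc c
      total = ℕₚ.+-cancelˡ-≡ a _ _ (≡.trans σ (≡.trans (≡.cong (_+ 1) (≡.sym e)) (≡.trans (ℕₚ.+-assoc a c 1) (≡.cong (ℕ._+_ a) (ℕₚ.+-comm c 1)))))

    complete zero    (primal a cs) (primal , d , vs) = complete-primal 0 b cs (s≤s z≤n) (ℕₚ.+-identityʳ b) d vs
    complete (suc c) (primal a cs) ((_ , a≥1 , e) , d , vs) = complete-primal (suc c) a cs a≥1 (≡.trans (ℕₚ.+-comm a (suc c)) e) d vs
    complete zero (dual i ds) (2-angle refl , _ , (_ , e) ∷ _) = inj₁ (refl , double-injective (≡.sym e) , refl)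
    complete (suc c) (dual i ds) (special e deg , dual (inj₁ (_ , e′)) _ , (_ , deg′) ∷ _) =
      inj₁ (e , double-injective (≡.trans (≡.sym deg′) deg) , e′)
    complete (suc c) (dual i ds) (special e deg , dual (inj₂ (x , b<x , e′ , _)) _ , _) = contradiction deg (¬labeled b<x e′)
    complete (suc c) (dual i ds) (regular e d> , dual (inj₁ (deg , _)) _ , _) = contradiction deg (2b<⇒≢ d>)
    complete (suc c) (dual i ds) (regular refl d> , dual (inj₂ (x , b<x , deg , tw)) as , (lk , deg′) ∷ vs)
      with complete-word true _ ds d> as lk vs ℕₚ.≤-refl (λ _ → refl)
    ... | j , l , w = inj₂ (refl , b<m , j , s≤s j≤ ,
      -- The height written out is what `bound (suc s₀) b` reduces to under its outermost successor.
      ≡.subst₂ (λ l t → Word (Below (s₀ + suc b′ * suc s₀ + (b ∸ suc b′)) 0) true j l t ds) l≡ tw′ (word-map (λ {u} → below-mono u (ℕₚ.≤-reflexive height)) w))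
      where
      x≡m : x ≡ m i
      x≡m = double-injective (≡.trans (≡.sym deg) deg′)
      b<m : b < m i
      b<m = ≡.subst₂ _≤_ (ℕₚ.+-comm b 1) x≡m b<x
      tw′ : twigs ds ≡ m i ∸ suc b
      tw′ = ≡.trans tw (≡.cong₂ _∸_ x≡m (ℕₚ.+-comm b 1))
      s₀ = length (blossomingAtD ds)
      height : bound s₀ 0 ≡ s₀ + suc b′ * suc s₀ + (b ∸ suc b′)
      height = ≡.sym (≡.trans (≡.cong (ℕ._+_ (s₀ + suc b′ * suc s₀)) (ℕₚ.n∸n≡0 b)) (solve 2 (λ s b → s :+ b :* (con 1 :+ s) :+ con 0 := (con 1 :+ b) :* s :+ b) refl s₀ b))
        where open +-*-Solver
      j+l : j + l ≡ m i + b
      j+l = ℕₚ.+-cancelʳ-≡ (suc (m i ∸ suc b)) (j + l) (m i + b) (begin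
        (j + l) + suc (m i ∸ suc b)         ≡⟨ ≡.cong (λ t → (j + l) + suc t) tw′ ⟨
        (j + l) + suc (twigs ds)            ≡⟨ solve 3 (λ j l t → (j :+ l) :+ (con 1 :+ t) := con 1 :+ (j :+ (l :+ t))) refl j l (twigs ds) ⟩
        suc (j + (l + twigs ds))            ≡⟨ ≡.cong suc (word-length w) ⟨
        dualDegree ds                       ≡⟨ deg′ ⟩
        2 * m i                             ≡⟨ ≡.cong (ℕ._+_ (m i)) (ℕₚ.+-identityʳ (m i)) ⟩
        m i + m i                           ≡⟨ ≡.cong (ℕ._+_ (m i)) (ℕₚ.m+[n∸m]≡n b<m) ⟨
        m i + (suc b + (m i ∸ suc b))       ≡⟨ solve 3 (λ x y z → x :+ ((con 1 :+ y) :+ z) := (x :+ y) :+ (con 1 :+ z)) refl (m i) b (m i ∸ suc b) ⟩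
        (m i + b) + suc (m i ∸ suc b)       ∎)
        where
        open ≡.≡-Reasoning
        open +-*-Solver
      j≤ : j ≤ m i + b
      j≤ = ≡.subst (j ≤_) j+l (ℕₚ.m≤m+n j l)
      l≡ : l ≡ m i + b ∸ j
      l≡ = ≡.trans (≡.sym (ℕₚ.m+n∸m≡n j l)) (≡.cong (_∸ j) j+l)

-- The series of 0-slices and its functional equations.

sum-⊕ : ∀ {n} (u v : Vec ℕ n) → Vec.sum (u ⊕ v) ≡ Vec.sum u ℕ.+ Vec.sum v
sum-⊕ []      []      = refl
sum-⊕ (x ∷ u) (y ∷ v) = ≡.trans (≡.cong (x ℕ.+ y ℕ.+_) (sum-⊕ u v)) (+-*-Solver.solve 4 (λ x y u v → (x :+ y) :+ (u :+ v) := (x :+ u) :+ (y :+ v)) refl x y (Vec.sum u) (Vec.sum v))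
  where
  open import Data.Nat.Solver using (module +-*-Solver)
  open +-*-Solver

sum-zeros : ∀ n → Vec.sum (zeros {n}) ≡ 0
sum-zeros zero    = refl
sum-zeros (suc n) = sum-zeros n

sum-unit : ∀ {n} (i : Fin n) → Vec.sum (unit i) ≡ 1
sum-unit {suc n} zero    = ≡.cong suc (sum-zeros n)
sum-unit         (suc i) = sum-unit i

sum-labelWeight : ∀ {n} (l : List (Fin n × List (Decoration (Fin n)))) → Vec.sum (labelWeight l) ≡ length l
sum-labelWeight {n} []      = sum-zeros n
sum-labelWeight ((i , _) ∷ l) = ≡.trans (sum-⊕ (unit i) _) (≡.cong₂ ℕ._+_ (sum-unit i) (sum-labelWeight l))

sum-⟦⟧ : ∀ {n} (S : Vec Bool n) → Vec.sum ⟦ S ⟧ ≡ size S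
sum-⟦⟧ []          = refl
sum-⟦⟧ (true ∷ S)  = ≡.cong suc (sum-⟦⟧ S)
sum-⟦⟧ (false ∷ S) = sum-⟦⟧ S

module SliceSeries (K : Ring₀) (torsionFree : TorsionFree K) (n b′ : ℕ) (m : Fin n → ℕ) where
  open GoodTrees b′ m
  open Grammar b m
  open Counting K n
  open TreeCounting K n
  open SubsetRing K
  open CommutativeRing (subsetRing K n) renaming (refl to ≈-refl; sym to ≈-sym; trans to ≈-trans) hiding (zero)
  open SeriesCalculus (subsetRing K n)
  open Algebra.Properties.Semiring.Exp semiring using (_^_)
  private
    module I = IntegerSolver (subsetRing K n)
    module J = IntegerSolver K[[u]]
  open import Relation.Binary.Reasoning.Setoid setoid

  -- The value of `bound` for n blossoming vertices and c = 0, its maximum. A tree of squarefree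
  -- weight uses each label at most once, so this height suffices for it.
  maxHeight : ℕ
  maxHeight = suc b ℕ.* n ℕ.+ b

  f : Seq
  f = belowGF b m maxHeight

  good⇒below : ∀ {c S} u → treeWeight u ≡ ⟦ S ⟧ → Good c u → Below maxHeight c u
  good⇒below {c} {S} u w g = below-mono u
    (ℕₚ.+-mono-≤ (ℕₚ.*-monoʳ-≤ (suc b) (≡.subst (ℕ._≤ n) (≡.trans (≡.sym (sum-⟦⟧ S)) (≡.trans (≡.cong Vec.sum (≡.sym w)) (sum-labelWeight (blossoming u)))) (size≤ S))) (ℕₚ.m∸n≤m b c))
    (complete c u g)

  counts-good : ∀ c → Counts treeWeight (Good c) (f c)
  counts-good c S = Cardinality.card-resp K (λ u → mk⇔ (λ (p , w) → sound maxHeight c u p , w) (λ (g , w) → good⇒below {S = S} u w g , w))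
    (CommutativeRing.refl K) (counts-below b m maxHeight c S)

  -- Allowing one more level adds no tree of squarefree weight: both heights count `Good c`, so the
  -- truncated series is already a fixed point of `step`.
  f-step : ∀ c → f c ≈ step b m f c
  f-step c = counts-unique (counts-good c) (λ S → Cardinality.card-resp K
    (λ u → mk⇔ (λ (p , w) → sound (suc maxHeight) c u p , w) (λ (g , w) → below-mono u (ℕₚ.n≤1+n _) (good⇒below {S = S} u w g) , w))
    (CommutativeRing.refl K) (counts-below b m (suc maxHeight) c S))

  R Sp L vertices : Carrier
  R  = f 0
  Sp = tsum (specialGF b m)
  L  = tsum (labeledGF b m R)
  vertices  = L + Sp

  specialTerm : ℕ → Carrier
  specialTerm c = if does (suc c ℕₚ.≟ b) then Sp else 0#

  H : Seq
  H = forestGF f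

  f-< : ∀ {c} → c ℕ.< b → f c ≈ H (suc c) + specialTerm c
  f-< {c} c<b = ≈-trans (f-step c) (+-cong
    (reflexive (≡.cong (λ x → if x then H (suc c) else 0#) (dec-true (c ℕₚ.<? b) c<b)))
    (≈-trans (+-congˡ (reflexive (≡.cong (λ x → if x then L else 0#) (dec-false (c ℕₚ.≟ b) (ℕₚ.<⇒≢ c<b))))) (+-identityʳ _)))

  f-b : f b ≈ L
  f-b = ≈-trans (f-step b) (≈-trans (+-cong
    (reflexive (≡.cong (λ x → if x then H (suc b) else 0#) (dec-false (b ℕₚ.<? b) (ℕₚ.<-irrefl refl))))
    (+-cong (reflexive (≡.cong (λ x → if x then Sp else 0#) (dec-false (suc b ℕₚ.≟ b) ℕₚ.1+n≢n)))
            (reflexive (≡.cong (λ x → if x then L else 0#) (dec-true (b ℕₚ.≟ b) refl)))))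
    (≈-trans (+-identityˡ _) (+-identityˡ _)))

  specialTerm-≢ : ∀ {c} → suc c ≢ b → specialTerm c ≈ 0#
  specialTerm-≢ {c} c≢ = reflexive (≡.cong (λ x → if x then Sp else 0#) (dec-false (suc c ℕₚ.≟ b) c≢))

  specialTerm-≡ : specialTerm b′ ≈ Sp
  specialTerm-≡ = reflexive (≡.cong (λ x → if x then Sp else 0#) (dec-true (b ℕₚ.≟ b) refl))

  -- The series `f` from degree 1 to b - 1, with the special vertices moved from degree b - 1 to
  -- degree b, next to the labeled ones.
  A : Seq
  A zero    = 0#
  A (suc c) = if does (suc c ℕₚ.≟ b) then vertices else f (suc c)

  A-< : ∀ {c} → suc c ℕ.< b → A (suc c) ≈ f (suc c)
  A-< {c} c<b = reflexive (≡.cong (λ x → if x then vertices else f (suc c)) (dec-false (suc c ℕₚ.≟ b) (ℕₚ.<⇒≢ c<b)))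

  A-b : A b ≈ vertices
  A-b = reflexive (≡.cong (λ x → if x then vertices else f b) (dec-true (b ℕₚ.≟ b) refl))

  RA : Seq
  RA = const R S.+ A

  RA-< : ∀ {c} → c ℕ.< b → RA c ≈ f c
  RA-< {zero}  _   = +-identityʳ R
  RA-< {suc c} c<b = ≈-trans (+-identityˡ _) (A-< c<b)

  H-< : ∀ {c} → c ℕ.< b → H c ≈ (S.1# S.+ (Y ⋆ RA)) c
  H-< {zero}  _   = ≈-sym (≈-trans (+-congˡ (Y⋆-zero RA)) (+-identityʳ 1#))
  H-< {suc c} c<b = begin
    H (suc c)                    ≈⟨ +-identityʳ _ ⟨
    H (suc c) + 0#               ≈⟨ +-congˡ (specialTerm-≢ (ℕₚ.<⇒≢ c<b)) ⟨
    H (suc c) + specialTerm c        ≈⟨ f-< (ℕₚ.<⇒≤ c<b) ⟨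
    f c                          ≈⟨ RA-< (ℕₚ.<⇒≤ c<b) ⟨
    RA c                         ≈⟨ Y⋆-suc RA c ⟨
    (Y ⋆ RA) (suc c)             ≈⟨ +-identityˡ _ ⟨
    0# + (Y ⋆ RA) (suc c)        ∎

  -- In degree b - 1 the top coefficient of `tail f` meets the constant term 1 of `H`, so adding
  -- `Sp` outside the product amounts to adding it to that coefficient, where L becomes L + Sp.
  forest-A : ∀ {c} → c ℕ.< b → H (suc c) + specialTerm c ≈ (tail A ⋆ H) c
  forest-A {c} (ℕ.s≤s c≤b′) with ℕₚ.m≤n⇒m<n∨m≡n c≤b′
  ... | inj₁ c<b′ = begin
    H (suc c) + specialTerm c   ≈⟨ +-congˡ (specialTerm-≢ (ℕₚ.<⇒≢ (ℕ.s≤s c<b′))) ⟩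
    H (suc c) + 0#          ≈⟨ +-identityʳ _ ⟩
    H (suc c)               ≈⟨ firstGF-⋆ f 0 c ⟩
    (tail f ⋆ H) c          ≈⟨ ⋆-cong≤ {g = H} c (λ i i≤c → ≈-sym (A-< (ℕ.s≤s (ℕₚ.≤-<-trans i≤c c<b′)))) (λ _ _ → ≈-refl) ⟩
    (tail A ⋆ H) c          ∎
  ... | inj₂ refl = begin
    H (suc b′) + specialTerm b′ ≈⟨ +-cong (firstGF-⋆ f 0 b′) specialTerm-≡ ⟩
    (tail f ⋆ H) b′ + Sp    ≈⟨ last b′ (tail f) (tail A) (λ i i<b′ → ≈-sym (A-< (ℕ.s≤s i<b′))) (≈-trans (+-congʳ f-b) (≈-sym A-b)) ⟩
    (tail A ⋆ H) b′         ∎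
    where
    last : ∀ d F G → (∀ i → i ℕ.< d → F i ≈ G i) → F d + Sp ≈ G d → (F ⋆ H) d + Sp ≈ (G ⋆ H) d
    last zero    F G p q = ≈-trans (+-congʳ (*-identityʳ _)) (≈-trans q (≈-sym (*-identityʳ _)))
    last (suc d) F G p q = begin
      (F ⋆ H) (suc d) + Sp                          ≈⟨ +-congʳ (⋆-sucʳ F H d) ⟩
      F (suc d) * 1# + (F ⋆ tail H) d + Sp          ≈⟨ I.solve 3 (λ x y z → x I.:* I.:1 I.:+ y I.:+ z I.:= (x I.:+ z) I.:* I.:1 I.:+ y) ≈-refl _ _ _ ⟩
      (F (suc d) + Sp) * 1# + (F ⋆ tail H) d        ≈⟨ +-cong (*-congʳ q) (⋆-cong≤ {g = tail H} d (λ i i≤d → p i (ℕ.s≤s i≤d)) (λ _ _ → ≈-refl)) ⟩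
      G (suc d) * 1# + (G ⋆ tail H) d               ≈⟨ ⋆-sucʳ G H d ⟨
      (G ⋆ H) (suc d)                               ∎

  Y⋆tail-A : Y ⋆ tail A S.≈ A
  Y⋆tail-A zero    = Y⋆-zero (tail A)
  Y⋆tail-A (suc c) = Y⋆-suc (tail A) c

  open Narayana (subsetRing K n) (subsetRing-torsionFree torsionFree n) R using (kernel; narayana)

  -- Eliminate `H`: below degree b, RA = (tail A) H and H = 1 + z RA. Hence RA = tail A + A RA, so
  -- tail A = RA (1 - A).
  A₊ : ∀ c → c ℕ.< b → A (suc c) ≈ kernel A c
  A₊ c c<b = begin
    A (suc c)
      ≈⟨ I.solve 2 (λ x y → x I.:= (x I.:+ y) I.:+ (I.:- y)) ≈-refl (A (suc c)) _ ⟩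
    (A (suc c) + (A ⋆ RA) c) + (- (A ⋆ RA) c)
      ≈⟨ +-congʳ (begin
        A (suc c) + (A ⋆ RA) c                   ≈⟨ +-congˡ (S.*-congʳ {RA} Y⋆tail-A c) ⟨
        (tail A S.+ ((Y ⋆ tail A) ⋆ RA)) c       ≈⟨ J.solve 3 (λ a y r → a J.:+ (y J.:* a) J.:* r J.:= a J.:* (J.:1 J.:+ y J.:* r)) S.refl (tail A) Y RA c ⟩
        (tail A ⋆ (S.1# S.+ (Y ⋆ RA))) c         ≈⟨ ⋆-cong≤ {f = tail A} c (λ _ _ → ≈-refl) (λ i i≤c → H-< (ℕₚ.≤-<-trans i≤c c<b)) ⟨
        (tail A ⋆ H) c                           ≈⟨ forest-A c<b ⟨
        H (suc c) + specialTerm c                    ≈⟨ f-< c<b ⟨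
        f c                                      ≈⟨ RA-< c<b ⟨
        RA c                                     ∎) ⟩
    RA c + (- (A ⋆ RA) c)
      ≈⟨ J.solve 2 (λ r a → r J.:+ (J.:- (a J.:* r)) J.:= r J.:* (J.:1 J.:+ (J.:- a))) S.refl RA A c ⟩
    kernel A c ∎

  vertices-narayana : ν b * vertices ≈ sumTo b (λ i → (- 1#) ^ i * ν ((b C suc i) ℕ.* (b C i)) * R ^ suc i)
  vertices-narayana = ≈-trans (*-congˡ (≈-sym A-b)) (narayana A b′ ≈-refl A₊)

  vertexGF : Fin n → Carrier
  vertexGF i = labeledGF b m R i + specialGF b m i

  vertices-vertex : vertices ≈ tsum vertexGF
  vertices-vertex = ≈-sym (tsum-+ n (labeledGF b m R) (specialGF b m))

-- Inversion for the series of 0-slices.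

module SliceLagrange (K : Ring₀) (torsionFree : TorsionFree K) (n b′ : ℕ) (m : Fin n → ℕ)
  (g w : ℕ → CommutativeRing.Carrier K) (Q : Fin n → ℕ → CommutativeRing.Carrier K) where

  open SliceSeries K torsionFree n b′ m using (counts-good; vertices; vertices-narayana; vertexGF; vertices-vertex) renaming (R to sliceGF)
  open GoodTrees b′ m using (b)
  open TreeCounting K n using (specialGF; labeledGF)
  open SubsetRing K
  open CommutativeRing K renaming (refl to ≈-refl; sym to ≈-sym; trans to ≈-trans) hiding (zero)
  open SeriesCalculus K
  open ListSum K
  open Algebra.Properties.Semiring.Exp semiring using (_^_)
  open Cancellation K torsionFree
  private
    module I = IntegerSolver K
    module En = CommutativeRing (subsetRing K n)
    module Iⁿ = IntegerSolver (subsetRing K n)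
    module Nn = Naturals (subsetRing K n)
    module Sn = RangeSum (subsetRing K n)
  open E n using () renaming (_^_ to _^ᴱ_)
  open Algebra.Properties.Semiring.Exp En.semiring using (^-homo-*)
  open import Relation.Binary.Reasoning.Setoid setoid

  coef-sign : ∀ (T : Vec Bool n) k h → coef T ((En.- En.1#) ^ᴱ k En.* h) ≈ (- 1#) ^ k * coef T h
  coef-sign T zero    h = ≈-trans (coef-cong T (En.*-identityˡ h)) (≈-sym (*-identityˡ _))
  coef-sign T (suc k) h = begin
    coef T ((En.- En.1#) En.* σ En.* h)     ≈⟨ coef-cong T (Iⁿ.solve 2 (λ s h → (Iⁿ.:- Iⁿ.:1) Iⁿ.:* s Iⁿ.:* h Iⁿ.:= Iⁿ.:- (s Iⁿ.:* h)) En.refl σ h) ⟩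
    coef T (En.- (σ En.* h))                ≈⟨ ≈-trans (coef-neg T _) (-‿cong (coef-sign T k h)) ⟩
    - ((- 1#) ^ k * coef T h)               ≈⟨ I.solve 2 (λ s h → I.:- (s I.:* h) I.:= (I.:- I.:1) I.:* s I.:* h) ≈-refl _ _ ⟩
    (- 1#) ^ suc k * coef T h               ∎
    where σ = (En.- En.1#) ^ᴱ k

  coef-sumTo : ∀ (T : Vec Bool n) k F → coef T (Sn.sumTo k F) ≈ sumTo k (λ i → coef T (F i))
  coef-sumTo T zero    F = coef-0 T
  coef-sumTo T (suc k) F = ≈-trans (coef-+ T _ _) (+-congˡ (coef-sumTo T k _))

  -- Sums over powers of R end at b or m + b by their coefficients, but after n by nilpotency; the
  -- inversion wants the uniform bound n + 1.
  sumTo-truncate : ∀ M N (F : ℕ → Carrier) → (∀ i → M ℕ.≤ i → F i ≈ 0#) → (∀ i → N ℕ.≤ i → F i ≈ 0#) → sumTo M F ≈ sumTo N F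
  sumTo-truncate M N F p q = ≈-trans (≈-sym (sumTo-extend M (M ℕ.+ N) p (ℕₚ.m≤m+n M N))) (sumTo-extend N (M ℕ.+ N) q (ℕₚ.m≤n+m N M))

  -- Every slice has a blossoming vertex, by `good-positive`.
  sliceGF∅ : ∀ (T : Vec Bool n) → size T ≡ 0 → coef T sliceGF ≈ 0#
  sliceGF∅ T e = Cardinality.card-unique K (counts-good 0 T) (Cardinality.card-∅ K λ { u (good , w) →
    ℕₚ.<⇒≢ (GoodTrees.good-positive b′ m u good) (≡.sym (≡.trans (≡.sym (sum-labelWeight (blossoming u)))
      (≡.trans (≡.cong Vec.sum w) (≡.trans (sum-⟦⟧ T) e)))) })

  power-vanishes : ∀ k j (T : Vec Bool n) → suc n ℕ.≤ j → coef T (sliceGF ^ᴱ (k ℕ.+ j)) ≈ 0#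
  power-vanishes k j T n<j = nilpotent sliceGF sliceGF∅ (k ℕ.+ j) T
    (ℕₚ.≤-trans (ℕ.s≤s (size≤ T)) (ℕₚ.≤-trans n<j (ℕₚ.m≤n+m j k)))

  module _ (b≤m : ∀ i → b ℕ.≤ m i)
    (Q-labeled : ∀ i → b ℕ.< m i → ∀ j → Q i j ≈ ν (((m i ℕ.+ b) C j) ℕ.* ((m i ∸ suc b ℕ.+ j) C j)))
    (Q-special : ∀ i → m i ≡ b → ∀ j → Q i j ≈ S.1# j) where

    vertex-powers : ∀ i k (T : Vec Bool n) →
      coef T (vertexGF i En.* sliceGF ^ᴱ k) ≈ sumTo (suc n) (λ j → Q i j * coef T (sliceGF ^ᴱ (k ℕ.+ j)))
    vertex-powers i k T with ℕₚ.m≤n⇒m<n∨m≡n (b≤m i)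
    ... | inj₁ b<m = begin
      coef T ((labeledGF b m sliceGF i En.+ specialGF b m i) En.* sliceGF ^ᴱ k)
        ≈⟨ coef-cong T (En.*-congʳ (En.trans (En.+-cong (En.reflexive (≡.cong (λ x → if x then labels else En.0#) (dec-true (b ℕₚ.<? m i) b<m)))
             (En.reflexive (≡.cong (λ x → if x then En.1# else En.0#) (dec-false (m i ℕₚ.≟ b) (ℕₚ.>⇒≢ b<m))))) (En.+-identityʳ labels))) ⟩
      coef T (labels En.* sliceGF ^ᴱ k)
        ≈⟨ ≈-trans (coef-cong T (Sn.sumTo-*ʳ (sliceGF ^ᴱ k) M summand)) (coef-sumTo T M (λ j → summand j En.* sliceGF ^ᴱ k)) ⟩
      sumTo M (λ j → coef T (Nn.ν (wordCount true j (m i ℕ.+ b ∸ j) (m i ∸ suc b)) En.* sliceGF ^ᴱ j En.* sliceGF ^ᴱ k))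
        ≈⟨ sumTo-cong M (λ { j (ℕ.s≤s j≤) → term j j≤ }) ⟩
      sumTo M (λ j → Q i j * coef T (sliceGF ^ᴱ (k ℕ.+ j)))
        ≈⟨ sumTo-truncate M (suc n) _
             (λ j j≥M → ≈-trans (*-congʳ (≈-trans (Q-labeled i b<m j) (ν-cong (≡.cong (ℕ._* ((m i ∸ suc b ℕ.+ j) C j)) (k>n⇒nCk≡0 j≥M))))) (zeroˡ _))
             (λ j j>n → ≈-trans (*-congˡ (power-vanishes k j T j>n)) (zeroʳ _)) ⟩
      sumTo (suc n) (λ j → Q i j * coef T (sliceGF ^ᴱ (k ℕ.+ j))) ∎
      where
      M = suc (m i ℕ.+ b)
      summand : ℕ → Elt n
      summand j = Nn.ν (wordCount true j (m i ℕ.+ b ∸ j) (m i ∸ suc b)) En.* sliceGF ^ᴱ j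
      labels : Elt n
      labels = Sn.sumTo M summand
      term : ∀ j → j ℕ.≤ m i ℕ.+ b →
        coef T (Nn.ν (wordCount true j (m i ℕ.+ b ∸ j) (m i ∸ suc b)) En.* sliceGF ^ᴱ j En.* sliceGF ^ᴱ k) ≈ Q i j * coef T (sliceGF ^ᴱ (k ℕ.+ j))
      term j j≤ = begin
        coef T (Nn.ν wc En.* sliceGF ^ᴱ j En.* sliceGF ^ᴱ k)
          ≈⟨ coef-cong T (En.trans (En.*-assoc _ _ _) (En.*-congˡ (En.trans (En.*-comm _ _) (En.sym (^-homo-* sliceGF k j))))) ⟩
        coef T (Nn.ν wc En.* sliceGF ^ᴱ (k ℕ.+ j))
          ≈⟨ coef-ν T wc _ ⟩
        ν wc * coef T (sliceGF ^ᴱ (k ℕ.+ j))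
          ≈⟨ *-congʳ (≈-trans (ν-cong (≡.cong (λ x → (x C j) ℕ.* ((m i ∸ suc b ℕ.+ j) C j)) (ℕₚ.m∸n+n≡m j≤))) (≈-sym (Q-labeled i b<m j))) ⟩
        Q i j * coef T (sliceGF ^ᴱ (k ℕ.+ j)) ∎
        where wc = wordCount true j (m i ℕ.+ b ∸ j) (m i ∸ suc b)
    ... | inj₂ b≡m = begin
      coef T ((labeledGF b m sliceGF i En.+ specialGF b m i) En.* sliceGF ^ᴱ k)
        ≈⟨ coef-cong T (En.trans (En.*-congʳ (En.trans (En.+-cong (En.reflexive (≡.cong (λ x → if x then labels else En.0#) (dec-false (b ℕₚ.<? m i) (ℕₚ.<-irrefl b≡m))))
             (En.reflexive (≡.cong (λ x → if x then En.1# else En.0#) (dec-true (m i ℕₚ.≟ b) (≡.sym b≡m))))) (En.+-identityˡ En.1#))) (En.*-identityˡ _)) ⟩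
      coef T (sliceGF ^ᴱ k)
        ≡⟨ ≡.cong (λ k → coef T (sliceGF ^ᴱ k)) (ℕₚ.+-identityʳ k) ⟨
      coef T (sliceGF ^ᴱ (k ℕ.+ 0))
        ≈⟨ ≈-trans (≈-sym (*-identityˡ _)) (*-congʳ (≈-sym (Q-special i (≡.sym b≡m) 0))) ⟩
      Q i 0 * coef T (sliceGF ^ᴱ (k ℕ.+ 0))
        ≈⟨ ≈-trans (+-congˡ (sumTo-zero n (λ j _ → ≈-trans (*-congʳ (Q-special i (≡.sym b≡m) (suc j))) (zeroˡ _)))) (+-identityʳ _) ⟨
      sumTo (suc n) (λ j → Q i j * coef T (sliceGF ^ᴱ (k ℕ.+ j))) ∎
      where
      labels : Elt n
      labels = Sn.sumTo (suc (m i ℕ.+ b)) (λ j → Nn.ν (wordCount true j (m i ℕ.+ b ∸ j) (m i ∸ suc b)) En.* sliceGF ^ᴱ j)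

    vertices-powers : ∀ k (T : Vec Bool n) → coef T (vertices En.* sliceGF ^ᴱ k) ≈
      ΣL (elements T) (λ (i , T′) → sumTo (suc n) (λ j → Q i j * coef T′ (sliceGF ^ᴱ (k ℕ.+ j))))
    vertices-powers k T = begin
      coef T (vertices En.* sliceGF ^ᴱ k)                              ≈⟨ coef-cong T (En.trans (En.*-congʳ vertices-vertex) (tsum-* n vertexGF (sliceGF ^ᴱ k))) ⟩
      coef T (tsum (λ i → vertexGF i En.* sliceGF ^ᴱ k))        ≈⟨ coef-tsum T _ ⟩
      ΣL (elements T) (λ (i , T′) → coef T′ (vertexGF i En.* sliceGF ^ᴱ k))
        ≈⟨ ΣL-cong′ (elements T) (λ (i , T′) → vertex-powers i k T′) ⟩
      ΣL (elements T) (λ (i , T′) → sumTo (suc n) (λ j → Q i j * coef T′ (sliceGF ^ᴱ (k ℕ.+ j)))) ∎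

    module _ (g-narayana : ∀ i → ν b * g i ≈ (- 1#) ^ i * ν ((b C suc i) ℕ.* (b C i))) where

      g₀ : g 0 ≈ 1#
      g₀ = ν-cancelˡ b′ (g 0) 1# (begin
        ν b * g 0                        ≈⟨ g-narayana 0 ⟩
        1# * ν ((b C 1) ℕ.* (b C 0))     ≈⟨ *-congˡ (ν-cong (≡.trans (ℕₚ.*-identityʳ (b C 1)) (nC1≡n b))) ⟩
        1# * ν b                         ≈⟨ *-comm _ _ ⟩
        ν b * 1#                         ∎)

      g-vanishes : ∀ i → b ℕ.≤ i → g i ≈ 0#
      g-vanishes i b≤i = torsionFree b′ (g i) (≈-trans (g-narayana i)
        (≈-trans (*-congˡ (ν-cong (≡.cong (ℕ._* (b C i)) (k>n⇒nCk≡0 (ℕ.s≤s b≤i))))) (zeroʳ _)))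

      -- The Narayana formula multiplied by R^k; b is cancelled only after coefficients have been
      -- taken, in K.
      g-powers : ∀ k (T : Vec Bool n) → sumTo (suc n) (λ j → g j * coef T (sliceGF ^ᴱ (suc k ℕ.+ j))) ≈ coef T (vertices En.* sliceGF ^ᴱ k)
      g-powers k T = ν-cancelˡ b′ _ _ (≈-sym (begin
        ν b * coef T (vertices En.* sliceGF ^ᴱ k)
          ≈⟨ coef-ν T b _ ⟨
        coef T (Nn.ν b En.* (vertices En.* sliceGF ^ᴱ k))
          ≈⟨ coef-cong T (En.trans (En.sym (En.*-assoc _ _ _)) (En.trans (En.*-congʳ vertices-narayana) (Sn.sumTo-*ʳ (sliceGF ^ᴱ k) b summand))) ⟩
        coef T (Sn.sumTo b (λ i → (En.- En.1#) ^ᴱ i En.* Nn.ν ((b C suc i) ℕ.* (b C i)) En.* sliceGF ^ᴱ suc i En.* sliceGF ^ᴱ k))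
          ≈⟨ coef-sumTo T b (λ i → summand i En.* sliceGF ^ᴱ k) ⟩
        sumTo b (λ i → coef T ((En.- En.1#) ^ᴱ i En.* Nn.ν ((b C suc i) ℕ.* (b C i)) En.* sliceGF ^ᴱ suc i En.* sliceGF ^ᴱ k))
          ≈⟨ sumTo-cong b (λ i _ → term i) ⟩
        sumTo b (λ i → ν b * (g i * coef T (sliceGF ^ᴱ (suc k ℕ.+ i))))
          ≈⟨ sumTo-*ˡ (ν b) b (λ i → g i * coef T (sliceGF ^ᴱ (suc k ℕ.+ i))) ⟨
        ν b * sumTo b (λ i → g i * coef T (sliceGF ^ᴱ (suc k ℕ.+ i)))
          ≈⟨ *-congˡ (sumTo-truncate b (suc n) _ (λ i b≤i → ≈-trans (*-congʳ (g-vanishes i b≤i)) (zeroˡ _))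
               (λ i n<i → ≈-trans (*-congˡ (power-vanishes (suc k) i T n<i)) (zeroʳ _))) ⟩
        ν b * sumTo (suc n) (λ j → g j * coef T (sliceGF ^ᴱ (suc k ℕ.+ j))) ∎))
        where
        summand : ℕ → Elt n
        summand i = (En.- En.1#) ^ᴱ i En.* Nn.ν ((b C suc i) ℕ.* (b C i)) En.* sliceGF ^ᴱ suc i
        term : ∀ i → coef T ((En.- En.1#) ^ᴱ i En.* Nn.ν ((b C suc i) ℕ.* (b C i)) En.* sliceGF ^ᴱ suc i En.* sliceGF ^ᴱ k) ≈
                     ν b * (g i * coef T (sliceGF ^ᴱ (suc k ℕ.+ i)))
        term i = begin
          coef T ((En.- En.1#) ^ᴱ i En.* Nn.ν N En.* sliceGF ^ᴱ suc i En.* sliceGF ^ᴱ k)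
            ≈⟨ coef-cong T (En.trans (Iⁿ.solve 5 (λ s v r p q → s Iⁿ.:* v Iⁿ.:* (r Iⁿ.:* p) Iⁿ.:* q Iⁿ.:= s Iⁿ.:* (v Iⁿ.:* (r Iⁿ.:* (q Iⁿ.:* p)))) En.refl _ _ sliceGF (sliceGF ^ᴱ i) (sliceGF ^ᴱ k))
                 (En.*-congˡ (En.*-congˡ (En.*-congˡ (En.sym (^-homo-* sliceGF k i)))))) ⟩
          coef T ((En.- En.1#) ^ᴱ i En.* (Nn.ν N En.* sliceGF ^ᴱ (suc k ℕ.+ i)))
            ≈⟨ ≈-trans (coef-sign T i _) (*-congˡ (coef-ν T N _)) ⟩
          (- 1#) ^ i * (ν N * r)
            ≈⟨ ≈-trans (≈-sym (*-assoc _ _ _)) (*-congʳ (≈-sym (g-narayana i))) ⟩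
          ν b * g i * r
            ≈⟨ *-assoc _ _ _ ⟩
          ν b * (g i * r) ∎
          where
          N = (b C suc i) ℕ.* (b C i)
          r = coef T (sliceGF ^ᴱ (suc k ℕ.+ i))

      slices-lagrange : (w ⋆ g) S.≈ S.1# → ∀ s (T : Vec Bool n) → size T ≡ suc s → ∀ k →
        coef T (sliceGF ^ᴱ k) ≈ ν k * (ν (s ℕ.!) * (Y ^ˢ k ⋆ (ProductSeries.∏ K Q T ⋆ w ^ˢ suc s)) (suc s))
      slices-lagrange w⋆g = Lagrange.lagrange K sliceGF g w Q g₀ w⋆g sliceGF∅ (suc n) ℕₚ.≤-refl
        (λ k T → ≈-trans (g-powers k T) (vertices-powers k T))

-- Tuples of slices

idWeight : List (Fin n) → Vec ℕ n
idWeight []       = zeros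
idWeight (i ∷ is) = unit i ⊕ idWeight is

labelWeight-map : (l : List (Fin n × List (Decoration (Fin n)))) → labelWeight l ≡ idWeight (map proj₁ l)
labelWeight-map []            = refl
labelWeight-map ((i , _) ∷ l) = ≡.cong (unit i ⊕_) (labelWeight-map l)

idWeight-↭ : {is js : List (Fin n)} → is ↭ js → idWeight is ≡ idWeight js
idWeight-↭ Perm.refl         = refl
idWeight-↭ (Perm.prep i p)   = ≡.cong (unit i ⊕_) (idWeight-↭ p)
idWeight-↭ (Perm.swap i j p) = ≡.trans (≡.sym (⊕-assoc (unit i) (unit j) _)) (≡.trans
  (≡.cong₂ _⊕_ (Vecₚ.zipWith-comm ℕₚ.+-comm (unit i) (unit j)) (idWeight-↭ p)) (⊕-assoc (unit j) (unit i) _))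
idWeight-↭ (Perm.trans p q)  = ≡.trans (idWeight-↭ p) (idWeight-↭ q)

lookup-⊕ : (u v : Vec ℕ n) (i : Fin n) → Vec.lookup (u ⊕ v) i ≡ Vec.lookup u i ℕ.+ Vec.lookup v i
lookup-⊕ u v i = Vecₚ.lookup-zipWith ℕ._+_ i u v

lookup-unit : (i : Fin n) → Vec.lookup (unit i) i ≡ 1
lookup-unit zero    = refl
lookup-unit (suc i) = lookup-unit i

lookup-unit-≢ : (i j : Fin n) → i ≢ j → Vec.lookup (unit i) j ≡ 0
lookup-unit-≢ zero    zero    i≢j = contradiction refl i≢j
lookup-unit-≢ {suc n} zero    (suc j) i≢j = Vecₚ.lookup-replicate j 0
lookup-unit-≢ (suc i) zero    i≢j = refl
lookup-unit-≢ (suc i) (suc j) i≢j = lookup-unit-≢ i j (i≢j ∘ ≡.cong suc)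

idWeight-∈ : (is : List (Fin n)) (i : Fin n) → 0 ℕ.< Vec.lookup (idWeight is) i → i ∈ is
idWeight-∈ [] i p = ⊥-elim (ℕₚ.<-irrefl (≡.sym (Vecₚ.lookup-replicate i 0)) p)
idWeight-∈ (j ∷ is) i p with i Finₚ.≟ j
... | yes refl = here refl
... | no i≢j   = there (idWeight-∈ is i (≡.subst (0 ℕ.<_) (≡.trans (lookup-⊕ (unit j) _ i) (≡.cong (ℕ._+ _) (lookup-unit-≢ j i (i≢j ∘ ≡.sym)))) p))

∈-idWeight : (is : List (Fin n)) (i : Fin n) → i ∈ is → 0 ℕ.< Vec.lookup (idWeight is) i
∈-idWeight (i ∷ is) i (here refl) = ≡.subst (0 ℕ.<_) (≡.sym (≡.trans (lookup-⊕ (unit i) _ i) (≡.cong (ℕ._+ Vec.lookup (idWeight is) i) (lookup-unit i)))) (ℕ.s≤s ℕ.z≤n)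
∈-idWeight (j ∷ is) i (there i∈)  = ≡.subst (0 ℕ.<_) (≡.sym (lookup-⊕ (unit j) _ i)) (ℕₚ.<-≤-trans (∈-idWeight is i i∈) (ℕₚ.m≤n+m _ _))

⊕-cancelˡ : (u v w : Vec ℕ n) → u ⊕ v ≡ u ⊕ w → v ≡ w
⊕-cancelˡ []      []      []      e = refl
⊕-cancelˡ (x ∷ u) (y ∷ v) (z ∷ w) e = ≡.cong₂ _∷_ (ℕₚ.+-cancelˡ-≡ x y z (Vecₚ.∷-injectiveˡ e)) (⊕-cancelˡ u v w (Vecₚ.∷-injectiveʳ e))

idWeight-injective : (is js : List (Fin n)) → idWeight is ≡ idWeight js → is ↭ js
idWeight-injective [] []       e = ↭-refl
idWeight-injective [] (j ∷ js) e = ⊥-elim (ℕₚ.<-irrefl (≡.trans (≡.sym (Vecₚ.lookup-replicate j 0)) (≡.cong (λ v → Vec.lookup v j) e))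
  (∈-idWeight (j ∷ js) j (here refl)))
idWeight-injective (i ∷ is) js e with ∈-∃++ (idWeight-∈ js i (≡.subst (λ v → 0 ℕ.< Vec.lookup v i) e (∈-idWeight (i ∷ is) i (here refl))))
... | ks , ls , refl = ↭-trans (Perm.prep i (idWeight-injective is (ks ++ ls) (⊕-cancelˡ (unit i) _ _ (≡.trans e (idWeight-↭ (Permₚ.shift i ks ls))))))
                               (↭-sym (Permₚ.shift i ks ls))

full : Vec Bool n
full = Vec.replicate _ true

idWeight-allFin : ∀ n → idWeight (allFin n) ≡ ⟦ full ⟧
idWeight-allFin zero    = refl
idWeight-allFin (suc n) = ≡.trans (≡.cong (unit zero ⊕_) (≡.trans (≡.cong idWeight (≡.sym (Listₚ.map-tabulate id suc))) (shift (allFin n))))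
  (≡.cong (1 ∷_) (≡.trans (⊕-identityˡ _) (idWeight-allFin n)))
  where
  shift : (is : List (Fin n)) → idWeight (map suc is) ≡ 0 ∷ idWeight is
  shift []       = refl
  shift (i ∷ is) = ≡.cong (unit (suc i) ⊕_) (shift is)

size-full : ∀ n → size (full {n}) ≡ n
size-full zero    = refl
size-full (suc n) = ≡.cong suc (size-full n)

-- Splits the permutation into a condition at each vertex, which the grammar handles, and one on the
-- multiset of labels, which selects a monomial.
numbered⇔ : (d : Fin n → ℕ) (l : List (Fin n × List (Decoration (Fin n)))) →
  (map (λ (i , ds) → i , dualDegree ds) l ↭ tabulate (λ i → i , d i)) ⇔
  (All (λ (i , ds) → dualDegree ds ≡ d i) l × labelWeight l ≡ ⟦ full ⟧)
numbered⇔ {n} d l = mk⇔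
  (λ p → Allₚ.map⁻ (Permₚ.All-resp-↭ (↭-sym p) (Allₚ.tabulate⁺ {P = λ (i , x) → x ≡ d i} (λ i → refl))) ,
         ≡.trans (labelWeight-map l) (≡.trans (idWeight-↭ (↭-trans (↭-reflexive (Listₚ.map-∘ l))
           (↭-trans (Permₚ.map⁺ proj₁ p) (↭-reflexive (Listₚ.map-tabulate (λ i → i , d i) proj₁))))) (idWeight-allFin n)))
  (λ (as , e) → ↭-trans (↭-reflexive (degrees l as)) (↭-trans
     (Permₚ.map⁺ (λ i → i , d i) (idWeight-injective (map proj₁ l) (allFin n) (≡.trans (≡.sym (labelWeight-map l)) (≡.trans e (≡.sym (idWeight-allFin n))))))
     (↭-reflexive (Listₚ.map-tabulate id (λ i → i , d i)))))
  where
  degrees : ∀ l → All (λ (i , ds) → dualDegree ds ≡ d i) l → map (λ (i , ds) → i , dualDegree ds) l ≡ map (λ i → i , d i) (map proj₁ l)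
  degrees []            []       = refl
  degrees ((i , ds) ∷ l) (e ∷ es) = ≡.cong₂ _∷_ (≡.cong (i ,_) e) (degrees l es)

module Tuples (K : Ring₀) (torsionFree : TorsionFree K) (n b′ k : ℕ) (mᵥ : Vec ℕ (suc n)) where

  private
    m : Fin (suc n) → ℕ
    m = Vec.lookup mᵥ

  open GoodTrees b′ m
  open Counting K (suc n)
  open SubsetRing K
  open SliceSeries K torsionFree (suc n) b′ m using (counts-good) renaming (R to sliceGF)
  open E (suc n) using () renaming (_^_ to _^ᴱ_)
  private
    module K = CommutativeRing K
    module En = CommutativeRing (subsetRing K (suc n))
    module E′ = CommutativeRing (subsetRing K n)
  open Cardinality K using (Card; card-resp; card-∅)

  tupleWeight : ∀ {k} → Vec (Tree (Fin (suc n))) k → Vec ℕ (suc n)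
  tupleWeight ts = labelWeight (concatMap blossoming (Vec.toList ts))

  First : Tree (Fin (suc n)) → Set
  First u = zero ∈ map proj₁ (blossoming u)

  -- First components collect the monomials without the first variable; putting 0 there discards the
  -- trees in which the first label does not occur.
  counts-first : Counts treeWeight (λ u → Good 0 u × First u) (E′.0# , proj₂ sliceGF)
  counts-first (true ∷ S) = card-resp (λ u → mk⇔
    (λ (g , w) → (g , idWeight-∈ _ zero (≡.subst (λ v → 0 ℕ.< Vec.lookup v zero) (≡.trans (≡.sym w) (labelWeight-map (blossoming u))) (ℕ.s≤s ℕ.z≤n))) , w)
    (λ ((g , _) , w) → g , w)) K.refl (counts-good 0 (true ∷ S))
  counts-first (false ∷ S) = card-resp (λ u → mk⇔ ⊥-elim
    (λ ((_ , z) , w) → ℕₚ.<-irrefl (≡.sym (≡.cong (λ v → Vec.lookup v zero) (≡.trans (≡.sym (labelWeight-map (blossoming u))) w))) (∈-idWeight _ zero z)))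
    (K.sym (coef-0 S)) (card-∅ (λ _ z → z))

  counts-tuple : ∀ k → Counts (tupleWeight {k}) (λ ts → All (Good 0) (Vec.toList ts)) (sliceGF ^ᴱ k)
  counts-tuple zero = counts-resp (λ { [] → mk⇔ (λ _ → []) (λ _ → refl) }) En.refl (counts-singleton [] refl)
  counts-tuple (suc k) = counts-resp
    (λ { (u ∷ ts) → mk⇔ (λ { (_ , (g , gs) , refl) → g ∷ gs }) (λ { (g ∷ gs) → _ , (g , gs) , refl }) })
    En.refl (counts-map (λ (u , ts) → u ∷ ts) (λ { refl → refl }) (λ (u , ts) → labelWeight-++ (blossoming u) _)
      (counts-× (counts-good 0) (counts-tuple k)))

  counts-firstTuple : Counts (tupleWeight {suc k}) (λ ts → All (Good 0) (Vec.toList ts) × First (Vec.head ts)) ((E′.0# , proj₂ sliceGF) En.* sliceGF ^ᴱ k)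
  counts-firstTuple = counts-resp
    (λ { (u ∷ ts) → mk⇔ (λ { (_ , ((g , z) , gs) , refl) → g ∷ gs , z }) (λ { (g ∷ gs , z) → _ , ((g , z) , gs) , refl }) })
    En.refl (counts-map (λ (u , ts) → u ∷ ts) (λ { refl → refl }) (λ (u , ts) → labelWeight-++ (blossoming u) _)
      (counts-× counts-first (counts-tuple k)))

  concat-All : ∀ {P : Fin (suc n) × List (Decoration (Fin (suc n))) → Set} us →
    All (All P ∘ blossoming) us ⇔ All P (concatMap blossoming us)
  concat-All us = mk⇔ (Allₚ.concat⁺ ∘ Allₚ.map⁺) (Allₚ.map⁻ ∘ Allₚ.concat⁻)

  admissible⇔ : ∀ ts → ((All (Good 0) (Vec.toList ts) × First (Vec.head ts)) × tupleWeight ts ≡ ⟦ full ⟧) ⇔ Admissible b k mᵥ ts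
  admissible⇔ ts = mk⇔
    (λ ((gs , z) , w) → record
      { slices   = All.map (λ (s , d , v) → d , s , All.map proj₁ v) gs
      ; numbered = from (numbered⇔ _ _) (to (concat-All _) (All.map (λ (_ , _ , v) → All.map proj₂ v) gs) , w)
      ; first    = z })
    (λ a → let open Admissible a
               as , w = to (numbered⇔ (λ i → 2 ℕ.* m i) _) numbered
           in (All.zipWith (λ ((d , s , t) , v) → s , d , All.zipWith id (t , v)) (slices , from (concat-All _) as) , first) , w)

  card-admissible : Card (Admissible b k mᵥ) (coef (full {n}) (proj₂ sliceGF E′.* proj₁ (sliceGF ^ᴱ k)))
  card-admissible = card-resp admissible⇔ (coef-cong (full {n}) (E′.trans (E′.+-congʳ (E′.zeroˡ _)) (E′.+-identityˡ _))) (counts-firstTuple full)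

  module _ (g w : ℕ → K.Carrier) (Q : Fin (suc n) → ℕ → K.Carrier) where
    open SeriesCalculus K
    open Cancellation K torsionFree
    open ProductSeries K using (∏)
    open SubsetRing.E K n using () renaming (_^_ to _^′_)
    open Algebra.Properties.Semiring.Exp K.semiring using (_^_)
    open import Relation.Binary.Reasoning.Setoid K.setoid

    module _ (b≤m : ∀ i → b ℕ.≤ m i)
      (Q-labeled : ∀ i → b ℕ.< m i → ∀ j → Q i j K.≈ ν (((m i ℕ.+ b) C j) ℕ.* ((m i ∸ suc b ℕ.+ j) C j)))
      (Q-special : ∀ i → m i ≡ b → ∀ j → Q i j K.≈ S.1# j)
      (g-narayana : ∀ i → ν b K.* g i K.≈ (K.- K.1#) ^ i K.* ν ((b C suc i) ℕ.* (b C i)))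
      (w⋆g : (w ⋆ g) S.≈ S.1#) where

      first-sliceGF : coef (full {n}) (proj₂ sliceGF E′.* proj₁ (sliceGF ^ᴱ k)) K.≈ ν (n ℕ.!) K.* (Y ^ˢ k ⋆ (∏ Q full ⋆ w ^ˢ suc n)) n
      first-sliceGF = ν-cancelˡ k _ _ (begin
        ν (suc k) K.* coef (full {n}) (proj₂ sliceGF E′.* proj₁ (sliceGF ^ᴱ k))
          ≈⟨ K.*-congˡ (coef-cong (full {n}) (E′.*-congˡ (Dual.proj₁-^ (subsetRing K n) (proj₁ sliceGF) (proj₂ sliceGF) k))) ⟩
        ν (suc k) K.* coef (full {n}) (proj₂ sliceGF E′.* proj₁ sliceGF ^′ k)
          ≈⟨ coef-ν (full {n}) (suc k) _ ⟨
        coef (full {n}) (Naturals.ν (subsetRing K n) (suc k) E′.* (proj₂ sliceGF E′.* proj₁ sliceGF ^′ k))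
          ≈⟨ coef-cong (full {n}) (proj₂ (Dual.^-dual (subsetRing K n) (proj₁ sliceGF) (proj₂ sliceGF) k)) ⟨
        coef (full {suc n}) (sliceGF ^ᴱ suc k)
          ≈⟨ SliceLagrange.slices-lagrange K torsionFree (suc n) b′ m g w Q b≤m Q-labeled Q-special g-narayana w⋆g n full (size-full (suc n)) (suc k) ⟩
        ν (suc k) K.* (ν (n ℕ.!) K.* (Y ^ˢ suc k ⋆ (∏ Q full ⋆ w ^ˢ suc n)) (suc n))
          ≈⟨ K.*-congˡ (K.*-congˡ (K.trans (⋆-assoc Y (Y ^ˢ k) _ (suc n)) (Y⋆-suc _ n))) ⟩
        ν (suc k) K.* (ν (n ℕ.!) K.* (Y ^ˢ k ⋆ (∏ Q full ⋆ w ^ˢ suc n)) n) ∎)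

      card-formula : Card (Admissible b k mᵥ) (ν (n ℕ.!) K.* (Y ^ˢ k ⋆ (∏ Q full ⋆ w ^ˢ suc n)) n)
      card-formula = card-resp (λ _ → mk⇔ id id) first-sliceGF card-admissible

open import Data.Nat.Base using (_≤_; _<_)
open ≡ using (cong; cong₂; sym; trans)
open ≡.≡-Reasoning

-- The base ring ℚ

ℚ-ring : Ring₀
ℚ-ring = ℚₚ.+-*-commutativeRing

toℚᵘ-/ : ∀ a m → toℚᵘ (a / suc m) ℚᵘ.≃ mkℚᵘ a m
toℚᵘ-/ a m = ℚₚ.toℚᵘ-fromℚᵘ (mkℚᵘ a m)

/-cross : ∀ a c m n .{{_ : NonZero m}} .{{_ : NonZero n}} → a ℤ.* + n ≡ c ℤ.* + m → a / m ≡ c / n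
/-cross a c (suc m) (suc n) e = ℚₚ.fromℚᵘ-cong {mkℚᵘ a m} {mkℚᵘ c n} (*≡* e)

/-* : ∀ a c m n .{{_ : NonZero m}} .{{_ : NonZero n}} → let instance _ = ℕₚ.m*n≢0 m n in
      (a / m) ℚ.* (c / n) ≡ (a ℤ.* c) / (m ℕ.* n)
/-* a c (suc m) (suc n) = ℚₚ.toℚᵘ-injective (ℚᵘₚ.≃-trans (ℚₚ.toℚᵘ-homo-* (a / suc m) (c / suc n))
  (ℚᵘₚ.≃-trans (ℚᵘₚ.*-cong (toℚᵘ-/ a m) (toℚᵘ-/ c n)) (ℚᵘₚ.≃-sym (toℚᵘ-/ (a ℤ.* c) (n ℕ.+ m ℕ.* suc n)))))

/1-+ : ∀ a c → (a / 1) ℚ.+ (c / 1) ≡ (a ℤ.+ c) / 1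
/1-+ a c = ℚₚ.toℚᵘ-injective (ℚᵘₚ.≃-trans (ℚₚ.toℚᵘ-homo-+ (a / 1) (c / 1))
  (ℚᵘₚ.≃-trans (ℚᵘₚ.+-cong (toℚᵘ-/ a 0) (toℚᵘ-/ c 0)) (ℚᵘₚ.≃-trans (*≡* (eq a c)) (ℚᵘₚ.≃-sym (toℚᵘ-/ (a ℤ.+ c) 0)))))
  where
  eq : ∀ a c → (a ℤ.* + 1 ℤ.+ c ℤ.* + 1) ℤ.* + 1 ≡ (a ℤ.+ c) ℤ.* + 1
  eq = ℤ-Solver.solve-∀

/1-* : ∀ a c → (a / 1) ℚ.* (c / 1) ≡ (a ℤ.* c) / 1
/1-* a c = /-* a c 1 1

open Naturals ℚ-ring using (ν)

ν≡/1 : ∀ n → ν n ≡ + n / 1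
ν≡/1 zero    = refl
ν≡/1 (suc n) = trans (cong (1ℚ ℚ.+_) (ν≡/1 n)) (/1-+ (+ 1) (+ n))

/1-cancel : ∀ z b .{{_ : NonZero b}} → (+ b / 1) ℚ.* (z / b) ≡ z / 1
/1-cancel z b@(suc _) = trans (/-* (+ b) z 1 b) (/-cross (+ b ℤ.* z) z (1 ℕ.* b) 1 (trans (eq (+ b) z) (cong (λ k → z ℤ.* + k) (sym (ℕₚ.*-identityˡ b)))))
  where
  eq : ∀ b z → b ℤ.* z ℤ.* + 1 ≡ z ℤ.* b
  eq = ℤ-Solver.solve-∀

ℚ-torsionFree : TorsionFree ℚ-ring
ℚ-torsionFree n x e = begin
  x                                               ≡⟨ ℚₚ.*-identityˡ x ⟨
  1ℚ ℚ.* x                                        ≡⟨ cong (ℚ._* x) (/1-cancel (+ 1) (suc n)) ⟨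
  (+ suc n / 1) ℚ.* (+ 1 / suc n) ℚ.* x           ≡⟨ cong (ℚ._* x) (ℚₚ.*-comm (+ suc n / 1) (+ 1 / suc n)) ⟩
  (+ 1 / suc n) ℚ.* (+ suc n / 1) ℚ.* x           ≡⟨ ℚₚ.*-assoc (+ 1 / suc n) (+ suc n / 1) x ⟩
  (+ 1 / suc n) ℚ.* ((+ suc n / 1) ℚ.* x)         ≡⟨ cong (λ y → (+ 1 / suc n) ℚ.* (y ℚ.* x)) (ν≡/1 (suc n)) ⟨
  (+ 1 / suc n) ℚ.* (ν (suc n) ℚ.* x)             ≡⟨ cong ((+ 1 / suc n) ℚ.*_) e ⟩
  (+ 1 / suc n) ℚ.* 0ℚ                            ≡⟨ ℚₚ.*-zeroʳ (+ 1 / suc n) ⟩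
  0ℚ                                              ∎

Πℤ-cong : ∀ k {f g : ℕ → ℤ} → (∀ i → f i ≡ g i) → Πℤ< k f ≡ Πℤ< k g
Πℤ-cong zero    p = refl
Πℤ-cong (suc k) p = cong₂ ℤ._*_ (p 0) (Πℤ-cong k (λ i → p (suc i)))

Πℤ-last : ∀ k (f : ℕ → ℤ) → Πℤ< (suc k) f ≡ Πℤ< k f ℤ.* f k
Πℤ-last zero    f = ℤₚ.*-comm (f 0) (+ 1)
Πℤ-last (suc k) f = trans (cong (f 0 ℤ.*_) (Πℤ-last k (f ∘ suc))) (sym (ℤₚ.*-assoc (f 0) _ _))

Πℤ-* : ∀ k (f g : ℕ → ℤ) → Πℤ< k f ℤ.* Πℤ< k g ≡ Πℤ< k (λ i → f i ℤ.* g i)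
Πℤ-* zero    f g = refl
Πℤ-* (suc k) f g = trans (eq (f 0) _ (g 0) _) (cong (f 0 ℤ.* g 0 ℤ.*_) (Πℤ-* k (f ∘ suc) (g ∘ suc)))
  where
  eq : ∀ a x b y → a ℤ.* x ℤ.* (b ℤ.* y) ≡ a ℤ.* b ℤ.* (x ℤ.* y)
  eq = ℤ-Solver.solve-∀

Πℤ-reverse : ∀ k c → Πℤ< k (λ i → c ℤ.+ + k ℤ.- + i) ≡ Πℤ< k (λ i → c ℤ.+ + 1 ℤ.+ + i)
Πℤ-reverse zero    c = refl
Πℤ-reverse (suc k) c = begin
  (c ℤ.+ + suc k ℤ.- + 0) ℤ.* Πℤ< k (λ i → c ℤ.+ + suc k ℤ.- + suc i)
    ≡⟨ cong₂ ℤ._*_ (eq₀ c (+ k)) (Πℤ-cong k (λ i → eq₁ c (+ k) (+ i))) ⟩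
  (c ℤ.+ + 1 ℤ.+ + k) ℤ.* Πℤ< k (λ i → c ℤ.+ + k ℤ.- + i)
    ≡⟨ cong ((c ℤ.+ + 1 ℤ.+ + k) ℤ.*_) (Πℤ-reverse k c) ⟩
  (c ℤ.+ + 1 ℤ.+ + k) ℤ.* Πℤ< k (λ i → c ℤ.+ + 1 ℤ.+ + i)
    ≡⟨ ℤₚ.*-comm (c ℤ.+ + 1 ℤ.+ + k) _ ⟩
  Πℤ< k (λ i → c ℤ.+ + 1 ℤ.+ + i) ℤ.* (c ℤ.+ + 1 ℤ.+ + k)
    ≡⟨ Πℤ-last k (λ i → c ℤ.+ + 1 ℤ.+ + i) ⟨
  Πℤ< (suc k) (λ i → c ℤ.+ + 1 ℤ.+ + i) ∎
  where
  eq₀ : ∀ c k → c ℤ.+ (+ 1 ℤ.+ k) ℤ.- + 0 ≡ c ℤ.+ + 1 ℤ.+ k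
  eq₀ = ℤ-Solver.solve-∀
  eq₁ : ∀ c k i → c ℤ.+ (+ 1 ℤ.+ k) ℤ.- (+ 1 ℤ.+ i) ≡ c ℤ.+ k ℤ.- i
  eq₁ = ℤ-Solver.solve-∀

-- Once the second product is reversed, the i-th factors are x + (b - i) and x - (b - i).
q≡qProduct : ∀ b k x → q b k x ≡ qProduct b k x
q≡qProduct b k x = trans (/-* (Πℤ< k λ i → x ℤ.+ + b ℤ.- + i) (Πℤ< k λ i → x ℤ.- + b ℤ.- + 1 ℤ.+ + k ℤ.- + i) (k !) (k !) {{k !≢0}} {{k !≢0}}) (ℚₚ./-cong {q₁ = k ! ℕ.* k !} {q₂ = k ! ℕ.* k !} {{ℕₚ.m*n≢0 (k !) (k !) {{k !≢0}} {{k !≢0}}}} {{k !* k !≢0}} products refl)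
  where
  open ℕₚ using (_!≢0; _!*_!≢0)
  eq₁ : ∀ x b i → x ℤ.- b ℤ.- + 1 ℤ.+ + 1 ℤ.+ i ≡ x ℤ.- b ℤ.+ i
  eq₁ = ℤ-Solver.solve-∀
  eq₂ : ∀ x b i → (x ℤ.+ b ℤ.- i) ℤ.* (x ℤ.- b ℤ.- + 1 ℤ.+ + 1 ℤ.+ i) ≡ x ℤ.* x ℤ.- (b ℤ.- i) ℤ.* (b ℤ.- i)
  eq₂ = ℤ-Solver.solve-∀
  products : Πℤ< k (λ i → x ℤ.+ + b ℤ.- + i) ℤ.* Πℤ< k (λ i → x ℤ.- + b ℤ.- + 1 ℤ.+ + k ℤ.- + i) ≡
             Πℤ< k (λ i → x ℤ.* x ℤ.- (+ b ℤ.- + i) ℤ.* (+ b ℤ.- + i))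
  products = begin
    Πℤ< k (λ i → x ℤ.+ + b ℤ.- + i) ℤ.* Πℤ< k (λ i → x ℤ.- + b ℤ.- + 1 ℤ.+ + k ℤ.- + i)
      ≡⟨ cong (Πℤ< k (λ i → x ℤ.+ + b ℤ.- + i) ℤ.*_) (Πℤ-reverse k (x ℤ.- + b ℤ.- + 1)) ⟩
    Πℤ< k (λ i → x ℤ.+ + b ℤ.- + i) ℤ.* Πℤ< k (λ i → x ℤ.- + b ℤ.- + 1 ℤ.+ + 1 ℤ.+ + i)
      ≡⟨ Πℤ-* k _ _ ⟩
    Πℤ< k (λ i → (x ℤ.+ + b ℤ.- + i) ℤ.* (x ℤ.- + b ℤ.- + 1 ℤ.+ + 1 ℤ.+ + i))
      ≡⟨ Πℤ-cong k (λ i → eq₂ x (+ b) (+ i)) ⟩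
    Πℤ< k (λ i → x ℤ.* x ℤ.- (+ b ℤ.- + i) ℤ.* (+ b ℤ.- + i)) ∎

absorption : ∀ n k → suc k ℕ.* (suc n C suc k) ≡ suc n ℕ.* (n C k)
absorption n zero = trans (ℕₚ.*-identityˡ (suc n C 1)) (trans (nC1≡n (suc n)) (sym (ℕₚ.*-identityʳ (suc n))))
absorption zero (suc k) = trans (cong (suc (suc k) ℕ.*_) (k>n⇒nCk≡0 {1} {suc (suc k)} (ℕ.s≤s (ℕ.s≤s ℕ.z≤n)))) (trans (ℕₚ.*-zeroʳ (suc (suc k))) (sym (cong (1 ℕ.*_) (k>n⇒nCk≡0 {0} {suc k} (ℕ.s≤s ℕ.z≤n)))))
absorption (suc n) (suc k) = begin
  suc (suc k) ℕ.* (suc (suc n) C suc (suc k))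
    ≡⟨ cong (suc (suc k) ℕ.*_) (nCk+nC[k+1]≡[n+1]C[k+1] (suc n) (suc k)) ⟨
  suc (suc k) ℕ.* (x ℕ.+ (suc n C suc (suc k)))
    ≡⟨ split k x (suc n C suc (suc k)) ⟩
  x ℕ.+ (suc k ℕ.* x ℕ.+ suc (suc k) ℕ.* (suc n C suc (suc k)))
    ≡⟨ cong (x ℕ.+_) (cong₂ ℕ._+_ (absorption n k) (absorption n (suc k))) ⟩
  x ℕ.+ (suc n ℕ.* (n C k) ℕ.+ suc n ℕ.* (n C suc k))
    ≡⟨ cong (x ℕ.+_) (trans (sym (ℕₚ.*-distribˡ-+ (suc n) (n C k) (n C suc k))) (cong (suc n ℕ.*_) (nCk+nC[k+1]≡[n+1]C[k+1] n k))) ⟩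
  suc (suc n) ℕ.* x ∎
  where
  x = suc n C suc k
  split : ∀ k x y → suc (suc k) ℕ.* (x ℕ.+ y) ≡ x ℕ.+ (suc k ℕ.* x ℕ.+ suc (suc k) ℕ.* y)
  split = ℕ-Solver.solve-∀

fallingFactorial : ∀ n k → Πℤ< k (λ i → + n ℤ.- + i) ≡ + (k ! ℕ.* (n C k))
fallingFactorial n zero = refl
fallingFactorial zero (suc k) = cong +_ (sym (trans (cong (suc k ! ℕ.*_) (k>n⇒nCk≡0 {0} {suc k} (ℕ.s≤s ℕ.z≤n))) (ℕₚ.*-zeroʳ (suc k !))))
fallingFactorial (suc n) (suc k) = begin
  (+ suc n ℤ.- + 0) ℤ.* Πℤ< k (λ i → + suc n ℤ.- + suc i)
    ≡⟨ cong₂ ℤ._*_ (ℤₚ.+-identityʳ (+ suc n)) (trans (Πℤ-cong k (λ i → eq (+ n) (+ i))) (fallingFactorial n k)) ⟩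
  + suc n ℤ.* + (k ! ℕ.* (n C k))
    ≡⟨ ℤₚ.pos-* (suc n) (k ! ℕ.* (n C k)) ⟨
  + (suc n ℕ.* (k ! ℕ.* (n C k)))
    ≡⟨ cong +_ (trans (swap (suc n) (k !) (n C k)) (trans (cong (k ! ℕ.*_) (sym (absorption n k))) (assoc (k !) (suc k) (suc n C suc k)))) ⟩
  + (suc k ! ℕ.* (suc n C suc k)) ∎
  where
  eq : ∀ n i → (+ 1 ℤ.+ n) ℤ.- (+ 1 ℤ.+ i) ≡ n ℤ.- i
  eq = ℤ-Solver.solve-∀
  swap : ∀ x y z → x ℕ.* (y ℕ.* z) ≡ y ℕ.* (x ℕ.* z)
  swap = ℕ-Solver.solve-∀
  assoc : ∀ x y z → x ℕ.* (y ℕ.* z) ≡ y ℕ.* x ℕ.* z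
  assoc = ℕ-Solver.solve-∀

binom-ℕ : ∀ n k → binom (+ n) k ≡ ν (n C k)
binom-ℕ n k = trans (/-cross (Πℤ< k λ i → + n ℤ.- + i) (+ (n C k)) (k !) 1 {{k !≢0}} (trans (ℤₚ.*-identityʳ _) (trans (fallingFactorial n k)
  (trans (cong +_ (ℕₚ.*-comm (k !) (n C k))) (ℤₚ.pos-* (n C k) (k !)))))) (sym (ν≡/1 (n C k)))
  where open ℕₚ using (_!≢0)

q-labeled : ∀ b m k → b ℕ.< m → q b k (+ m) ≡ ν (((m ℕ.+ b) C k) ℕ.* ((m ∸ suc b ℕ.+ k) C k))
q-labeled b m k b<m = trans (cong₂ ℚ._*_ (binom-ℕ (m ℕ.+ b) k) (trans (cong (λ z → binom z k) upper) (binom-ℕ (m ∸ suc b ℕ.+ k) k)))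
  (sym (Naturals.ν-* ℚ-ring ((m ℕ.+ b) C k) ((m ∸ suc b ℕ.+ k) C k)))
  where
  eq : ∀ b t k → (+ 1 ℤ.+ b ℤ.+ t) ℤ.- b ℤ.- + 1 ℤ.+ k ≡ t ℤ.+ k
  eq = ℤ-Solver.solve-∀
  upper : + m ℤ.- + b ℤ.- + 1 ℤ.+ + k ≡ + (m ∸ suc b ℕ.+ k)
  upper = trans (cong (λ m → + m ℤ.- + b ℤ.- + 1 ℤ.+ + k) (sym (ℕₚ.m+[n∸m]≡n b<m))) (eq (+ b) (+ (m ∸ suc b)) (+ k))

-- At m = b the second binomial has upper argument k - 1, so it vanishes for k > 0 and is 1 for k =
-- 0. This agrees with a special vertex having no attaching point.
q-special : ∀ b k → q b k (+ b) ≡ 1ₛ k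
q-special b zero    = refl
q-special b (suc k) = begin
  binom (+ b ℤ.+ + b) (suc k) ℚ.* binom (+ b ℤ.- + b ℤ.- + 1 ℤ.+ + suc k) (suc k)
    ≡⟨ cong (binom (+ b ℤ.+ + b) (suc k) ℚ.*_) (begin
         binom (+ b ℤ.- + b ℤ.- + 1 ℤ.+ + suc k) (suc k)   ≡⟨ cong (λ z → binom z (suc k)) (eq (+ b) (+ k)) ⟩
         binom (+ k) (suc k)                               ≡⟨ binom-ℕ k (suc k) ⟩
         ν (k C suc k)                                     ≡⟨ cong ν (k>n⇒nCk≡0 (ℕₚ.n<1+n k)) ⟩
         0ℚ                                                ∎) ⟩
  binom (+ b ℤ.+ + b) (suc k) ℚ.* 0ℚ
    ≡⟨ ℚₚ.*-zeroʳ (binom (+ b ℤ.+ + b) (suc k)) ⟩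
  0ℚ ∎
  where
  eq : ∀ b k → b ℤ.- b ℤ.- + 1 ℤ.+ (+ 1 ℤ.+ k) ≡ k
  eq = ℤ-Solver.solve-∀

-- The formula of the statement as a coefficient of a product of series.

module SeriesLemmas (K : Ring₀) where
  open CommutativeRing K renaming (sym to ≈-sym; trans to ≈-trans) hiding (zero; refl)
  open SeriesCalculus K
  open Algebra.Properties.Semiring.Exp S.semiring using (^-homo-*; ^-congˡ)
  open Algebra.Properties.CommutativeSemiring.Exp S.commutativeSemiring using (^-distrib-*)
  private module J = IntegerSolver K[[u]]

  ⋆-expand-shifted : ∀ B k f P d → d < B → sumTo B (λ j → f j * (Y ^ˢ (k ℕ.+ j) ⋆ P) d) ≈ (Y ^ˢ k ⋆ (f ⋆ P)) d
  ⋆-expand-shifted B k f P d d<B = ≈-trans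
    (sumTo-cong B (λ j _ → *-congˡ (S.trans (S.*-congʳ {P} (^-homo-* Y k j))
      (J.solve 3 (λ x y p → (x J.:* y) J.:* p J.:= y J.:* (x J.:* p)) S.refl (Y ^ˢ k) (Y ^ˢ j) P) d)))
    (≈-trans (⋆-expand B f (Y ^ˢ k ⋆ P) d d<B)
      (J.solve 3 (λ f x p → f J.:* (x J.:* p) J.:= x J.:* (f J.:* p)) S.refl f (Y ^ˢ k) P d))

  inverse-unique : ∀ f x y → f ⋆ x S.≈ S.1# → f ⋆ y S.≈ S.1# → x S.≈ y
  inverse-unique f x y p q = S.trans (S.sym (S.trans (S.*-congˡ {x} q) (S.*-identityʳ x)))
    (S.trans (J.solve 3 (λ f x y → x J.:* (f J.:* y) J.:= (f J.:* x) J.:* y) S.refl f x y) (S.trans (S.*-congʳ {y} p) (S.*-identityˡ y)))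

  ^-inverse : ∀ f x → f ⋆ x S.≈ S.1# → ∀ k → f ^ˢ k ⋆ x ^ˢ k S.≈ S.1#
  ^-inverse f x p k = S.trans (S.sym (^-distrib-* f x k)) (S.trans (^-congˡ k p) (1^ k))
    where
    1^ : ∀ k → S.1# ^ˢ k S.≈ S.1#
    1^ zero    = S.refl
    1^ (suc k) = S.trans (S.*-identityˡ (S.1# ^ˢ k)) (1^ k)

open SeriesCalculus ℚ-ring using (_⋆_; ⋆-cong; Y; Y⋆-suc; Y⋆-zero; ⋆-assoc; ⋆-constˡ; sumTo; sumTo-*ˡ; sumTo-cong; _^ˢ_; const; module S)
open SeriesLemmas ℚ-ring
open ProductSeries ℚ-ring using (∏)
open Algebra.Properties.Semiring.Exp (CommutativeRing.semiring ℚ-ring) using (_^_)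

Σ<≡sumTo : ∀ n f → Σ< n f ≡ sumTo n f
Σ<≡sumTo zero    f = refl
Σ<≡sumTo (suc n) f = cong (f 0 ℚ.+_) (Σ<≡sumTo n (f ∘ suc))

·≡⋆ : ∀ f g d → (f · g) d ≡ (f ⋆ g) d
·≡⋆ f g zero    = ℚₚ.+-identityʳ (f 0 ℚ.* g 0)
·≡⋆ f g (suc d) = cong (f 0 ℚ.* g (suc d) ℚ.+_) (·≡⋆ (f ∘ suc) g d)

1ₛ≡ : ∀ d → 1ₛ d ≡ const 1ℚ d
1ₛ≡ zero    = refl
1ₛ≡ (suc d) = refl

^ₛ≡^ˢ : ∀ f n d → (f ^ₛ n) d ≡ (f ^ˢ n) d
^ₛ≡^ˢ f zero    d = 1ₛ≡ d
^ₛ≡^ˢ f (suc n) d = trans (·≡⋆ f (f ^ₛ n) d) (⋆-cong {f} {f} (λ _ → refl) (^ₛ≡^ˢ f n) d)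

⋆-recip : ∀ f → f 0 ≡ 1ℚ → ∀ d → (f ⋆ recip f) d ≡ const 1ℚ d
⋆-recip f f₀ d = trans (sym (·≡⋆ f (recip f) d)) (trans (·-recip f f₀ d) (1ₛ≡ d))

recip-^ : ∀ f → f 0 ≡ 1ℚ → ∀ n d → recip (f ^ₛ n) d ≡ (recip f ^ˢ n) d
recip-^ f f₀ n = inverse-unique (f ^ₛ n) (recip (f ^ₛ n)) (recip f ^ˢ n) (⋆-recip (f ^ₛ n) (^ₛ-const f f₀ n))
  (λ d → trans (⋆-cong {f ^ₛ n} {f ^ˢ n} (^ₛ≡^ˢ f n) (λ _ → refl) d) (^-inverse f (recip f) (⋆-recip f f₀) n d))

-- Multiplication by Y^k pushes coefficients up and fills with zeros, which reproduces the
-- convention for negative exponents.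
[u^]-shift : ∀ k n h → [u^ n ⊖ k ] h ≡ (Y ^ˢ k ⋆ h) n
[u^]-shift zero    n       h = sym (trans (⋆-constˡ 1ℚ h n) (ℚₚ.*-identityˡ (h n)))
[u^]-shift (suc k) zero    h = sym (trans (⋆-assoc Y (Y ^ˢ k) h 0) (Y⋆-zero (Y ^ˢ k ⋆ h)))
[u^]-shift (suc k) (suc n) h = begin
  [u^ suc n ⊖ suc k ] h             ≡⟨ cong (λ z → [u^ z ] h) (ℤₚ.[1+m]⊖[1+n]≡m⊖n n k) ⟩
  [u^ n ⊖ k ] h                     ≡⟨ [u^]-shift k n h ⟩
  (Y ^ˢ k ⋆ h) n                    ≡⟨ Y⋆-suc (Y ^ˢ k ⋆ h) n ⟨
  (Y ⋆ (Y ^ˢ k ⋆ h)) (suc n)        ≡⟨ ⋆-assoc Y (Y ^ˢ k) h (suc n) ⟨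
  (Y ^ˢ suc k ⋆ h) (suc n)          ∎

vertexSeries : ∀ {l} → ℕ → Vec ℕ l → Fin l → ℕ → ℚ
vertexSeries b m i j = q b j (+ lookup m i)

-- Peeling off one kᵢ at a time multiplies the series by one factor of `∏`. As n < B, the terms
-- beyond the bound only have degrees above n.
ΣVec-∏ : ∀ b l (m : Vec ℕ l) B k n h → n < B →
  ΣVec< l B (λ ks → Vec.foldr′ ℚ._*_ 1ℚ (Vec.zipWith (λ kᵢ mᵢ → q b kᵢ (+ mᵢ)) ks m) ℚ.* [u^ n ⊖ (k ℕ.+ Vec.sum ks) ] h)
  ≡ (Y ^ˢ k ⋆ (∏ (vertexSeries b m) full ⋆ h)) n
ΣVec-∏ b zero [] B k n h n<B = begin
  1ℚ ℚ.* [u^ n ⊖ (k ℕ.+ 0) ] h         ≡⟨ ℚₚ.*-identityˡ ([u^ n ⊖ (k ℕ.+ 0) ] h) ⟩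
  [u^ n ⊖ (k ℕ.+ 0) ] h                ≡⟨ cong (λ k → [u^ n ⊖ k ] h) (ℕₚ.+-identityʳ k) ⟩
  [u^ n ⊖ k ] h                        ≡⟨ [u^]-shift k n h ⟩
  (Y ^ˢ k ⋆ h) n                       ≡⟨ S.*-congˡ {Y ^ˢ k} {S.1# ⋆ h} {h} (S.*-identityˡ h) n ⟨
  (Y ^ˢ k ⋆ (S.1# ⋆ h)) n              ∎
ΣVec-∏ b (suc l) (x ∷ m) B k n h n<B = begin
  Σ< B (λ j → ΣVec< l B (λ ks → (q b j (+ x) ℚ.* Q ks) ℚ.* U (k ℕ.+ (j ℕ.+ Vec.sum ks))))
    ≡⟨ Σ<≡sumTo B _ ⟩
  sumTo B (λ j → ΣVec< l B (λ ks → (q b j (+ x) ℚ.* Q ks) ℚ.* U (k ℕ.+ (j ℕ.+ Vec.sum ks))))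
    ≡⟨ sumTo-cong B (λ j _ → trans (ΣVec-cong l B (λ ks → trans (ℚₚ.*-assoc (q b j (+ x)) (Q ks) _)
         (cong (λ k → q b j (+ x) ℚ.* (Q ks ℚ.* U k)) (sym (ℕₚ.+-assoc k j (Vec.sum ks)))))) (ΣVec-*ˡ l B (q b j (+ x)) _)) ⟩
  sumTo B (λ j → q b j (+ x) ℚ.* ΣVec< l B (λ ks → Q ks ℚ.* U (k ℕ.+ j ℕ.+ Vec.sum ks)))
    ≡⟨ sumTo-cong B (λ j _ → cong (q b j (+ x) ℚ.*_) (ΣVec-∏ b l m B (k ℕ.+ j) n h n<B)) ⟩
  sumTo B (λ j → q b j (+ x) ℚ.* (Y ^ˢ (k ℕ.+ j) ⋆ (P ⋆ h)) n)
    ≡⟨ ⋆-expand-shifted B k (λ j → q b j (+ x)) (P ⋆ h) n n<B ⟩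
  (Y ^ˢ k ⋆ ((λ j → q b j (+ x)) ⋆ (P ⋆ h))) n
    ≡⟨ S.*-congˡ {Y ^ˢ k} (⋆-assoc (λ j → q b j (+ x)) P h) n ⟨
  (Y ^ˢ k ⋆ (∏ (vertexSeries b (x ∷ m)) full ⋆ h)) n ∎
  where
  Q : Vec ℕ l → ℚ
  Q ks = Vec.foldr′ ℚ._*_ 1ℚ (Vec.zipWith (λ kᵢ mᵢ → q b kᵢ (+ mᵢ)) ks m)
  U : ℕ → ℚ
  U k = [u^ n ⊖ k ] h
  P : ℕ → ℚ
  P = ∏ (vertexSeries b m) full
  ΣVec-cong : ∀ l B {F G : Vec ℕ l → ℚ} → (∀ ks → F ks ≡ G ks) → ΣVec< l B F ≡ ΣVec< l B G
  ΣVec-cong zero    B p = p []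
  ΣVec-cong (suc l) B p = trans (Σ<≡sumTo B _) (trans (sumTo-cong B (λ j _ → ΣVec-cong l B (λ ks → p (j ∷ ks)))) (sym (Σ<≡sumTo B _)))
  ΣVec-*ˡ : ∀ l B c (F : Vec ℕ l → ℚ) → ΣVec< l B (λ ks → c ℚ.* F ks) ≡ c ℚ.* ΣVec< l B F
  ΣVec-*ˡ zero    B c F = refl
  ΣVec-*ˡ (suc l) B c F = trans (Σ<≡sumTo B _) (trans (sumTo-cong B (λ j _ → ΣVec-*ˡ l B c (λ ks → F (j ∷ ks))))
    (trans (sym (sumTo-*ˡ c B _)) (cong (c ℚ.*_) (sym (Σ<≡sumTo B _)))))

sign≡ : ∀ d → (ℚ.- 1ℚ) ^ d ≡ sign d / 1
sign≡ zero    = refl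
sign≡ (suc d) = trans (cong ((ℚ.- 1ℚ) ℚ.*_) (sign≡ d)) (/1-* -1ℤ (sign d))

module _ (b′ : ℕ) where
  private
    b : ℕ
    b = suc b′

  -- With i = j - 1, the constant term 1 is the term j = 1 of the same sum, since C(b,1) C(b,0) = b,
  -- and the minus sign before u is one more factor -1.
  g-narayana : ∀ i → ν b ℚ.* 1-u·innerSum b i ≡ (ℚ.- 1ℚ) ^ i ℚ.* ν ((b C suc i) ℕ.* (b C i))
  g-narayana zero = begin
    ν b ℚ.* 1ℚ                         ≡⟨ ℚₚ.*-comm (ν b) 1ℚ ⟩
    1ℚ ℚ.* ν b                         ≡⟨ cong (λ x → 1ℚ ℚ.* ν x) (trans (ℕₚ.*-identityʳ (b C 1)) (nC1≡n b)) ⟨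
    1ℚ ℚ.* ν ((b C 1) ℕ.* (b C 0))     ∎
  g-narayana (suc d) = begin
    ν b ℚ.* (ℚ.- ((sign d ℤ.* + N′) / b))       ≡⟨ ℚₚ.neg-distribʳ-* (ν b) _ ⟨
    ℚ.- (ν b ℚ.* ((sign d ℤ.* + N′) / b))       ≡⟨ cong (λ x → ℚ.- (x ℚ.* ((sign d ℤ.* + N′) / b))) (ν≡/1 b) ⟩
    ℚ.- ((+ b / 1) ℚ.* ((sign d ℤ.* + N′) / b)) ≡⟨ cong ℚ.-_ (/1-cancel (sign d ℤ.* + N′) b) ⟩
    ℚ.- ((sign d ℤ.* + N′) / 1)                 ≡⟨ cong ℚ.-_ (/1-* (sign d) (+ N′)) ⟨
    ℚ.- ((sign d / 1) ℚ.* (+ N′ / 1))           ≡⟨ cong₂ (λ x y → ℚ.- (x ℚ.* y)) (sign≡ d) (ν≡/1 N′) ⟨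
    ℚ.- ((ℚ.- 1ℚ) ^ d ℚ.* ν N′)                 ≡⟨ neg ((ℚ.- 1ℚ) ^ d) (ν N′) ⟩
    (ℚ.- 1ℚ) ^ suc d ℚ.* ν N′                   ≡⟨ cong₂ (λ x y → (ℚ.- 1ℚ) ^ suc d ℚ.* ν ((b C x) ℕ.* (b C y))) (ℕₚ.+-comm d 2) (ℕₚ.+-comm d 1) ⟩
    (ℚ.- 1ℚ) ^ suc d ℚ.* ν ((b C suc (suc d)) ℕ.* (b C suc d)) ∎
    where
    N′ = (b C (d ℕ.+ 2)) ℕ.* (b C (d ℕ.+ 1))
    neg : ∀ s x → ℚ.- (s ℚ.* x) ≡ (ℚ.- 1ℚ) ℚ.* s ℚ.* x
    neg s x = trans (cong ℚ.-_ (sym (ℚₚ.*-identityˡ (s ℚ.* x)))) (trans (ℚₚ.neg-distribˡ-* 1ℚ (s ℚ.* x)) (sym (ℚₚ.*-assoc (ℚ.- 1ℚ) s x)))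

  count≡F : ∀ n k (m : Vec ℕ (suc n)) → (∀ i → b ≤ lookup m i) →
    ∃[ N ] HasCardinality (Admissible b k m) N × (+ N / 1) ≡ F b k m
  count≡F n k m b≤m = proj₁ counted , proj₁ (proj₂ counted) , trans (sym (ν≡/1 (proj₁ counted))) (trans (proj₂ (proj₂ counted)) formula≡F)
    where
    g w : ℕ → ℚ
    g = 1-u·innerSum b
    w = recip g
    Q : Fin (suc n) → ℕ → ℚ
    Q = vertexSeries b m
    counted : Cardinality.Card ℚ-ring (Admissible b k m) (ν (n !) ℚ.* (Y ^ˢ k ⋆ (∏ Q full ⋆ w ^ˢ suc n)) n)
    counted = Tuples.card-formula ℚ-ring ℚ-torsionFree n b′ k m g w Q b≤m
      (λ i b<m j → q-labeled b (lookup m i) j b<m)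
      (λ i m≡b j → trans (cong (λ x → q b j (+ x)) m≡b) (trans (q-special b j) (1ₛ≡ j)))
      g-narayana
      (λ d → trans (S.*-comm w g d) (⋆-recip g refl d))
    formula≡F : ν (n !) ℚ.* (Y ^ˢ k ⋆ (∏ Q full ⋆ w ^ˢ suc n)) n ≡ F b k m
    formula≡F = begin
      ν (n !) ℚ.* (Y ^ˢ k ⋆ (∏ Q full ⋆ w ^ˢ suc n)) n
        ≡⟨ cong₂ ℚ._*_ (ν≡/1 (n !)) (S.*-congˡ {Y ^ˢ k} (S.*-congˡ {∏ Q full} (λ d → sym (recip-^ g refl (suc n) d))) n) ⟩
      (+ (n !) / 1) ℚ.* (Y ^ˢ k ⋆ (∏ Q full ⋆ recip (g ^ₛ suc n))) n
        ≡⟨ cong ((+ (n !) / 1) ℚ.*_) (ΣVec-∏ b (suc n) m (suc n) k n (recip (g ^ₛ suc n)) (ℕₚ.n<1+n n)) ⟨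
      F b k m ∎

proposition3p8 : (n b k : ℕ) .{{_ : NonZero b}} (m : Vec ℕ (suc n)) → (∀ i → b ≤ lookup m i) →
    (∃[ N ] HasCardinality (Admissible b k m) N × (+ N / 1) ≡ F b k m)
    × ((j : ℕ) (x : ℤ) → q b j x ≡ qProduct b j x)
proposition3p8 n zero k {{b≢0}} m b≤m = ⊥-elim-irr (NonZero.nonZero b≢0)
proposition3p8 n (suc b′) k m b≤m = count≡F b′ n k m b≤m , q≡qProduct (suc b′)
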